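{- Suppose $k\ge 17$ is odd, and $D$ is a dominating set of cardinality at most $2k+1$ for $\Delta_k$. Then there is a vertex $v\notin D$ such that defenders (guards) cannot reconfigure from $D$ to any dominating set that contains $v$. Therefore, $\gamma_{\mathrm{all}}^\infty(\Delta_k)\ge 2k+2=\gamma(\Delta_k)+2$.
   Context: For odd $k\ge 3$, let $G_k=\langle \rho,\tau,a : \rho^k=\tau^2=a^k=e,\ a\in Z(G_k),\ \tau\rho=\rho^{ -1}\tau\rangle\cong D_{2k}\times C_k$, of order $2k^2$ ($D_{2k}$ is the dihedral group of order $2k$, $e$ the identity). Let $b\notin G_k$ be an element of order 2 centralising $G_k$, so $\langle G_k,b\rangle=G_k\times\langle b\rangle\cong D_{2k}\times C_{2k}$ has order $4k^2$. For a group $G$ and an inverse-closed subset $S\subseteq G$, $\mathrm{Cay}(G,S)$ is the graph with vertex set $G$ and an edge from $u$ to $us$ for every $u\in G$, $s\in S$. Let $S_k=\{\tau a^i,\rho^ia^i : 1\le i\le k-1\}\cup\{\rho\tau a,\rho\tau a^{ -1}\}$, $T_k=(S_k\setminus\{\rho a,\rho^{ -1}a^{ -1}\})\cup\{\rho ab,\rho^{ -1}a^{ -1}b\}$, and $\Delta_k=\mathrm{Cay}(\langle G_k,b\rangle,T_k)$. A vertex $u$ dominates a vertex $w$ if $w=u$ or $w$ is adjacent to $u$. A dominating set is a set $D$ of vertices such that every vertex is dominated by at least one vertex of $D$; $\gamma(\Gamma)$ is the smallest size of a dominating set of $\Gamma$. Guards located at the vertices of a set $D$ (one guard per vertex) can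 reconfigure to a set $D'$ if there is a bijection $f:D\to D'$ such that for every $d\in D$, either $f(d)=d$ or $f(d)$ is adjacent to $d$. An eternal dominating configuration for $\Gamma$ is a nonempty collection $\mathcal D$ of subsets of $V(\Gamma)$, all of the same cardinality, such that for every $D_i\in\mathcal D$ and every vertex $w\notin D_i$ there is $D_j\in\mathcal D$ with $w\in D_j$ such that guards at $D_i$ can reconfigure to $D_j$. An eternal dominating set is a member of some eternal dominating configuration. The eternal domination number $\gamma_{\mathrm{all}}^\infty(\Gamma)$ is the smallest cardinality of an eternal dominating set. -}

module Defs where

open import Level using (Level; 0ℓ)
open import Algebra.Bundles using (AbelianGroup; Group)
open import Algebra.Structures using (IsGroup; IsAbelianGroup)
import Algebra.Definitions.RawMonoid as RawMonoidDefs
import Algebra.Properties.Group as GroupProperties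
import Algebra.Properties.Monoid.Mult as MonoidMult
import Algebra.Properties.AbelianGroup as AbelianGroupProperties
open import Data.Bool using (Bool; true; false; not; _xor_; if_then_else_)
open import Data.Bool.Properties using (xor-assoc; xor-identityʳ; xor-inverseˡ; xor-inverseʳ)
import Data.Bool.Properties as Bool
open import Data.Fin as Fin using (Fin; toℕ)
open import Data.Fin.Properties as Fin using (toℕ-injective; toℕ-fromℕ<; toℕ<n; 2↔Bool; *↔×)
open import Data.Fin.Subset as Subset using (Subset; inside; outside; ∣_∣; ⊤)
import Data.Fin.Subset.Properties as Subset
open import Data.List using (List; []; _∷_; _++_; map; filter; length)
open import Data.List.Membership.Propositional as List using ()
open import Data.List.Membership.Propositional.Properties using (∈-++⁺ˡ; ∈-++⁺ʳ; ∈-map⁺; ∈-filter⁺; ∈-filter⁻)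
open import Data.List.Properties using (filter-notAll)
open import Data.List.Relation.Unary.All as All using (All; []; _∷_)
open import Data.List.Relation.Unary.All.Properties using (¬All⇒Any¬)
open import Data.List.Relation.Unary.Any using (here; there)
open import Data.Nat using (ℕ; zero; suc; _+_; _*_; _∸_; _%_; _≤_; _<_; z≤n; s≤s; NonZero; _≤?_)
open import Data.Nat.DivMod using (_mod_; %-distribˡ-+; m%n%n≡m%n; m<n⇒m%n≡m; n%n≡0; m%n<n)
open import Data.Nat.Induction using (<-wellFounded)
import Data.Nat.Properties as ℕ
open import Data.Nat.Solver using (module +-*-Solver)
open import Data.Product using (Σ; ∃; ∃-syntax; ∃₂; _×_; _,_; proj₁; proj₂)
open import Data.Product.Function.NonDependent.Propositional using (_×-↔_)
open import Data.Sum using (_⊎_; inj₁; inj₂)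
open import Data.Vec as Vec using (Vec; []; _∷_; lookup; tabulate)
open import Data.Vec.Properties using (lookup∘tabulate; ≡-dec)
open import Data.Vec.Properties.WithK using ([]=-irrelevant)
open import Function.Base using (_∘_; id)
open import Function.Bundles using (Inverse; Bijection; _↔_; _⤖_; mk⤖)
open import Function.Construct.Composition using (_↔-∘_)
open import Function.Construct.Identity using (↔-id)
open import Function.Construct.Symmetry using (↔-sym)
open import Function.Properties.Inverse using (↔⇒↣)
open import Induction.WellFounded using (Acc; acc)
open import Relation.Binary.Definitions using (DecidableEquality; Symmetric)
import Relation.Binary.Definitions as Binary
open import Relation.Binary.PropositionalEquality
open import Relation.Nullary using (¬_; Dec; yes; no; contradiction)
open import Relation.Nullary.Decidable using (map′; _×-dec_; _⊎-dec_; ¬?; decidable-stable; via-injection)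
open import Relation.Unary using (Pred; Decidable; ｛_｝; _∪_; _∖_)

IsLeast : ∀ {ℓ} → Pred ℕ ℓ → Pred ℕ ℓ
IsLeast P m = P m × (∀ n → P n → m ≤ n)

least : ∀ {ℓ} {P : Pred ℕ ℓ} → Decidable P → ∃ P → ∃ (IsLeast P)
least {P = P} P? (n , Pn) with below (suc n)
  where
  below : ∀ b → (∀ m → m < b → ¬ P m) ⊎ ∃ (IsLeast P)
  below zero = inj₁ λ _ ()
  below (suc b) with below b
  ... | inj₂ found = inj₂ found
  ... | inj₁ none with P? b
  ...   | yes Pb = inj₂ (b , Pb , λ m Pm → ℕ.≮⇒≥ λ m<b → none m m<b Pm)
  ...   | no ¬Pb = inj₁ λ m m<1+b Pm → ¬Pb (subst P (ℕ.≤-antisym (ℕ.≤-pred m<1+b) (ℕ.≮⇒≥ λ m<b → none m m<b Pm)) Pm)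
... | inj₁ none  = contradiction Pn (none n ℕ.≤-refl)
... | inj₂ found = found

module Search {A : Set} {n : ℕ} (enum : A ↔ Fin n) where

  open Inverse enum

  infix 4 _≟_

  _≟_ : DecidableEquality A
  _≟_ = via-injection (↔⇒↣ enum) Fin._≟_

  any? : ∀ {ℓ} {P : Pred A ℓ} → Decidable P → Dec (∃ P)
  any? {P = P} P? = map′
    (λ (i , p) → from i , p)
    (λ (x , p) → to x , subst P (sym (strictlyInverseʳ x)) p)
    (Fin.any? (P? ∘ from))

  all? : ∀ {ℓ} {P : Pred A ℓ} → Decidable P → Dec (∀ x → P x)
  all? {P = P} P? = map′
    (λ h x → subst P (strictlyInverseʳ x) (h (to x)))
    (λ h i → h (from i))
    (Fin.all? (P? ∘ from))

anyVec? : ∀ {ℓ m n} {P : Pred (Vec (Fin n) m) ℓ} → Decidable P → Dec (∃ P)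
anyVec? {m = zero} P? = map′ ([] ,_) (λ { ([] , p) → p }) (P? [])
anyVec? {m = suc m} P? = map′
  (λ (x , xs , p) → x ∷ xs , p)
  (λ { (x ∷ xs , p) → x , xs , p })
  (Fin.any? λ x → anyVec? λ xs → P? (x ∷ xs))

allSubsets : ∀ n → List (Subset n)
allSubsets zero    = [] ∷ []
allSubsets (suc n) = map (inside ∷_) (allSubsets n) ++ map (outside ∷_) (allSubsets n)

∈-allSubsets : ∀ {n} (p : Subset n) → p List.∈ allSubsets n
∈-allSubsets []            = here refl
∈-allSubsets (inside ∷ p)  = ∈-++⁺ˡ (∈-map⁺ (inside ∷_) (∈-allSubsets p))
∈-allSubsets (outside ∷ p) = ∈-++⁺ʳ (map (inside ∷_) (allSubsets _)) (∈-map⁺ (outside ∷_) (∈-allSubsets p))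

record Graph : Set₁ where
  infix 4 _~_
  field
    Vertex : Set
    order  : ℕ
    enum   : Vertex ↔ Fin order
    _~_    : Vertex → Vertex → Set
    _~?_   : Binary.Decidable _~_
    ~-sym  : Symmetric _~_

module Domination (Γ : Graph) where

  open Graph Γ
  open Inverse enum using (to; from; strictlyInverseˡ; strictlyInverseʳ)
  open Search enum

  -- Sets of vertices, as sets of indices with respect to the enumeration.
  VertexSet : Set
  VertexSet = Subset order

  infix 4 _∈ᵛ_ _∉ᵛ_

  _∈ᵛ_ : Vertex → VertexSet → Set
  v ∈ᵛ D = to v Subset.∈ D

  _∉ᵛ_ : Vertex → VertexSet → Set
  v ∉ᵛ D = ¬ (v ∈ᵛ D)

  Dominates : Vertex → Vertex → Set
  Dominates u w = w ≡ u ⊎ u ~ w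

  Dominating : VertexSet → Set
  Dominating D = ∀ w → ∃[ u ] (u ∈ᵛ D × Dominates u w)

  Guard : VertexSet → Set
  Guard D = Σ Vertex (_∈ᵛ D)

  Reconfigure : VertexSet → VertexSet → Set
  Reconfigure D D′ = Σ (Guard D ⤖ Guard D′) λ f → ∀ (d : Guard D) →
    proj₁ (Bijection.to f d) ≡ proj₁ d ⊎ proj₁ d ~ proj₁ (Bijection.to f d)

  -- Members need not be assumed dominating: this follows from defends.
  record EternalDominatingConfiguration (𝒟 : Pred VertexSet 0ℓ) : Set where
    field
      nonempty        : ∃ 𝒟
      sameCardinality : ∀ D D′ → 𝒟 D → 𝒟 D′ → ∣ D ∣ ≡ ∣ D′ ∣
      defends         : ∀ D → 𝒟 D → ∀ w → w ∉ᵛ D →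
                        ∃[ D′ ] (𝒟 D′ × w ∈ᵛ D′ × Reconfigure D D′)

  EternalDominatingSet : VertexSet → Set₁
  EternalDominatingSet D = Σ (Pred VertexSet 0ℓ) λ 𝒟 → EternalDominatingConfiguration 𝒟 × 𝒟 D

  DominatingSize : Pred ℕ 0ℓ
  DominatingSize m = ∃[ D ] (Dominating D × ∣ D ∣ ≡ m)

  EternalDominatingSize : ℕ → Set₁
  EternalDominatingSize m = ∃[ D ] (EternalDominatingSet D × ∣ D ∣ ≡ m)

  -- Both predicates on sizes are decidable and hold for the size of the
  -- whole vertex set, so that their least elements exist.

  ∈ᵛ? : ∀ v D → Dec (v ∈ᵛ D)
  ∈ᵛ? v D = to v Subset.∈? D

  ∈ᵛ-⊤ : ∀ v → v ∈ᵛ ⊤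
  ∈ᵛ-⊤ v = Subset.∈⊤

  dominatingSize? : Decidable DominatingSize
  dominatingSize? m = Subset.anySubset? λ D →
    all? (λ w → any? λ u → ∈ᵛ? u D ×-dec ((w ≟ u) ⊎-dec (u ~? w))) ×-dec (∣ D ∣ ℕ.≟ m)

  dominatingSize-⊤ : ∃ DominatingSize
  dominatingSize-⊤ = ∣ ⊤ {order} ∣ , ⊤ , (λ w → w , ∈ᵛ-⊤ w , inj₁ refl) , refl

  guard-≡ : ∀ {D} {g h : Guard D} → proj₁ g ≡ proj₁ h → g ≡ h
  guard-≡ {D} {v , p} {_ , q} refl = cong (v ,_) ([]=-irrelevant p q)

  private
    applyVec : Vec (Fin order) order → Vertex → Vertex
    applyVec t v = from (lookup t (to v))

    MovedBy : VertexSet → VertexSet → Vec (Fin order) order → Set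
    MovedBy D D′ t =
        (∀ d → (¬ d ∈ᵛ D) ⊎ (applyVec t d ∈ᵛ D′ × (applyVec t d ≡ d ⊎ d ~ applyVec t d)))
      × (∀ c d → (¬ c ∈ᵛ D) ⊎ (¬ d ∈ᵛ D) ⊎ (¬ applyVec t c ≡ applyVec t d) ⊎ c ≡ d)
      × (∀ d′ → (¬ d′ ∈ᵛ D′) ⊎ (∃[ d ] (d ∈ᵛ D × applyVec t d ≡ d′)))

    movedBy? : ∀ D D′ → Decidable (MovedBy D D′)
    movedBy? D D′ t =
            all? (λ d → ¬? (∈ᵛ? d D) ⊎-dec (∈ᵛ? (applyVec t d) D′ ×-dec ((applyVec t d ≟ d) ⊎-dec (d ~? applyVec t d))))
      ×-dec all? (λ c → all? λ d → ¬? (∈ᵛ? c D) ⊎-dec ¬? (∈ᵛ? d D) ⊎-dec ¬? (applyVec t c ≟ applyVec t d) ⊎-dec (c ≟ d))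
      ×-dec all? (λ d′ → ¬? (∈ᵛ? d′ D′) ⊎-dec any? λ d → ∈ᵛ? d D ×-dec (applyVec t d ≟ d′))

    moved⇒reconfigure : ∀ {D D′} → ∃ (MovedBy D D′) → Reconfigure D D′
    moved⇒reconfigure {D} {D′} (t , move , inj , surj) = mk⤖ {to = f} (f-injective , f-surjective) , λ (d , p) → proj₂ (moved d p)
      where
      moved : ∀ d → d ∈ᵛ D → applyVec t d ∈ᵛ D′ × (applyVec t d ≡ d ⊎ d ~ applyVec t d)
      moved d p with move d
      ... | inj₁ ¬p = contradiction p ¬p
      ... | inj₂ q  = q
      f : Guard D → Guard D′
      f (d , p) = applyVec t d , proj₁ (moved d p)
      f-injective : ∀ {g h} → f g ≡ f h → g ≡ h
      f-injective {c , p} {d , q} eq with inj c d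
      ... | inj₁ ¬p                = contradiction p ¬p
      ... | inj₂ (inj₁ ¬q)         = contradiction q ¬q
      ... | inj₂ (inj₂ (inj₁ ne))  = contradiction (cong proj₁ eq) ne
      ... | inj₂ (inj₂ (inj₂ c≡d)) = guard-≡ c≡d
      f-surjective : ∀ h → ∃[ g ] (∀ {g′} → g′ ≡ g → f g′ ≡ h)
      f-surjective (d′ , q) with surj d′
      ... | inj₁ ¬q           = contradiction q ¬q
      ... | inj₂ (d , p , eq) = (d , p) , λ { refl → guard-≡ eq }

    reconfigure⇒moved : ∀ {D D′} → Reconfigure D D′ → ∃ (MovedBy D D′)
    reconfigure⇒moved {D} {D′} (f , near) = t , move , inj , surj
      where
      open Bijection f using (injective; strictlySurjective) renaming (to to f⟨_⟩)
      w : Vertex → Vertex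
      w v with ∈ᵛ? v D
      ... | yes p = proj₁ (f⟨ v , p ⟩)
      ... | no _  = v
      w-∈ : ∀ v (p : v ∈ᵛ D) → w v ≡ proj₁ (f⟨ v , p ⟩)
      w-∈ v p with ∈ᵛ? v D
      ... | yes q = cong (λ r → proj₁ (f⟨ v , r ⟩)) ([]=-irrelevant q p)
      ... | no ¬p = contradiction p ¬p
      t : Vec (Fin order) order
      t = tabulate (to ∘ w ∘ from)
      apply-t : ∀ v → applyVec t v ≡ w v
      apply-t v = trans (cong from (lookup∘tabulate (to ∘ w ∘ from) (to v)))
                 (trans (strictlyInverseʳ _) (cong w (strictlyInverseʳ v)))
      apply-∈ : ∀ v (p : v ∈ᵛ D) → applyVec t v ≡ proj₁ (f⟨ v , p ⟩)
      apply-∈ v p = trans (apply-t v) (w-∈ v p)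
      move : ∀ d → (¬ d ∈ᵛ D) ⊎ (applyVec t d ∈ᵛ D′ × (applyVec t d ≡ d ⊎ d ~ applyVec t d))
      move d with ∈ᵛ? d D
      ... | no ¬p = inj₁ ¬p
      ... | yes p rewrite apply-∈ d p = inj₂ (proj₂ (f⟨ d , p ⟩) , near (d , p))
      inj : ∀ c d → (¬ c ∈ᵛ D) ⊎ (¬ d ∈ᵛ D) ⊎ (¬ applyVec t c ≡ applyVec t d) ⊎ c ≡ d
      inj c d with ∈ᵛ? c D | ∈ᵛ? d D | applyVec t c ≟ applyVec t d
      ... | no ¬p | _     | _      = inj₁ ¬p
      ... | yes _ | no ¬q | _      = inj₂ (inj₁ ¬q)
      ... | yes _ | yes _ | no ne  = inj₂ (inj₂ (inj₁ ne))
      ... | yes p | yes q | yes eq = inj₂ (inj₂ (inj₂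
        (cong proj₁ (injective (guard-≡ (trans (sym (apply-∈ c p)) (trans eq (apply-∈ d q))))))))
      surj : ∀ d′ → (¬ d′ ∈ᵛ D′) ⊎ (∃[ d ] (d ∈ᵛ D × applyVec t d ≡ d′))
      surj d′ with ∈ᵛ? d′ D′
      ... | no ¬q = inj₁ ¬q
      ... | yes q with strictlySurjective (d′ , q)
      ...   | (d , p) , eq = inj₂ (d , p , trans (apply-∈ d p) (cong proj₁ eq))

  reconfigure? : Binary.Decidable Reconfigure
  reconfigure? D D′ = map′ moved⇒reconfigure reconfigure⇒moved (anyVec? (movedBy? D D′))

  reconfigure-refl : ∀ D → Reconfigure D D
  reconfigure-refl D = mk⤖ {to = id} (id , λ g → g , id) , λ _ → inj₁ refl

  private
    Defends : List VertexSet → VertexSet → Set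
    Defends L D = ∀ w → w ∈ᵛ D ⊎ (∃[ D′ ] (D′ List.∈ L × w ∈ᵛ D′ × Reconfigure D D′))

    infix 4 _≟ˢ_
    _≟ˢ_ : DecidableEquality VertexSet
    _≟ˢ_ = ≡-dec Bool._≟_

    defends? : ∀ L → Decidable (Defends L)
    defends? L D = all? λ w → ∈ᵛ? w D ⊎-dec Subset.anySubset? λ D′ →
      (D′ ∈? L) ×-dec ∈ᵛ? w D′ ×-dec reconfigure? D D′
      where open import Data.List.Membership.DecPropositional _≟ˢ_ using (_∈?_)

    -- Sets that cannot answer every attack within the current list are
    -- discarded until the list is empty or an eternal dominating
    -- configuration; no configuration of sets of size m ever loses a member.
    prune : ∀ m (L : List VertexSet) → Acc _<_ (length L) →
            (∀ {D} → D List.∈ L → ∣ D ∣ ≡ m) →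
            (∀ {𝒟} → EternalDominatingConfiguration 𝒟 → (∀ {D} → 𝒟 D → ∣ D ∣ ≡ m) → ∀ {D} → 𝒟 D → D List.∈ L) →
            Dec (EternalDominatingSize m)
    prune m L (acc rs) size covers with All.all? (defends? L) L
    prune m [] _ size covers | yes _ = no none
      where
      none : ¬ EternalDominatingSize m
      none (D , (𝒟 , conf , D∈𝒟) , ∣D∣≡m)
        with () ← covers conf (λ D′∈𝒟 → trans (EternalDominatingConfiguration.sameCardinality conf _ _ D′∈𝒟 D∈𝒟) ∣D∣≡m) D∈𝒟
    prune m L@(D₀ ∷ _) _ size covers | yes ok = yes (D₀ , ((List._∈ L) , conf , here refl) , size (here refl))
      where
      defends : ∀ D → D List.∈ L → ∀ w → w ∉ᵛ D → ∃[ D′ ] (D′ List.∈ L × w ∈ᵛ D′ × Reconfigure D D′)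
      defends D D∈L w w∉D with All.lookup ok D∈L w
      ... | inj₁ w∈D    = contradiction w∈D w∉D
      ... | inj₂ answer = answer
      conf : EternalDominatingConfiguration (List._∈ L)
      conf = record
        { nonempty        = D₀ , here refl
        ; sameCardinality = λ _ _ D∈L D′∈L → trans (size D∈L) (sym (size D′∈L))
        ; defends         = defends
        }
    prune m L (acc rs) size covers | no ¬ok =
      prune m (filter (defends? L) L) (rs (filter-notAll (defends? L) L (¬All⇒Any¬ (defends? L) L ¬ok)))
        (λ D∈ → size (proj₁ (∈-filter⁻ (defends? L) D∈)))
        (λ conf sizes D∈𝒟 → ∈-filter⁺ (defends? L) (covers conf sizes D∈𝒟) (kept conf sizes D∈𝒟))
      where
      kept : ∀ {𝒟} → EternalDominatingConfiguration 𝒟 → (∀ {D} → 𝒟 D → ∣ D ∣ ≡ m) → ∀ {D} → 𝒟 D → Defends L D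
      kept conf sizes {D} D∈𝒟 w with ∈ᵛ? w D
      ... | yes w∈D = inj₁ w∈D
      ... | no w∉D with EternalDominatingConfiguration.defends conf D D∈𝒟 w w∉D
      ...   | D′ , D′∈𝒟 , w∈D′ , D⇝D′ = inj₂ (D′ , covers conf sizes D′∈𝒟 , w∈D′ , D⇝D′)

  eternalDominatingSize? : Decidable EternalDominatingSize
  eternalDominatingSize? m = prune m candidates (<-wellFounded _)
      (λ D∈ → proj₂ (∈-filter⁻ size? {xs = allSubsets order} D∈))
      (λ _ sizes D∈𝒟 → ∈-filter⁺ size? (∈-allSubsets _) (sizes D∈𝒟))
    where
    size? : Decidable (λ (D : VertexSet) → ∣ D ∣ ≡ m)
    size? D = ∣ D ∣ ℕ.≟ m
    candidates : List VertexSet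
    candidates = filter size? (allSubsets order)

  eternalDominatingSize-⊤ : ∃ EternalDominatingSize
  eternalDominatingSize-⊤ = ∣ ⊤ {order} ∣ , ⊤ , ((_≡ ⊤) , conf , refl) , refl
    where
    conf : EternalDominatingConfiguration (_≡ ⊤)
    conf = record
      { nonempty        = ⊤ , refl
      ; sameCardinality = λ { _ _ refl refl → refl }
      ; defends         = λ { _ refl w w∉⊤ → contradiction (∈ᵛ-⊤ w) w∉⊤ }
      }

  abstract
    γ-least : ∃ (IsLeast DominatingSize)
    γ-least = least dominatingSize? dominatingSize-⊤

    γ∞all-least : ∃ (IsLeast EternalDominatingSize)
    γ∞all-least = least eternalDominatingSize? eternalDominatingSize-⊤

  γ : ℕ
  γ = proj₁ γ-least

  γ∞all : ℕ
  γ∞all = proj₁ γ∞all-least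

record FiniteGroup : Set₁ where
  infixl 7 _∙_
  infix  8 _⁻¹
  field
    Carrier : Set
    _∙_     : Carrier → Carrier → Carrier
    ε       : Carrier
    _⁻¹     : Carrier → Carrier
    isGroup : IsGroup _≡_ _∙_ ε _⁻¹
    order   : ℕ
    enum    : Carrier ↔ Fin order

  group : Group 0ℓ 0ℓ
  group = record { isGroup = isGroup }

  open IsGroup isGroup public using (assoc; identityˡ; identityʳ; inverseˡ; inverseʳ)
  open Search enum public using (_≟_; any?; all?)

  infixr 8 _^_

  _^_ : Carrier → ℕ → Carrier
  x ^ n = RawMonoidDefs._×_ (Group.rawMonoid group) n x

module _ (G : FiniteGroup) where

  open FiniteGroup G

  Cay : (S : Pred Carrier 0ℓ) → Decidable S → (∀ {s} → S s → S (s ⁻¹)) → Graph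
  Cay S S? S⁻¹⊆S = record
    { Vertex = Carrier
    ; order  = order
    ; enum   = enum
    ; _~_    = _~_
    ; _~?_   = λ u v → any? λ s → S? s ×-dec (v ≟ (u ∙ s))
    ; ~-sym  = ~-sym
    }
    where
    _~_ : Carrier → Carrier → Set
    u ~ v = ∃[ s ] (S s × v ≡ u ∙ s)
    ~-sym : Symmetric _~_
    ~-sym {u} (s , s∈S , refl) = s ⁻¹ , S⁻¹⊆S s∈S , sym
      (trans (assoc u s (s ⁻¹)) (trans (cong (u ∙_) (inverseʳ s)) (identityʳ u)))

infixr 6 _×ᴳ_

_×ᴳ_ : FiniteGroup → FiniteGroup → FiniteGroup
G ×ᴳ H = record
  { Carrier = G.Carrier × H.Carrier
  ; _∙_     = λ (g , h) (g′ , h′) → g G.∙ g′ , h H.∙ h′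
  ; ε       = G.ε , H.ε
  ; _⁻¹     = λ (g , h) → g G.⁻¹ , h H.⁻¹
  ; isGroup = record
    { isMonoid = record
      { isSemigroup = record
        { isMagma = record { isEquivalence = isEquivalence ; ∙-cong = cong₂ _ }
        ; assoc   = λ (g , h) (g′ , h′) (g″ , h″) → cong₂ _,_ (G.assoc g g′ g″) (H.assoc h h′ h″)
        }
      ; identity = (λ (g , h) → cong₂ _,_ (G.identityˡ g) (H.identityˡ h))
                 , (λ (g , h) → cong₂ _,_ (G.identityʳ g) (H.identityʳ h))
      }
    ; inverse = (λ (g , h) → cong₂ _,_ (G.inverseˡ g) (H.inverseˡ h))
              , (λ (g , h) → cong₂ _,_ (G.inverseʳ g) (H.inverseʳ h))
    ; ⁻¹-cong = cong λ (g , h) → g G.⁻¹ , h H.⁻¹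
    }
  ; order = G.order * H.order
  ; enum  = ↔-sym *↔× ↔-∘ (G.enum ×-↔ H.enum)
  }
  where
  module G = FiniteGroup G
  module H = FiniteGroup H

module _ (n : ℕ) .{{_ : NonZero n}} where

  infixl 6 _+ₙ_

  _+ₙ_ : Fin n → Fin n → Fin n
  x +ₙ y = (toℕ x + toℕ y) mod n

  0ₙ : Fin n
  0ₙ = 0 mod n

  -ₙ_ : Fin n → Fin n
  -ₙ x = (n ∸ toℕ x) mod n

  mod-cong : ∀ {p q} → p % n ≡ q % n → p mod n ≡ q mod n
  mod-cong {p} {q} eq = toℕ-injective
    (trans (toℕ-fromℕ< (m%n<n p n)) (trans eq (sym (toℕ-fromℕ< (m%n<n q n)))))

  mod-toℕ : ∀ x → toℕ x mod n ≡ x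
  mod-toℕ x = toℕ-injective (trans (toℕ-fromℕ< (m%n<n (toℕ x) n)) (m<n⇒m%n≡m (toℕ<n x)))

  mod-+ : ∀ p q → (p mod n) +ₙ (q mod n) ≡ (p + q) mod n
  mod-+ p q = mod-cong (begin
    (toℕ (p mod n) + toℕ (q mod n)) % n ≡⟨ cong₂ (λ a b → (a + b) % n) (toℕ-fromℕ< (m%n<n p n)) (toℕ-fromℕ< (m%n<n q n)) ⟩
    (p % n + q % n) % n                 ≡⟨ %-distribˡ-+ p q n ⟨
    (p + q) % n                         ∎)
    where open ≡-Reasoning

  mod-n : n mod n ≡ 0ₙ
  mod-n = mod-cong (trans (n%n≡0 n) (sym (m<n⇒m%n≡m (ℕ.n≢0⇒n>0 (≢-nonZero⁻¹ n)))))
    where open import Data.Nat using (≢-nonZero⁻¹)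

  +ₙ-assoc : ∀ x y z → (x +ₙ y) +ₙ z ≡ x +ₙ (y +ₙ z)
  +ₙ-assoc x y z = begin
    (x +ₙ y) +ₙ z                              ≡⟨ cong ((x +ₙ y) +ₙ_) (mod-toℕ z) ⟨
    (x +ₙ y) +ₙ (toℕ z mod n)                  ≡⟨ mod-+ (toℕ x + toℕ y) (toℕ z) ⟩
    (toℕ x + toℕ y + toℕ z) mod n              ≡⟨ cong (_mod n) (ℕ.+-assoc (toℕ x) (toℕ y) (toℕ z)) ⟩
    (toℕ x + (toℕ y + toℕ z)) mod n            ≡⟨ mod-+ (toℕ x) (toℕ y + toℕ z) ⟨
    (toℕ x mod n) +ₙ (y +ₙ z)                  ≡⟨ cong (_+ₙ (y +ₙ z)) (mod-toℕ x) ⟩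
    x +ₙ (y +ₙ z)                              ∎
    where open ≡-Reasoning

  +ₙ-comm : ∀ x y → x +ₙ y ≡ y +ₙ x
  +ₙ-comm x y = cong (_mod n) (ℕ.+-comm (toℕ x) (toℕ y))

  +ₙ-identityˡ : ∀ x → 0ₙ +ₙ x ≡ x
  +ₙ-identityˡ x = trans (cong (0ₙ +ₙ_) (sym (mod-toℕ x))) (trans (mod-+ 0 (toℕ x)) (mod-toℕ x))

  +ₙ-inverseˡ : ∀ x → (-ₙ x) +ₙ x ≡ 0ₙ
  +ₙ-inverseˡ x = begin
    (-ₙ x) +ₙ x               ≡⟨ cong ((-ₙ x) +ₙ_) (mod-toℕ x) ⟨
    (-ₙ x) +ₙ (toℕ x mod n)   ≡⟨ mod-+ (n ∸ toℕ x) (toℕ x) ⟩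
    (n ∸ toℕ x + toℕ x) mod n ≡⟨ cong (_mod n) (ℕ.m∸n+n≡m (ℕ.<⇒≤ (toℕ<n x))) ⟩
    n mod n                   ≡⟨ mod-n ⟩
    0ₙ                        ∎
    where open ≡-Reasoning

  +ₙ-isAbelianGroup : IsAbelianGroup _≡_ _+ₙ_ 0ₙ -ₙ_
  +ₙ-isAbelianGroup = record
    { isGroup = record
      { isMonoid = record
        { isSemigroup = record
          { isMagma = record { isEquivalence = isEquivalence ; ∙-cong = cong₂ _+ₙ_ }
          ; assoc   = +ₙ-assoc
          }
        ; identity = +ₙ-identityˡ , λ x → trans (+ₙ-comm x 0ₙ) (+ₙ-identityˡ x)
        }
      ; inverse = +ₙ-inverseˡ , λ x → trans (+ₙ-comm x (-ₙ x)) (+ₙ-inverseˡ x)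
      ; ⁻¹-cong = cong -ₙ_
      }
    ; comm = +ₙ-comm
    }

  +ₙ-abelianGroup : AbelianGroup 0ℓ 0ℓ
  +ₙ-abelianGroup = record { isAbelianGroup = +ₙ-isAbelianGroup }

  cyclic : FiniteGroup
  cyclic = record { isGroup = IsAbelianGroup.isGroup +ₙ-isAbelianGroup ; enum = ↔-id (Fin n) }

  -- The dihedral group of order 2n; (x , s) stands for ρ^x τ^s, and
  -- τ ρ^y = ρ^(-y) τ.

  twist : Bool → Fin n → Fin n
  twist s y = if s then -ₙ y else y

  dihedral : FiniteGroup
  dihedral = record
    { Carrier = Fin n × Bool
    ; _∙_     = λ (x , s) (y , t) → x +ₙ twist s y , s xor t
    ; ε       = 0ₙ , false
    ; _⁻¹     = λ (x , s) → twist s (-ₙ x) , s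
    ; isGroup = record
      { isMonoid = record
        { isSemigroup = record
          { isMagma = record { isEquivalence = isEquivalence ; ∙-cong = cong₂ _ }
          ; assoc   = λ (x , s) (y , t) (z , u) → cong₂ _,_ (twist-assoc x s y t z) (xor-assoc s t u)
          }
        ; identity = (λ (x , s) → cong (_, s) (+ₙ-identityˡ x))
                   , (λ (x , s) → cong₂ _,_ (trans (cong (x +ₙ_) (twist-0 s)) (A.identityʳ x)) (xor-identityʳ s))
        }
      ; inverse = (λ (x , s) → cong₂ _,_ (twist-inverseˡ x s) (Bool.xor-same s))
                , (λ (x , s) → cong₂ _,_ (twist-inverseʳ x s) (Bool.xor-same s))
      ; ⁻¹-cong = cong λ (x , s) → twist s (-ₙ x) , s
      }
    ; order = n * 2
    ; enum  = ↔-sym *↔× ↔-∘ (↔-id (Fin n) ×-↔ ↔-sym 2↔Bool)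
    }
    where
    module A = AbelianGroup +ₙ-abelianGroup
    open AbelianGroupProperties +ₙ-abelianGroup using (⁻¹-involutive; ε⁻¹≈ε; ⁻¹-∙-comm)
    open ≡-Reasoning
    twist-0 : ∀ s → twist s 0ₙ ≡ 0ₙ
    twist-0 false = refl
    twist-0 true  = ε⁻¹≈ε
    twist-+ : ∀ s y z → twist s (y +ₙ z) ≡ twist s y +ₙ twist s z
    twist-+ false y z = refl
    twist-+ true  y z = sym (⁻¹-∙-comm y z)
    twist-twist : ∀ s t z → twist (s xor t) z ≡ twist s (twist t z)
    twist-twist false t     z = refl
    twist-twist true  false z = refl
    twist-twist true  true  z = sym (⁻¹-involutive z)
    twist-assoc : ∀ x s y t z → (x +ₙ twist s y) +ₙ twist (s xor t) z ≡ x +ₙ twist s (y +ₙ twist t z)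
    twist-assoc x s y t z = begin
      (x +ₙ twist s y) +ₙ twist (s xor t) z      ≡⟨ cong ((x +ₙ twist s y) +ₙ_) (twist-twist s t z) ⟩
      (x +ₙ twist s y) +ₙ twist s (twist t z)    ≡⟨ +ₙ-assoc x (twist s y) (twist s (twist t z)) ⟩
      x +ₙ (twist s y +ₙ twist s (twist t z))    ≡⟨ cong (x +ₙ_) (twist-+ s y (twist t z)) ⟨
      x +ₙ twist s (y +ₙ twist t z)              ∎
    twist-inverseˡ : ∀ x s → twist s (-ₙ x) +ₙ twist s x ≡ 0ₙ
    twist-inverseˡ x s = trans (sym (twist-+ s (-ₙ x) x)) (trans (cong (twist s) (+ₙ-inverseˡ x)) (twist-0 s))
    twist-inverseʳ : ∀ x s → x +ₙ twist s (twist s (-ₙ x)) ≡ 0ₙ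
    twist-inverseʳ x s = begin
      x +ₙ twist s (twist s (-ₙ x)) ≡⟨ cong (x +ₙ_) (twist-twist s s (-ₙ x)) ⟨
      x +ₙ twist (s xor s) (-ₙ x)   ≡⟨ cong (λ b → x +ₙ twist b (-ₙ x)) (Bool.xor-same s) ⟩
      x +ₙ (-ₙ x)                   ≡⟨ A.inverseʳ x ⟩
      0ₙ                            ∎

module _ (k : ℕ) .{{_ : NonZero k}} where

  -- G_k is dihedral k ×ᴳ cyclic k, embedded as the elements with trivial
  -- last coordinate; (((x , s) , y) , z) stands for ρ^x τ^s a^y b^z.
  ⟨G,b⟩ : FiniteGroup
  ⟨G,b⟩ = (dihedral k ×ᴳ cyclic k) ×ᴳ cyclic 2

  open FiniteGroup ⟨G,b⟩

  private
    infixl 6 _+ₖ_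
    _+ₖ_ : Fin k → Fin k → Fin k
    _+ₖ_ = _+ₙ_ k

  ρ τ a b : Carrier
  ρ = ((1 mod k , false) , 0ₙ k) , 0ₙ 2
  τ = ((0ₙ k    , true ) , 0ₙ k) , 0ₙ 2
  a = ((0ₙ k    , false) , 1 mod k) , 0ₙ 2
  b = ((0ₙ k    , false) , 0ₙ k) , 1 mod 2

  S : Pred Carrier 0ℓ
  S = (λ g → ∃[ i ] (1 ≤ i × i ≤ k ∸ 1 × (g ≡ τ ∙ a ^ i ⊎ g ≡ ρ ^ i ∙ a ^ i)))
    ∪ ｛ ρ ∙ τ ∙ a ｝ ∪ ｛ ρ ∙ τ ∙ a ⁻¹ ｝

  T : Pred Carrier 0ℓ
  T = (S ∖ (｛ ρ ∙ a ｝ ∪ ｛ ρ ⁻¹ ∙ a ⁻¹ ｝)) ∪ (｛ ρ ∙ a ∙ b ｝ ∪ ｛ ρ ⁻¹ ∙ a ⁻¹ ∙ b ｝)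

  -- ⟨G,b⟩ is the intended group: ρ, τ, a, b satisfy the defining relations
  -- and generate, and the order 4k² is that of the presented group.

  private
    el-cong : ∀ {x x′ s s′ y y′ z z′} → x ≡ x′ → s ≡ s′ → y ≡ y′ → z ≡ z′ →
              _≡_ {A = Carrier} (((x , s) , y) , z) (((x′ , s′) , y′) , z′)
    el-cong refl refl refl refl = refl

    0+0 : 0ₙ k +ₖ 0ₙ k ≡ 0ₙ k
    0+0 = +ₙ-identityˡ k (0ₙ k)

    -0≡0 : -ₙ_ k (0ₙ k) ≡ 0ₙ k
    -0≡0 = GroupProperties.ε⁻¹≈ε (FiniteGroup.group (cyclic k))

    +-twist-0 : ∀ x s → x +ₖ twist k s (0ₙ k) ≡ x
    +-twist-0 x false = FiniteGroup.identityʳ (cyclic k) x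
    +-twist-0 x true  = trans (cong (x +ₖ_) -0≡0) (FiniteGroup.identityʳ (cyclic k) x)

  ρ^-coordinates : ∀ i → ρ ^ i ≡ (((i mod k , false) , 0ₙ k) , 0ₙ 2)
  ρ^-coordinates zero    = refl
  ρ^-coordinates (suc i) = trans (cong (ρ ∙_) (ρ^-coordinates i)) (el-cong (mod-+ k 1 i) refl 0+0 refl)

  a^-coordinates : ∀ i → a ^ i ≡ (((0ₙ k , false) , i mod k) , 0ₙ 2)
  a^-coordinates zero    = refl
  a^-coordinates (suc i) = trans (cong (a ∙_) (a^-coordinates i)) (el-cong 0+0 refl (mod-+ k 1 i) refl)

  ρ^k≡ε : ρ ^ k ≡ ε
  ρ^k≡ε = trans (ρ^-coordinates k) (el-cong (mod-n k) refl refl refl)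

  a^k≡ε : a ^ k ≡ ε
  a^k≡ε = trans (a^-coordinates k) (el-cong refl refl (mod-n k) refl)

  τ∙τ≡ε : τ ∙ τ ≡ ε
  τ∙τ≡ε = el-cong (trans (+ₙ-identityˡ k (-ₙ_ k (0ₙ k))) -0≡0) refl 0+0 refl

  b∙b≡ε : b ∙ b ≡ ε
  b∙b≡ε = el-cong 0+0 refl 0+0 refl

  τ∙ρ≡ρ⁻¹∙τ : τ ∙ ρ ≡ ρ ⁻¹ ∙ τ
  τ∙ρ≡ρ⁻¹∙τ = el-cong (+ₙ-comm k (0ₙ k) (-ₙ_ k (1 mod k))) refl
    (cong (_+ₖ 0ₙ k) (sym -0≡0)) refl

  Central : Carrier → Set
  Central c = ∀ g → c ∙ g ≡ g ∙ c

  private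
    central : ∀ y z → Central (((0ₙ k , false) , y) , z)
    central y z (((x , s) , y′) , z′) = el-cong
      (trans (+ₙ-identityˡ k x) (sym (+-twist-0 x s)))
      (sym (xor-identityʳ s)) (+ₙ-comm k y y′) (+ₙ-comm 2 z z′)

  a-central : Central a
  a-central = central (1 mod k) (0ₙ 2)

  b-central : Central b
  b-central = central (0ₙ k) (1 mod 2)

  generated : ∀ g → ∃[ i ] ∃[ s ] ∃[ j ] ∃[ t ] g ≡ ρ ^ i ∙ τ ^ s ∙ a ^ j ∙ b ^ t
  generated (((x , s) , y) , z) = toℕ x , toℕ (bit s) , toℕ y , toℕ z , sym (begin
    ρ ^ toℕ x ∙ τ ^ toℕ (bit s) ∙ a ^ toℕ y ∙ b ^ toℕ z
      ≡⟨ cong₂ _∙_ (cong₂ _∙_ (cong₂ _∙_ (ρ^-coordinates (toℕ x)) (τ^-coordinates s)) (a^-coordinates (toℕ y))) (b^-coordinates z) ⟩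
    (((toℕ x mod k , false) , 0ₙ k) , 0ₙ 2) ∙ (((0ₙ k , s) , 0ₙ k) , 0ₙ 2)
      ∙ (((0ₙ k , false) , toℕ y mod k) , 0ₙ 2) ∙ (((0ₙ k , false) , 0ₙ k) , z)
      ≡⟨ el-cong
           (trans (+-twist-0 _ (s xor false)) (trans (+-twist-0 _ s) (trans (+-twist-0 _ false) (mod-toℕ k x))))
           (trans (xor-identityʳ (s xor false)) (xor-identityʳ s))
           (trans (+-twist-0 _ false) (trans (cong (_+ₖ (toℕ y mod k)) 0+0) (trans (+ₙ-identityˡ k _) (mod-toℕ k y))))
           (+ₙ-identityˡ 2 z) ⟩
    (((x , s) , y) , z) ∎)
    where
    open ≡-Reasoning
    bit : Bool → Fin 2
    bit = Inverse.from 2↔Bool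
    τ^-coordinates : ∀ s → τ ^ toℕ (bit s) ≡ (((0ₙ k , s) , 0ₙ k) , 0ₙ 2)
    τ^-coordinates false = refl
    τ^-coordinates true  = identityʳ τ
    b^-coordinates : ∀ z → b ^ toℕ z ≡ (((0ₙ k , false) , 0ₙ k) , z)
    b^-coordinates Fin.zero           = refl
    b^-coordinates (Fin.suc Fin.zero) = identityʳ b

  order≡4k² : order ≡ 4 * (k * k)
  order≡4k² = solve 1 (λ κ → κ :* con 2 :* κ :* con 2 := con 4 :* (κ :* κ)) refl k
    where open +-*-Solver

  private
    inverse-of : ∀ x y → x ∙ y ≡ ε → x ⁻¹ ≡ y
    inverse-of x y eq = sym (GroupProperties.inverseʳ-unique group x y eq)

    cancel : ∀ x x′ c c′ → Central c → x ∙ x′ ≡ ε → c ∙ c′ ≡ ε → (x ∙ c) ∙ (x′ ∙ c′) ≡ ε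
    cancel x x′ c c′ c-central xx′ cc′ = begin
      (x ∙ c) ∙ (x′ ∙ c′) ≡⟨ assoc x c (x′ ∙ c′) ⟩
      x ∙ (c ∙ (x′ ∙ c′)) ≡⟨ cong (x ∙_) (assoc c x′ c′) ⟨
      x ∙ (c ∙ x′ ∙ c′)   ≡⟨ cong (λ g → x ∙ (g ∙ c′)) (c-central x′) ⟩
      x ∙ (x′ ∙ c ∙ c′)   ≡⟨ cong (x ∙_) (assoc x′ c c′) ⟩
      x ∙ (x′ ∙ (c ∙ c′)) ≡⟨ cong (λ g → x ∙ (x′ ∙ g)) cc′ ⟩
      x ∙ (x′ ∙ ε)        ≡⟨ cong (x ∙_) (identityʳ x′) ⟩
      x ∙ x′              ≡⟨ xx′ ⟩
      ε                   ∎
      where open ≡-Reasoning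

    a^-central : ∀ i → Central (a ^ i)
    a^-central i = subst Central (sym (a^-coordinates i)) (central (i mod k) (0ₙ 2))

    a⁻¹-central : Central (a ⁻¹)
    a⁻¹-central = subst (λ x → Central (((x , false) , -ₙ_ k (1 mod k)) , 0ₙ 2))
      (sym -0≡0) (central _ _)

    power-inverse : ∀ x i → x ^ k ≡ ε → i ≤ k → x ^ i ∙ x ^ (k ∸ i) ≡ ε
    power-inverse x i x^k≡ε i≤k = trans (sym (MonoidMult.×-homo-+ (Group.monoid group) x i (k ∸ i)))
      (trans (cong (x ^_) (ℕ.m+[n∸m]≡n i≤k)) x^k≡ε)

    ρτ∙ρτ≡ε : (ρ ∙ τ) ∙ (ρ ∙ τ) ≡ ε
    ρτ∙ρτ≡ε = begin
      (ρ ∙ τ) ∙ (ρ ∙ τ)     ≡⟨ assoc ρ τ (ρ ∙ τ) ⟩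
      ρ ∙ (τ ∙ (ρ ∙ τ))     ≡⟨ cong (ρ ∙_) (assoc τ ρ τ) ⟨
      ρ ∙ (τ ∙ ρ ∙ τ)       ≡⟨ cong (λ g → ρ ∙ (g ∙ τ)) τ∙ρ≡ρ⁻¹∙τ ⟩
      ρ ∙ (ρ ⁻¹ ∙ τ ∙ τ)    ≡⟨ cong (ρ ∙_) (assoc (ρ ⁻¹) τ τ) ⟩
      ρ ∙ (ρ ⁻¹ ∙ (τ ∙ τ))  ≡⟨ cong (λ g → ρ ∙ (ρ ⁻¹ ∙ g)) τ∙τ≡ε ⟩
      ρ ∙ (ρ ⁻¹ ∙ ε)        ≡⟨ cong (ρ ∙_) (identityʳ (ρ ⁻¹)) ⟩
      ρ ∙ ρ ⁻¹              ≡⟨ inverseʳ ρ ⟩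
      ε                     ∎
      where open ≡-Reasoning

    ρa∙ρ⁻¹a⁻¹≡ε : (ρ ∙ a) ∙ (ρ ⁻¹ ∙ a ⁻¹) ≡ ε
    ρa∙ρ⁻¹a⁻¹≡ε = cancel ρ (ρ ⁻¹) a (a ⁻¹) a-central (inverseʳ ρ) (inverseʳ a)

    ρ⁻¹a⁻¹∙ρa≡ε : (ρ ⁻¹ ∙ a ⁻¹) ∙ (ρ ∙ a) ≡ ε
    ρ⁻¹a⁻¹∙ρa≡ε = cancel (ρ ⁻¹) ρ (a ⁻¹) a a⁻¹-central (inverseˡ ρ) (inverseˡ a)

    ρa-inverse : (ρ ∙ a) ⁻¹ ≡ ρ ⁻¹ ∙ a ⁻¹
    ρa-inverse = inverse-of (ρ ∙ a) (ρ ⁻¹ ∙ a ⁻¹) ρa∙ρ⁻¹a⁻¹≡ε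

    ρ⁻¹a⁻¹-inverse : (ρ ⁻¹ ∙ a ⁻¹) ⁻¹ ≡ ρ ∙ a
    ρ⁻¹a⁻¹-inverse = inverse-of (ρ ⁻¹ ∙ a ⁻¹) (ρ ∙ a) ρ⁻¹a⁻¹∙ρa≡ε

    ⁻¹-swap : ∀ g h → h ≡ g ⁻¹ → h ⁻¹ ≡ g
    ⁻¹-swap g _ refl = GroupProperties.⁻¹-involutive group g

  S-inverse : ∀ {g} → S g → S (g ⁻¹)
  S-inverse (inj₁ (i , 1≤i , i≤k∸1 , form)) =
      inj₁ (k ∸ i , ℕ.m<n⇒0<n∸m i<k , ℕ.∸-monoʳ-≤ k 1≤i , inverted form)
    where
    i<k : i < k
    i<k = ℕ.≤-trans (s≤s i≤k∸1) (ℕ.≤-reflexive (ℕ.suc-pred k))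
    inverted : ∀ {g} → g ≡ τ ∙ a ^ i ⊎ g ≡ ρ ^ i ∙ a ^ i →
               g ⁻¹ ≡ τ ∙ a ^ (k ∸ i) ⊎ g ⁻¹ ≡ ρ ^ (k ∸ i) ∙ a ^ (k ∸ i)
    inverted (inj₁ refl) = inj₁ (inverse-of (τ ∙ a ^ i) (τ ∙ a ^ (k ∸ i))
      (cancel τ τ (a ^ i) (a ^ (k ∸ i)) (a^-central i) τ∙τ≡ε (power-inverse a i a^k≡ε (ℕ.<⇒≤ i<k))))
    inverted (inj₂ refl) = inj₂ (inverse-of (ρ ^ i ∙ a ^ i) (ρ ^ (k ∸ i) ∙ a ^ (k ∸ i))
      (cancel (ρ ^ i) (ρ ^ (k ∸ i)) (a ^ i) (a ^ (k ∸ i)) (a^-central i)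
      (power-inverse ρ i ρ^k≡ε (ℕ.<⇒≤ i<k)) (power-inverse a i a^k≡ε (ℕ.<⇒≤ i<k))))
  S-inverse (inj₂ (inj₁ refl)) = inj₂ (inj₂ (sym (inverse-of (ρ ∙ τ ∙ a) (ρ ∙ τ ∙ a ⁻¹)
    (cancel (ρ ∙ τ) (ρ ∙ τ) a (a ⁻¹) a-central ρτ∙ρτ≡ε (inverseʳ a)))))
  S-inverse (inj₂ (inj₂ refl)) = inj₂ (inj₁ (sym (inverse-of (ρ ∙ τ ∙ a ⁻¹) (ρ ∙ τ ∙ a)
    (cancel (ρ ∙ τ) (ρ ∙ τ) (a ⁻¹) a a⁻¹-central ρτ∙ρτ≡ε (inverseˡ a)))))

  T-inverse : ∀ {g} → T g → T (g ⁻¹)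
  T-inverse {g} (inj₁ (g∈S , g∉)) = inj₁ (S-inverse g∈S , λ
    { (inj₁ eq) → g∉ (inj₂ (trans (sym ρa-inverse) (⁻¹-swap g _ eq)))
    ; (inj₂ eq) → g∉ (inj₁ (trans (sym ρ⁻¹a⁻¹-inverse) (⁻¹-swap g _ eq)))
    })
  T-inverse (inj₂ (inj₁ refl)) =
    inj₂ (inj₂ (sym (inverse-of (ρ ∙ a ∙ b) (ρ ⁻¹ ∙ a ⁻¹ ∙ b)
      (cancel (ρ ∙ a) (ρ ⁻¹ ∙ a ⁻¹) b b b-central ρa∙ρ⁻¹a⁻¹≡ε b∙b≡ε))))
  T-inverse (inj₂ (inj₂ refl)) =
    inj₂ (inj₁ (sym (inverse-of (ρ ⁻¹ ∙ a ⁻¹ ∙ b) (ρ ∙ a ∙ b)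
      (cancel (ρ ⁻¹ ∙ a ⁻¹) (ρ ∙ a) b b b-central ρ⁻¹a⁻¹∙ρa≡ε b∙b≡ε))))

  S? : Decidable S
  S? g = map′ bounded⇒ ⇒bounded (ℕ.anyUpTo? form? k) ⊎-dec (ρ ∙ τ ∙ a ≟ g) ⊎-dec (ρ ∙ τ ∙ a ⁻¹ ≟ g)
    where
    Form : ℕ → Set
    Form i = 1 ≤ i × i ≤ k ∸ 1 × (g ≡ τ ∙ a ^ i ⊎ g ≡ ρ ^ i ∙ a ^ i)
    form? : Decidable Form
    form? i = (1 ≤? i) ×-dec (i ≤? k ∸ 1) ×-dec ((g ≟ τ ∙ a ^ i) ⊎-dec (g ≟ ρ ^ i ∙ a ^ i))
    bounded⇒ : ∃ (λ i → i < k × Form i) → ∃ Form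
    bounded⇒ (i , _ , f) = i , f
    ⇒bounded : ∃ Form → ∃ (λ i → i < k × Form i)
    ⇒bounded (i , f@(_ , i≤k∸1 , _)) = i , ℕ.≤-trans (s≤s i≤k∸1) (ℕ.≤-reflexive (ℕ.suc-pred k)) , f

  T? : Decidable T
  T? g = (S? g ×-dec ¬? ((ρ ∙ a ≟ g) ⊎-dec (ρ ⁻¹ ∙ a ⁻¹ ≟ g)))
    ⊎-dec (ρ ∙ a ∙ b ≟ g) ⊎-dec (ρ ⁻¹ ∙ a ⁻¹ ∙ b ≟ g)

  Δ : Graph
  Δ = Cay ⟨G,b⟩ T T? T-inverse

{-# OPTIONS --safe #-}

-- Write A x y z and B x y z for ρ^x a^y b^z and ρ^x τ a^y b^z.  A vertex of
-- the A side dominates almost all of one column on the B side and almost all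
-- of one diagonal on its own side (antidiagonals, for B).  Columns that hold
-- no guard are expensive to dominate otherwise, and counting shows that at
-- most 2k + 1 guards suffice only if, up to the symmetry exchanging A and B,
-- both layers of A have a guard in every column and at most one guard is on
-- the B side.  Every diagonal is then occupied too, which forces D to contain
-- D_c = {A x (c − x) z} for some c; so γ = 2k and D has at most one spare guard.
-- Guards at D_c cannot cross to the mirror image of any D_c′, as one guard per
-- layer would be left over, and they move to a D_c′ along diagonals.  So an
-- attacked vertex of the B side must be met by the spare guard or by a guard
-- whose diagonal the spare guard can refill, and most vertices are neither.
module Submission where

open import Defs
open import Level using (0ℓ)
open import Algebra.Bundles using (AbelianGroup)
import Algebra.Properties.AbelianGroup as AbelianGroupProperties
import Data.Nat.Properties as ℕ
open import Algebra.Properties.Semiring.Sum ℕ.+-*-semiring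
  using (sum; sum-cong-≗; ∑-distrib-+; ∑-comm; sum-permute; *-distribˡ-sum)
import Algebra.Solver.CommutativeMonoid as CommutativeMonoidSolver
open import Algebra.Structures using (IsAbelianGroup)
open import Data.Bool using (Bool; true; false; if_then_else_)
open import Data.Empty using (⊥; ⊥-elim)
open import Data.Fin as Fin using (Fin; zero; suc; toℕ)
import Data.Fin.Permutation as Perm
import Data.Fin.Properties as Fin
open import Data.Fin.Subset as Subset using (Subset; inside; outside; ∣_∣; _∪_; ⁅_⁆)
import Data.Fin.Subset.Properties as Subset
open import Data.List using (List; []; _∷_; _++_; length; filter; allFin)
open import Data.List.Membership.Propositional as List using ()
open import Data.List.Membership.Propositional.Properties using (∈-++⁺ˡ; ∈-++⁺ʳ; ∈-filter⁺; ∈-allFin)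
open import Data.List.Properties using (filter-notAll; length-++; length-tabulate)
open import Data.List.Relation.Unary.Any as Any using (here; there)
open import Data.Nat using (ℕ; zero; suc; _+_; _*_; _∸_; _/_; _%_; _≤_; _<_; z≤n; s≤s; _≤?_; _<?_; NonZero)
open import Data.Nat.DivMod using (_mod_; m≡m%n+[m/n]*n; [m+kn]%n≡m%n; %-distribˡ-*; m%n%n≡m%n; m<n⇒m%n≡m; m%n<n)
open import Data.Nat.Tactic.RingSolver using (solve-∀)
open import Data.Product using (Σ; ∃; ∃₂; ∃-syntax; _×_; _,_; proj₁; proj₂)
open import Data.Sum using (_⊎_; inj₁; inj₂)
open import Data.Vec using ([]; _∷_; here; there)
open import Function.Base using (_∘_)
open import Function.Bundles using (Inverse; Bijection)
open import Relation.Binary.PropositionalEquality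
open import Relation.Nullary using (¬_; Dec; yes; no; does; contradiction)
open import Relation.Nullary.Decidable using (True; toWitness; ¬?; _⊎-dec_)

-- Sums over finite index sets

𝟙 : ∀ {ℓ} {P : Set ℓ} → Dec P → ℕ
𝟙 P? = if does P? then 1 else 0

𝟙-yes : ∀ {ℓ} {P : Set ℓ} (P? : Dec P) → P → 𝟙 P? ≡ 1
𝟙-yes (yes _) _ = refl
𝟙-yes (no ¬p) p = contradiction p ¬p

𝟙⁻¹ : ∀ {ℓ} {P : Set ℓ} (P? : Dec P) → 1 ≤ 𝟙 P? → P
𝟙⁻¹ (yes p) _ = p

sum-mono : ∀ {n} {f g : Fin n → ℕ} → (∀ i → f i ≤ g i) → sum f ≤ sum g
sum-mono {zero}  f≤g = z≤n
sum-mono {suc n} f≤g = ℕ.+-mono-≤ (f≤g zero) (sum-mono (f≤g ∘ suc))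

sum-const : ∀ n c → sum {n} (λ _ → c) ≡ n * c
sum-const zero    c = refl
sum-const (suc n) c = cong (c +_) (sum-const n c)

sum-𝟙 : ∀ {n} (c : Fin n) → sum (λ i → 𝟙 (c Fin.≟ i)) ≡ 1
sum-𝟙 {suc n} zero    = cong suc (trans (sum-const n 0) (ℕ.*-zeroʳ n))
sum-𝟙 {suc n} (suc c) = sum-𝟙 c

sum-positive : ∀ {n} (f : Fin n → ℕ) → 1 ≤ sum f → ∃[ i ] 1 ≤ f i
sum-positive {suc n} f pos with f zero in eq
... | suc _ = zero , subst (1 ≤_) (sym eq) (s≤s z≤n)
... | zero with sum-positive (f ∘ suc) pos
...   | i , p = suc i , p

private
  sum-+𝟙 : ∀ {n} m t (i : Fin n) → sum (λ x → m + t * 𝟙 (i Fin.≟ x)) ≡ n * m + t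
  sum-+𝟙 {n} m t i = begin
    sum (λ x → m + t * 𝟙 (i Fin.≟ x))                       ≡⟨ ∑-distrib-+ (λ _ → m) (λ x → t * 𝟙 (i Fin.≟ x)) ⟩
    sum {n} (λ _ → m) + sum (λ x → t * 𝟙 (i Fin.≟ x))
      ≡⟨ cong₂ _+_ (sum-const n m) (sym (*-distribˡ-sum t (λ x → 𝟙 (i Fin.≟ x)))) ⟩
    n * m + t * sum (λ x → 𝟙 (i Fin.≟ x))                   ≡⟨ cong (λ s → n * m + t * s) (sum-𝟙 i) ⟩
    n * m + t * 1                                           ≡⟨ cong (n * m +_) (ℕ.*-identityʳ t) ⟩
    n * m + t                                               ∎
    where open ≡-Reasoning

-- Compare `f` with the constant `m` plus a spike of height `t` at `i`; `sum-≥₂` uses two spikes of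
-- height 1.
sum-≥₁ : ∀ {n} m t {f : Fin n → ℕ} i → (∀ x → m ≤ f x) → m + t ≤ f i → n * m + t ≤ sum f
sum-≥₁ m t {f} i m≤f i≤f = subst (_≤ sum f) (sum-+𝟙 m t i) (sum-mono bound)
  where
  bound : ∀ x → m + t * 𝟙 (i Fin.≟ x) ≤ f x
  bound x with i Fin.≟ x
  ... | yes refl = subst (λ s → m + s ≤ f i) (sym (ℕ.*-identityʳ t)) i≤f
  ... | no  _    = subst (_≤ f x) (sym (trans (cong (m +_) (ℕ.*-zeroʳ t)) (ℕ.+-identityʳ m))) (m≤f x)

sum-≥₂ : ∀ {n} m {f : Fin n → ℕ} {i j} → i ≢ j → (∀ x → m ≤ f x) → m < f i → m < f j → n * m + 2 ≤ sum f
sum-≥₂ {n} m {f} {i} {j} i≢j m≤f m<fi m<fj = subst (_≤ sum f) total (sum-mono bound)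
  where
  open ≡-Reasoning
  total : sum (λ x → (m + 1 * 𝟙 (i Fin.≟ x)) + 𝟙 (j Fin.≟ x)) ≡ n * m + 2
  total = begin
    sum (λ x → (m + 1 * 𝟙 (i Fin.≟ x)) + 𝟙 (j Fin.≟ x))
      ≡⟨ ∑-distrib-+ (λ x → m + 1 * 𝟙 (i Fin.≟ x)) (λ x → 𝟙 (j Fin.≟ x)) ⟩
    sum (λ x → m + 1 * 𝟙 (i Fin.≟ x)) + sum (λ x → 𝟙 (j Fin.≟ x))
      ≡⟨ cong₂ _+_ (sum-+𝟙 m 1 i) (sum-𝟙 j) ⟩
    n * m + 1 + 1
      ≡⟨ ℕ.+-assoc (n * m) 1 1 ⟩
    n * m + 2 ∎
  bound : ∀ x → (m + 1 * 𝟙 (i Fin.≟ x)) + 𝟙 (j Fin.≟ x) ≤ f x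
  bound x with i Fin.≟ x | j Fin.≟ x
  ... | yes refl | yes refl = contradiction refl i≢j
  ... | yes refl | no _     = subst (_≤ f i) (trans (ℕ.+-comm 1 m) (sym (ℕ.+-identityʳ (m + 1)))) m<fi
  ... | no _     | yes refl = subst (_≤ f j) (trans (ℕ.+-comm 1 m) (cong (_+ 1) (sym (ℕ.+-identityʳ m)))) m<fj
  ... | no _     | no _     = subst (_≤ f x) (sym (trans (ℕ.+-identityʳ (m + 0)) (ℕ.+-identityʳ m))) (m≤f x)

sum≥2 : ∀ {n} {f : Fin n → ℕ} {i j} → i ≢ j → 1 ≤ f i → 1 ≤ f j → 2 ≤ sum f
sum≥2 {n} i≢j 1≤fi 1≤fj = ℕ.≤-trans (ℕ.m≤n+m 2 (n * 0)) (sum-≥₂ 0 i≢j (λ _ → z≤n) 1≤fi 1≤fj)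

sum≤1⇒unique : ∀ {n} {f : Fin n → ℕ} {i j} → sum f ≤ 1 → 1 ≤ f i → 1 ≤ f j → i ≡ j
sum≤1⇒unique {i = i} {j} sum≤1 1≤fi 1≤fj with i Fin.≟ j
... | yes i≡j = i≡j
... | no i≢j  = contradiction (ℕ.≤-trans (sum≥2 i≢j 1≤fi 1≤fj) sum≤1) λ { (s≤s ()) }

term≤sum : ∀ {n} (f : Fin n → ℕ) i → f i ≤ sum f
term≤sum {n} f i = ℕ.≤-trans (ℕ.m≤n+m (f i) (n * 0)) (sum-≥₁ 0 (f i) i (λ _ → z≤n) ℕ.≤-refl)

multiplicity : ∀ {k} → List (Fin k) → Fin k → ℕ
multiplicity []       y = 0
multiplicity (m ∷ ms) y = 𝟙 (m Fin.≟ y) + multiplicity ms y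

private
  ∈⇒multiplicity : ∀ {k} {y : Fin k} {ms} → y List.∈ ms → 1 ≤ multiplicity ms y
  ∈⇒multiplicity {y = y} {m ∷ ms} (here refl) = ℕ.≤-trans (ℕ.≤-reflexive (sym (𝟙-yes (m Fin.≟ y) refl))) (ℕ.m≤m+n _ _)
  ∈⇒multiplicity {y = y} {m ∷ ms} (there y∈)  = ℕ.≤-trans (∈⇒multiplicity y∈) (ℕ.m≤n+m _ _)

  sum-multiplicity : ∀ {k} (ms : List (Fin k)) → sum (multiplicity ms) ≡ length ms
  sum-multiplicity {k} []       = trans (sum-const k 0) (ℕ.*-zeroʳ k)
  sum-multiplicity     (m ∷ ms) = trans (∑-distrib-+ (λ y → 𝟙 (m Fin.≟ y)) (multiplicity ms))
    (cong₂ _+_ (sum-𝟙 m) (sum-multiplicity ms))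

covering-bound : ∀ {k n} (M : Fin n → List (Fin k)) → (∀ y → ∃[ i ] y List.∈ M i) → k ≤ sum (length ∘ M)
covering-bound {k} M covers = begin
  k                                             ≡⟨ ℕ.*-identityʳ k ⟨
  k * 1                                         ≡⟨ sum-const k 1 ⟨
  sum {k} (λ _ → 1)                             ≤⟨ sum-mono (λ y → let i , y∈ = covers y in
                                                     ℕ.≤-trans (∈⇒multiplicity y∈) (term≤sum (λ i → multiplicity (M i) y) i)) ⟩
  sum (λ y → sum (λ i → multiplicity (M i) y))  ≡⟨ ∑-comm (λ y i → multiplicity (M i) y) ⟩
  sum (λ i → sum (multiplicity (M i)))          ≡⟨ sum-cong-≗ (λ i → sum-multiplicity (M i)) ⟩
  sum (length ∘ M)                              ∎
  where open ℕ.≤-Reasoning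

-- Arithmetic of the guard counts

≤⇒+ : ∀ {m n} → m ≤ n → ∃[ t ] n ≡ m + t
≤⇒+ m≤n with ℕ.m≤n⇒∃[o]m+o≡n m≤n
... | t , eq = t , sym eq

-- Here α, β count the guards in one layer of either side, α′, β′ those in
-- the other layer, and p, q are the numbers of columns missed by the former.
record Layer (k α β α′ β′ p q : ℕ) : Set where
  field
    grid    : k * k + 2 * β ≤ (k + 1) * α + k * β + 2 * β′
    gridᵗ   : k * k + 2 * α ≤ (k + 1) * β + k * α + 2 * α′
    column  : p * k + 2 * k ≤ 2 * α + p * (β + 4) + 2 * β′
    columnᵗ : q * k + 2 * k ≤ 2 * β + q * (α + 4) + 2 * α′
    missed  : k ≤ α + p
    missedᵗ : k ≤ β + q

transpose : ∀ {k α β α′ β′ p q} → Layer k α β α′ β′ p q → Layer k β α β′ α′ q p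
transpose l = record
  { grid = gridᵗ ; gridᵗ = grid ; column = columnᵗ ; columnᵗ = column ; missed = missedᵗ ; missedᵗ = missed }
  where open Layer l

-- The layer counted by `α` and `β` has no slack at all; a surplus guard, on either side, can only
-- be in the other layer.
record Spread (k α β α′ β′ p p′ : ℕ) : Set where
  field
    exact  : α ≡ k
    empty  : β ≡ 0
    full   : p ≡ 0
    full′  : p′ ≡ 0
    rest   : β′ ≤ 1
    rest′  : α′ ≤ k + 1

private
  -- Linear arithmetic without subtraction: `l ≤ r` is a sum of hypotheses, the ring solver supplies
  -- the equation, and `a ≤ b` is what remains after cancelling.
  squeeze : ∀ {l r a b} → l ≤ r → r + a ≡ l + b → a ≤ b
  squeeze {l} {r} {a} {b} l≤r eq = ℕ.+-cancelˡ-≤ r a b (ℕ.≤-trans (ℕ.≤-reflexive eq) (ℕ.+-monoˡ-≤ b l≤r))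

  ¬17≤ : ∀ k n {n<17 : True (n <? 17)} → k ≤ n → 17 ≤ k → ⊥
  ¬17≤ k n {n<17} k≤n 17≤k = ℕ.<⇒≱ (toWitness n<17) (ℕ.≤-trans 17≤k k≤n)

  -- For `s = k − 1 − j` the hypotheses add up to `2jk + k ≤ 3j + 5`, which is false for large `k`.
  -- The cases of `j` reflect the sign of the constant once `k` is expressed by `s` and `j`.
  grid-total : ∀ k s s′ → 17 ≤ k → k * k + k * k + 2 * s ≤ (2 * k + 1) * s + 2 * s′ → s + s′ ≤ 2 * k + 1 → k ≤ s
  grid-total k s s′ 17≤k grids total with k ≤? s
  ... | yes k≤s = k≤s
  ... | no k≰s with ≤⇒+ (ℕ.≰⇒> k≰s)
  ...   | j , refl = ⊥-elim (excess j 17≤k (ℕ.+-mono-≤ grids (ℕ.*-monoʳ-≤ 2 total)))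
    where
    identity₀ : ∀ s s′ → let k = suc s + 0 in
      (2 * k + 1) * s + 2 * s′ + 2 * (2 * k + 1) + k ≡ k * k + k * k + 2 * s + 2 * (s + s′) + 5
    identity₀ = solve-∀
    identity₁ : ∀ s s′ → let k = suc s + 1 in
      (2 * k + 1) * s + 2 * s′ + 2 * (2 * k + 1) + (k + 2 * s) ≡ k * k + k * k + 2 * s + 2 * (s + s′) + 4
    identity₁ = solve-∀
    identity₂ : ∀ s s′ i → let k = suc s + suc (suc i) in
      (2 * k + 1) * s + 2 * s′ + 2 * (2 * k + 1) + (k + (2 * i * s + 2 * i * i + 7 * i + 4 * s + 1))
      ≡ k * k + k * k + 2 * s + 2 * (s + s′) + 0
    identity₂ = solve-∀
    excess : ∀ j → let k = suc s + j in 17 ≤ k →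
      k * k + k * k + 2 * s + 2 * (s + s′) ≤ (2 * k + 1) * s + 2 * s′ + 2 * (2 * k + 1) → ⊥
    excess 0 17≤k h = ¬17≤ (suc s + 0) 5 (squeeze h (identity₀ s s′)) 17≤k
    excess 1 17≤k h = ¬17≤ (suc s + 1) 4 (ℕ.m+n≤o⇒m≤o _ (squeeze h (identity₁ s s′))) 17≤k
    excess (suc (suc i)) 17≤k h = ¬17≤ (suc s + suc (suc i)) 0 (ℕ.m+n≤o⇒m≤o _ (squeeze h (identity₂ s s′ i))) 17≤k

  -- As `α + β = k`, the `A` guards miss at least `β` columns and the `B` guards at least `α`. In
  -- the column bounds a missed column costs `k − β − 4 = u` or `k − α − 4 = v`; the summands 4 keep
  -- these costs nonnegative. Adding both bounds leaves `k ≤ 10`.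
  ¬balanced : ∀ {k u v α′ β′ p q} → 17 ≤ k → (4 + u) + (4 + v) ≡ k → α′ + β′ ≤ k + 1 →
              Layer k (4 + u) (4 + v) α′ β′ p q → ⊥
  ¬balanced {u = u} {v} {α′} {β′} 17≤k refl rest l
    with ≤⇒+ (ℕ.+-cancelˡ-≤ (4 + u) (4 + v) _ (Layer.missed l))
       | ≤⇒+ (ℕ.+-cancelˡ-≤ (4 + v) (4 + u) _ (ℕ.≤-trans (ℕ.≤-reflexive (ℕ.+-comm (4 + v) (4 + u))) (Layer.missedᵗ l)))
  ... | x , refl | y , refl =
    ¬17≤ (4 + u + (4 + v)) 10 (bound u v α′ β′ x y (Layer.column l) (Layer.columnᵗ l) rest) 17≤k
    where
    identity : ∀ u v α′ β′ x y → let α = 4 + u ; β = 4 + v ; k = α + β in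
      2 * α + (β + x) * (β + 4) + 2 * β′ + (2 * β + (α + y) * (α + 4) + 2 * α′) + 2 * (k + 1)
        + (k + (3 * u + 3 * v + 2 * u * v + x * u + y * v))
      ≡ (β + x) * k + 2 * k + ((α + y) * k + 2 * k) + 2 * (α′ + β′) + 10
    identity = solve-∀
    bound : ∀ u v α′ β′ x y → let α = 4 + u ; β = 4 + v ; k = α + β in
      (β + x) * k + 2 * k ≤ 2 * α + (β + x) * (β + 4) + 2 * β′ →
      (α + y) * k + 2 * k ≤ 2 * β + (α + y) * (α + 4) + 2 * α′ →
      α′ + β′ ≤ k + 1 → k ≤ 10
    bound u v α′ β′ x y c cᵗ rest = ℕ.m+n≤o⇒m≤o _
      (squeeze (ℕ.+-mono-≤ (ℕ.+-mono-≤ c cᵗ) (ℕ.*-monoʳ-≤ 2 rest)) (identity u v α′ β′ x y))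

  -- `gridᵗ` amounts to `2α ≤ β + 2α′`, so the other layer must spend its guards on the `A` side and
  -- `2β′ ≤ 3β + 2`. One missed column would need more help from `β′` than that, unless
  -- `k ≤ 2β + 6`.
  missed-none : ∀ {k α β α′ β′ p q} → 17 ≤ k → β ≤ 3 → α + β ≡ k → α′ + β′ ≤ k + 1 →
                Layer k α β α′ β′ p q → p ≡ 0
  missed-none {p = zero} _ _ _ _ _ = refl
  missed-none {α = α} {β} {α′} {β′} {suc p} 17≤k β≤3 refl rest l = ⊥-elim (¬17≤ (α + β) 12 k≤12 17≤k)
    where
    identity : ∀ t β α′ β′ p → let α = 4 + t ; k = α + β in
      2 * α + suc p * (β + 4) + 2 * β′ + ((k + 1) * β + k * α + 2 * α′) + 2 * (k + 1) + (k + p * t)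
      ≡ suc p * k + 2 * k + (k * k + 2 * α) + 2 * (α′ + β′) + (2 * β + 6)
    identity = solve-∀
    4≤α : 4 ≤ α
    4≤α = ℕ.≮⇒≥ λ α<4 → ¬17≤ (α + β) 7 (ℕ.+-mono-≤ (ℕ.<⇒≤ α<4) β≤3) 17≤k
    k≤2β+6 : α + β ≤ 2 * β + 6
    k≤2β+6 with ≤⇒+ 4≤α
    ... | t , refl = ℕ.m+n≤o⇒m≤o _ (squeeze
        (ℕ.+-mono-≤ (ℕ.+-mono-≤ (Layer.column l) (Layer.gridᵗ l)) (ℕ.*-monoʳ-≤ 2 rest))
        (identity t β α′ β′ p))
    k≤12 : α + β ≤ 12
    k≤12 = ℕ.≤-trans k≤2β+6 (ℕ.+-monoˡ-≤ 6 (ℕ.*-monoʳ-≤ 2 β≤3))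

  missed-none′ : ∀ {k α′ β′ p′ q′} → 17 ≤ k → β′ ≤ 1 → α′ + β′ ≤ k + 1 →
                 Layer k α′ β′ k 0 p′ q′ → p′ ≡ 0
  missed-none′ {p′ = zero} _ _ _ _ = refl
  missed-none′ {k} {α′} {β′} {suc r} 17≤k β′≤1 rest l = ⊥-elim (¬17≤ k 7 k≤7 17≤k)
    where
    identity : ∀ t α′ β′ r → let k = 5 + t in
      2 * α′ + suc r * (β′ + 4) + 0 + 2 * (k + 1) + suc r * 1 + (k + (r * t + 2 * β′))
      ≡ suc r * k + 2 * k + 2 * (α′ + β′) + suc r * β′ + 7
    identity = solve-∀
    k≤7 : k ≤ 7
    k≤7 with ≤⇒+ (ℕ.≤-trans (ℕ.m≤m+n 5 12) 17≤k)
    ... | t , refl = ℕ.m+n≤o⇒m≤o _ (squeeze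
        (ℕ.+-mono-≤ (ℕ.+-mono-≤ (Layer.column l) (ℕ.*-monoʳ-≤ 2 rest)) (ℕ.*-monoʳ-≤ (suc r) β′≤1))
        (identity t α′ β′ r))

  spread : ∀ {k α β α′ β′ p q p′ q′} → 17 ≤ k → β ≤ 3 → α + β ≡ k → α′ + β′ ≤ k + 1 →
           Layer k α β α′ β′ p q → Layer k α′ β′ α β p′ q′ → Spread k α β α′ β′ p p′
  spread {k} {α} {β} {α′} {β′} {p} {q} {p′} {q′} 17≤k β≤3 sum≡k rest l l′ =
    record { exact = α≡k ; empty = β≡0 ; full = p≡0 ; full′ = p′≡0 ; rest = β′≤1 ; rest′ = ℕ.m+n≤o⇒m≤o α′ rest }
    where
    p≡0 : p ≡ 0
    p≡0 = missed-none 17≤k β≤3 sum≡k rest l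
    α≡k : α ≡ k
    α≡k = ℕ.≤-antisym (ℕ.m+n≤o⇒m≤o α (ℕ.≤-reflexive sum≡k))
      (ℕ.≤-trans (Layer.missed l) (ℕ.≤-reflexive (trans (cong (α +_) p≡0) (ℕ.+-identityʳ α))))
    β≡0 : β ≡ 0
    β≡0 = ℕ.+-cancelˡ-≡ α β 0 (trans sum≡k (trans (sym α≡k) (sym (ℕ.+-identityʳ α))))
    l₀ : Layer k k 0 α′ β′ p q
    l₀ = subst₂ (λ α β → Layer k α β α′ β′ p q) α≡k β≡0 l
    l′₀ : Layer k α′ β′ k 0 p′ q′
    l′₀ = subst₂ (λ α β → Layer k α′ β′ α β p′ q′) α≡k β≡0 l′
    identity : ∀ k α′ → (k + 1) * 0 + k * k + 2 * α′ + 2 * k ≡ k * k + 2 * k + 2 * α′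
    identity = solve-∀
    -- Each of the `k` guards leaves two vertices of its diagonal undominated in this layer, and a
    -- guard of the other layer makes up for two.
    k≤α′ : k ≤ α′
    k≤α′ = ℕ.*-cancelˡ-≤ 2 (squeeze (Layer.gridᵗ l₀) (identity k α′))
    β′≤1 : β′ ≤ 1
    β′≤1 = ℕ.+-cancelˡ-≤ k β′ 1 (ℕ.≤-trans (ℕ.+-monoˡ-≤ β′ k≤α′) rest)
    p′≡0 : p′ ≡ 0
    p′≡0 = missed-none′ 17≤k β′≤1 rest l′₀

  exact-layer : ∀ {k α β α′ β′ p q p′ q′} → 17 ≤ k → α + β ≡ k → α′ + β′ ≤ k + 1 →
                Layer k α β α′ β′ p q → Layer k α′ β′ α β p′ q′ →
                Spread k α β α′ β′ p p′ ⊎ Spread k β α β′ α′ q q′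
  exact-layer {k} {α} {β} {α′} {β′} 17≤k sum≡k rest l l′ with β ≤? 3 | α ≤? 3
  ... | yes β≤3 | _       = inj₁ (spread 17≤k β≤3 sum≡k rest l l′)
  ... | no _    | yes α≤3 = inj₂ (spread 17≤k α≤3 (trans (ℕ.+-comm β α) sum≡k)
    (ℕ.≤-trans (ℕ.≤-reflexive (ℕ.+-comm β′ α′)) rest) (transpose l) (transpose l′))
  ... | no β≰3  | no α≰3 with ≤⇒+ (ℕ.≰⇒> α≰3) | ≤⇒+ (ℕ.≰⇒> β≰3)
  ...   | u , refl | v , refl = ⊥-elim (¬balanced 17≤k sum≡k rest l)

  layer-total : ∀ {k α β α′ β′ p q} → 17 ≤ k → Layer k α β α′ β′ p q →
                (α + β) + (α′ + β′) ≤ 2 * k + 1 → k ≤ α + β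
  layer-total {k} {α} {β} {α′} {β′} 17≤k l total = grid-total k (α + β) (α′ + β′) 17≤k
    (subst₂ _≤_ (left k α β) (right k α β α′ β′) (ℕ.+-mono-≤ (Layer.grid l) (Layer.gridᵗ l))) total
    where
    left : ∀ k α β → k * k + 2 * β + (k * k + 2 * α) ≡ k * k + k * k + 2 * (α + β)
    left = solve-∀
    right : ∀ k α β α′ β′ → (k + 1) * α + k * β + 2 * β′ + ((k + 1) * β + k * α + 2 * α′)
            ≡ (2 * k + 1) * (α + β) + 2 * (α′ + β′)
    right = solve-∀

other : Fin 2 → Fin 2
other zero       = suc zero
other (suc zero) = zero

other-involutive : ∀ z → other (other z) ≡ z
other-involutive zero       = refl
other-involutive (suc zero) = refl

other-≢ : ∀ z → z ≢ other z
other-≢ zero       ()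
other-≢ (suc zero) ()

≢⇒other : ∀ {z z′} → z ≢ z′ → z′ ≡ other z
≢⇒other {zero}     {zero}     z≢z′ = contradiction refl z≢z′
≢⇒other {zero}     {suc zero} z≢z′ = refl
≢⇒other {suc zero} {zero}     z≢z′ = refl
≢⇒other {suc zero} {suc zero} z≢z′ = contradiction refl z≢z′

other-swap : ∀ {z z′} → z ≡ other z′ → z′ ≡ other z
other-swap {z′ = z′} refl = sym (other-involutive z′)

-- Each layer holds at least `k` of the at most `2k + 1` guards. Hence one layer has exactly `k`,
-- and the other at most `k + 1`.
one-sided : ∀ {k} (α β p q : Fin 2 → ℕ) → 17 ≤ k →
  (∀ z → Layer k (α z) (β z) (α (other z)) (β (other z)) (p z) (q z)) →
  (∀ z → (α z + β z) + (α (other z) + β (other z)) ≤ 2 * k + 1) →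
  ∃[ z ] (Spread k (α z) (β z) (α (other z)) (β (other z)) (p z) (p (other z))
        ⊎ Spread k (β z) (α z) (β (other z)) (α (other z)) (q z) (q (other z)))
one-sided {k} α β p q 17≤k layer total = choose (ℕ.m≤n⇒m<n∨m≡n (at-least zero))
  where
  at-least : ∀ z → k ≤ α z + β z
  at-least z = layer-total 17≤k (layer z) (total z)
  rest : ∀ m {s s′} → m ≤ s → s + s′ ≤ 2 * k + 1 → m + s′ ≤ 2 * k + 1
  rest m m≤s total = ℕ.≤-trans (ℕ.+-monoˡ-≤ _ m≤s) total
  double : 2 * k + 1 ≡ k + (k + 1)
  double = lemma k where
    lemma : ∀ k → 2 * k + 1 ≡ k + (k + 1)
    lemma = solve-∀
  choose : k < α zero + β zero ⊎ k ≡ α zero + β zero → _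
  choose (inj₂ k≡s₀) = zero , exact-layer 17≤k (sym k≡s₀)
    (ℕ.+-cancelˡ-≤ k _ _ (ℕ.≤-trans (rest k (at-least zero) (total zero)) (ℕ.≤-reflexive double)))
    (layer zero) (layer (suc zero))
  choose (inj₁ k<s₀) = suc zero , exact-layer 17≤k
    (ℕ.≤-antisym (ℕ.+-cancelˡ-≤ (suc k) _ _ (ℕ.≤-trans (rest (suc k) k<s₀ (total zero)) (ℕ.≤-reflexive double′))) (at-least (suc zero)))
    (ℕ.+-cancelˡ-≤ k _ _ (ℕ.≤-trans (rest k (at-least (suc zero)) (total (suc zero))) (ℕ.≤-reflexive double)))
    (layer (suc zero)) (layer zero)
    where
    double′ : 2 * k + 1 ≡ suc k + k
    double′ = lemma k where
      lemma : ∀ k → 2 * k + 1 ≡ suc k + k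
      lemma = solve-∀

-- Cyclic groups of odd order

-- What the combinatorics uses of the integers modulo `k`. Oddness enters through `half` and
-- `⊕-self-injective`; the multiples of `𝟏` up to 5 are the offsets between columns that arise in
-- `vacancy`.
record OddCyclic (k : ℕ) : Set₁ where
  infixl 6 _⊕_
  field
    _⊕_              : Fin k → Fin k → Fin k
    𝟎 𝟏              : Fin k
    ⊖_               : Fin k → Fin k
    isAbelianGroup   : IsAbelianGroup _≡_ _⊕_ 𝟎 ⊖_
    cyclic-induction : (P : Fin k → Set) → (∀ x → P x → P (x ⊕ 𝟏)) → ∀ {x} → P x → ∀ y → P y
    half             : Fin k → Fin k
    half-⊕           : ∀ u → half u ⊕ half u ≡ u
    ⊕-self-injective : ∀ {x y} → x ⊕ x ≡ y ⊕ y → x ≡ y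
    1≢0              : 𝟏 ≢ 𝟎
    2≢0              : 𝟏 ⊕ 𝟏 ≢ 𝟎
    3≢0              : 𝟏 ⊕ 𝟏 ⊕ 𝟏 ≢ 𝟎
    4≢0              : 𝟏 ⊕ 𝟏 ⊕ 𝟏 ⊕ 𝟏 ≢ 𝟎
    5≢0              : 𝟏 ⊕ 𝟏 ⊕ 𝟏 ⊕ 𝟏 ⊕ 𝟏 ≢ 𝟎

  abelianGroup : AbelianGroup 0ℓ 0ℓ
  abelianGroup = record { isAbelianGroup = isAbelianGroup }

  open AbelianGroup abelianGroup public using ()
    renaming (assoc to ⊕-assoc; comm to ⊕-comm; identityˡ to ⊕-identityˡ; identityʳ to ⊕-identityʳ;
              inverseˡ to ⊖-inverseˡ; inverseʳ to ⊖-inverseʳ)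
  open AbelianGroupProperties abelianGroup public using ()
    renaming (∙-cancelˡ to ⊕-cancelˡ; ∙-cancelʳ to ⊕-cancelʳ; ⁻¹-involutive to ⊖-involutive)
  open CommutativeMonoidSolver (AbelianGroup.commutativeMonoid abelianGroup) public
    using (solve; _⊜_) renaming (_⊕_ to infixl 6 _:+_; id to :0)

  infixl 6 _⊞_
  _⊞_ : ∀ {x x′ y y′} → x ≡ x′ → y ≡ y′ → x ⊕ y ≡ x′ ⊕ y′
  _⊞_ = cong₂ _⊕_

  -- Equations with inverses are proved subtraction-free: l ≡ r follows from
  -- a hypothesis l₁ ≡ r₁ once l + r₁ ≡ r + l₁ holds in commutative monoids.
  by : ∀ {l r l₁ r₁} → l ⊕ r₁ ≡ r ⊕ l₁ → l₁ ≡ r₁ → l ≡ r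
  by {l} {r} {l₁} {r₁} eq l₁≡r₁ = ⊕-cancelʳ r₁ l r (trans eq (cong (r ⊕_) l₁≡r₁))

  pred : Fin k → Fin k
  pred x = x ⊕ (⊖ 𝟏)

  pred-suc : ∀ x → pred x ⊕ 𝟏 ≡ x
  pred-suc x = trans (⊕-assoc x (⊖ 𝟏) 𝟏) (trans (cong (x ⊕_) (⊖-inverseˡ 𝟏)) (⊕-identityʳ x))

  suc-pred : ∀ x → pred (x ⊕ 𝟏) ≡ x
  suc-pred x = ⊕-cancelʳ 𝟏 _ _ (pred-suc (x ⊕ 𝟏))

  infixl 6 _⊝_
  _⊝_ : Fin k → Fin k → Fin k
  x ⊝ y = x ⊕ (⊖ y)

  ⊝-⊕ : ∀ x y → (x ⊝ y) ⊕ y ≡ x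
  ⊝-⊕ x y = trans (⊕-assoc x (⊖ y) y) (trans (cong (x ⊕_) (⊖-inverseˡ y)) (⊕-identityʳ x))

  shift : Perm.Permutation k k
  shift = Perm.permutation (_⊕ 𝟏) pred pred-suc suc-pred

  sum-⊕𝟏 : ∀ (f : Fin k → ℕ) → sum (λ x → f (x ⊕ 𝟏)) ≡ sum f
  sum-⊕𝟏 f = sym (sum-permute f shift)

  sum-pred : ∀ (f : Fin k → ℕ) → sum (λ x → f (pred x)) ≡ sum f
  sum-pred f = sym (sum-permute f (Perm.flip shift))

-- The vertices as four grids

pattern A x y z = (((x , false) , y) , z)
pattern B x y z = (((x , true) , y) , z)

V : ℕ → Set
V k = ((Fin k × Bool) × Fin k) × Fin 2

when : ∀ {P X : Set} → Dec P → List X → List X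
when (yes _) xs = xs
when (no _)  xs = []

length-when : ∀ {P X : Set} (P? : Dec P) (xs : List X) → length (when P? xs) ≡ 𝟙 P? * length xs
length-when (yes _) xs = sym (ℕ.*-identityˡ (length xs))
length-when (no _)  xs = refl

∈-when : ∀ {P X : Set} (P? : Dec P) {xs : List X} {x} → P → x List.∈ xs → x List.∈ when P? xs
∈-when (yes _) _ x∈ = x∈
∈-when (no ¬p) p x∈ = contradiction p ¬p

others : ∀ {k} → Fin k → List (Fin k)
others {k} y = filter (¬? ∘ (y Fin.≟_)) (allFin k)

length-others : ∀ {k} (y : Fin k) → length (others y) + 1 ≤ k
length-others {k} y = begin
  length (others y) + 1 ≡⟨ ℕ.+-comm _ 1 ⟩
  suc (length (others y)) ≤⟨ filter-notAll (¬? ∘ (y Fin.≟_)) (allFin k) (Any.map (λ eq ne → ne eq) (∈-allFin y)) ⟩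
  length (allFin k) ≡⟨ length-tabulate (λ i → i) ⟩
  k ∎
  where open ℕ.≤-Reasoning

∈-others : ∀ {k} {y y′ : Fin k} → y ≢ y′ → y′ List.∈ others y
∈-others {y = y} {y′} y≢y′ = ∈-filter⁺ (¬? ∘ (y Fin.≟_)) (∈-allFin y′) y≢y′

module Model (k : ℕ) (C : OddCyclic k) where

  open OddCyclic C

  Near : Fin k → Fin k → Set
  Near x x′ = x′ ≡ x ⊕ 𝟏 ⊎ x ≡ x′ ⊕ 𝟏

  near? : ∀ x x′ → Dec (Near x x′)
  near? x x′ = (x′ Fin.≟ x ⊕ 𝟏) ⊎-dec (x Fin.≟ x′ ⊕ 𝟏)

  -- The trace of replacing `S` by `T`: diagonal steps by one in either direction carry the factor
  -- `b`, all longer ones stay in the layer.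
  SameSide : Fin k → Fin k → Fin 2 → Fin 2 → Set
  SameSide x x′ z z′ = (z ≡ z′ × ¬ Near x x′) ⊎ (z′ ≡ other z × Near x x′)

  -- u dominates w.
  N : V k → V k → Set
  N (A x y z) (A x′ y′ z′) = x ⊕ y′ ≡ x′ ⊕ y × SameSide x x′ z z′
  N (B x y z) (B x′ y′ z′) = x ⊕ y ≡ x′ ⊕ y′ × SameSide x x′ z z′
  N (A x y z) (B x′ y′ z′) = z ≡ z′ × ((x ≡ x′ × y ≢ y′) ⊎ (x′ ≡ x ⊕ 𝟏 × Near y y′))
  N (B x y z) (A x′ y′ z′) = z ≡ z′ × ((x ≡ x′ × y ≢ y′) ⊎ (x ≡ x′ ⊕ 𝟏 × Near y y′))

  -- Left multiplication by `τ`, hence an automorphism of the Cayley graph.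
  φ : V k → V k
  φ (A x y z) = B (⊖ x) y z
  φ (B x y z) = A (⊖ x) y z

  φ-involutive : ∀ u → φ (φ u) ≡ u
  φ-involutive (A x y z) = cong (λ x → A x y z) (⊖-involutive x)
  φ-involutive (B x y z) = cong (λ x → B x y z) (⊖-involutive x)

  ⊖-flip : ∀ {x x′ y y′} → x ⊕ y′ ≡ x′ ⊕ y → (⊖ x) ⊕ y ≡ (⊖ x′) ⊕ y′
  ⊖-flip {x} {x′} {y} {y′} eq = by
    (solve 6 (λ x x′ y y′ m m′ → (m :+ y) :+ ((x :+ y′) :+ (:0 :+ (x′ :+ m′)))
        ⊜ (m′ :+ y′) :+ ((x′ :+ y) :+ ((x :+ m) :+ :0)))
      refl x x′ y y′ (⊖ x) (⊖ x′))
    (sym eq ⊞ (⊖-inverseʳ x ⊞ sym (⊖-inverseʳ x′)))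

  ⊖-suc : ∀ {x x′} → x′ ≡ x ⊕ 𝟏 → ⊖ x ≡ (⊖ x′) ⊕ 𝟏
  ⊖-suc {x} {x′} eq = by
    (solve 5 (λ x x′ o m m′ → m :+ ((x :+ o) :+ (:0 :+ (x′ :+ m′))) ⊜ (m′ :+ o) :+ (x′ :+ ((x :+ m) :+ :0)))
      refl x x′ 𝟏 (⊖ x) (⊖ x′))
    (eq ⊞ (⊖-inverseʳ x ⊞ sym (⊖-inverseʳ x′)))

  ⊖-near : ∀ {x x′} → Near x x′ → Near (⊖ x) (⊖ x′)
  ⊖-near (inj₁ eq) = inj₂ (⊖-suc eq)
  ⊖-near (inj₂ eq) = inj₁ (⊖-suc eq)

  ⊖-sameSide : ∀ {x x′ z z′} → SameSide x x′ z z′ → SameSide (⊖ x) (⊖ x′) z z′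
  ⊖-sameSide {x} {x′} (inj₁ (z≡z′ , ¬near)) = inj₁ (z≡z′ , λ near → ¬near
    (subst₂ Near (⊖-involutive x) (⊖-involutive x′) (⊖-near near)))
  ⊖-sameSide (inj₂ (z′≡ , near)) = inj₂ (z′≡ , ⊖-near near)

  N-φ : ∀ u w → N u w → N (φ u) (φ w)
  N-φ (A _ _ _) (A _ _ _) (eq , side) = ⊖-flip eq , ⊖-sameSide side
  N-φ (B x y z) (B x′ y′ z′) (eq , side) = unflip , ⊖-sameSide side
    where
    unflip : (⊖ x) ⊕ y′ ≡ (⊖ x′) ⊕ y
    unflip = ⊖-flip eq
  N-φ (A _ _ _) (B _ _ _) (z≡ , inj₁ (x≡ , y≢)) = z≡ , inj₁ (cong ⊖_ x≡ , y≢)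
  N-φ (A _ _ _) (B _ _ _) (z≡ , inj₂ (x≡ , near)) = z≡ , inj₂ (⊖-suc x≡ , near)
  N-φ (B _ _ _) (A _ _ _) (z≡ , inj₁ (x≡ , y≢)) = z≡ , inj₁ (cong ⊖_ x≡ , y≢)
  N-φ (B _ _ _) (A _ _ _) (z≡ , inj₂ (x≡ , near)) = z≡ , inj₂ (⊖-suc x≡ , near)

  Dom : ∀ {n} → (Fin n → V k) → Set
  Dom d = ∀ w → ∃[ i ] N (d i) w

  Dom-φ : ∀ {n} {d : Fin n → V k} → Dom d → Dom (φ ∘ d)
  Dom-φ {d = d} dom w with dom (φ w)
  ... | i , Niw = i , subst (N (φ (d i))) (φ-involutive w) (N-φ (d i) (φ w) Niw)

  atA atB : Fin 2 → Fin k → V k → ℕ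
  atA z x (A x′ y′ z′) = 𝟙 (z′ Fin.≟ z) * 𝟙 (x′ Fin.≟ x)
  atA z x (B x′ y′ z′) = 0
  atB z x (A x′ y′ z′) = 0
  atB z x (B x′ y′ z′) = 𝟙 (z′ Fin.≟ z) * 𝟙 (x′ Fin.≟ x)

  inA inB : Fin 2 → V k → ℕ
  inA z (A x′ y′ z′) = 𝟙 (z′ Fin.≟ z)
  inA z (B x′ y′ z′) = 0
  inB z (A x′ y′ z′) = 0
  inB z (B x′ y′ z′) = 𝟙 (z′ Fin.≟ z)

  onA : Fin 2 → Fin k → V k → ℕ
  onA z ℓ (A x′ y′ z′) = 𝟙 (z′ Fin.≟ z) * 𝟙 ((x′ ⊝ y′) Fin.≟ ℓ)
  onA z ℓ (B x′ y′ z′) = 0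

  private
    near⇒pred : ∀ {x x′} → Near x x′ → x′ ≡ x ⊕ 𝟏 ⊎ x′ ≡ pred x
    near⇒pred         (inj₁ eq) = inj₁ eq
    near⇒pred {x} {x′} (inj₂ eq) = inj₂ (⊕-cancelʳ 𝟏 _ _ (trans (sym eq) (sym (pred-suc x))))

    row : ∀ {x x′ y y′} → x′ ⊕ y′ ≡ x ⊕ y → y ≡ (x′ ⊕ y′) ⊝ x
    row {x} {x′} {y} {y′} eq = ⊕-cancelʳ x _ _ (trans (⊕-comm y x) (trans (sym eq) (sym (⊝-⊕ (x′ ⊕ y′) x))))

    -- Candidates for the rows of column `x`, layer `z` of `B` that `u` dominates. The antidiagonal
    -- of a `B` guard meets the column once; the guard acts there in its own layer, or in the other
    -- one if the column is adjacent to its own.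
    rows : Fin 2 → Fin k → V k → List (Fin k)
    rows z x (A x′ y′ z′) = when (z′ Fin.≟ z)
      (when (x′ Fin.≟ x) (others y′) ++ when (x′ Fin.≟ pred x) (y′ ⊕ 𝟏 ∷ pred y′ ∷ []))
    rows z x (B x′ y′ z′) with x′ Fin.≟ pred x | x′ Fin.≟ x ⊕ 𝟏
    ... | no _ | no _ = when (z′ Fin.≟ z) ((x′ ⊕ y′) ⊝ x ∷ [])
    ... | _    | _    = when (z′ Fin.≟ other z) ((x′ ⊕ y′) ⊝ x ∷ [])

    ∈-rows : ∀ z x y u → N u (B x y z) → y List.∈ rows z x u
    ∈-rows z x y (A x′ y′ z′) (refl , inj₁ (refl , y′≢y)) =
      ∈-when (z′ Fin.≟ z′) refl (∈-++⁺ˡ (∈-when (x Fin.≟ x) refl (∈-others y′≢y)))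
    ∈-rows z x y (A x′ y′ z′) (refl , inj₂ (refl , near)) =
      ∈-when (z′ Fin.≟ z′) refl (∈-++⁺ʳ (when (x′ Fin.≟ x) (others y′))
        (∈-when (x′ Fin.≟ pred x) (sym (suc-pred x′)) (candidate (near⇒pred near))))
      where
      candidate : y ≡ y′ ⊕ 𝟏 ⊎ y ≡ pred y′ → y List.∈ (y′ ⊕ 𝟏 ∷ pred y′ ∷ [])
      candidate (inj₁ eq) = here eq
      candidate (inj₂ eq) = there (here eq)
    ∈-rows z x y (B x′ y′ z′) (eq , side) with x′ Fin.≟ pred x | x′ Fin.≟ x ⊕ 𝟏 | side
    ... | yes p | _     | inj₁ (_ , ¬near) = contradiction (inj₁ (sym (trans (cong (_⊕ 𝟏) p) (pred-suc x)))) ¬near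
    ... | yes _ | _     | inj₂ (z≡ , _)    = ∈-when (z′ Fin.≟ other z) (other-swap z≡) (here (row eq))
    ... | no _  | yes q | inj₁ (_ , ¬near) = contradiction (inj₂ q) ¬near
    ... | no _  | yes _ | inj₂ (z≡ , _)    = ∈-when (z′ Fin.≟ other z) (other-swap z≡) (here (row eq))
    ... | no _  | no _  | inj₁ (refl , _)  = ∈-when (z′ Fin.≟ z′) refl (here (row eq))
    ... | no p  | no q  | inj₂ (_ , near)  = contradiction near λ
      { (inj₁ eq′) → p (⊕-cancelʳ 𝟏 _ _ (trans (sym eq′) (sym (pred-suc x)))) ; (inj₂ eq′) → q eq′ }

    pred≢suc : ∀ {x} → pred x ≢ x ⊕ 𝟏
    pred≢suc {x} eq = 2≢0 (by
      (solve 3 (λ x p o → (o :+ o) :+ (p :+ x) ⊜ :0 :+ ((x :+ o) :+ (p :+ o))) refl x (pred x) 𝟏)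
      (sym eq ⊞ pred-suc x))

    -- `weight` overcounts: an `A` guard in column `x` is given `k` rows although it misses one, and
    -- `inB` includes the guards of adjacent columns, which act in the other layer only. `excess` is
    -- the correction, kept on the smaller side so that nothing is subtracted.
    weight excess : Fin 2 → Fin k → V k → ℕ
    weight z x u =
      k * atA z x u + (2 * atA z (pred x) u + (inB z u + (atB (other z) (pred x) u + atB (other z) (x ⊕ 𝟏) u)))
    excess z x u = atA z x u + (atB z (pred x) u + atB z (x ⊕ 𝟏) u)

    length-rows : ∀ z x u → length (rows z x u) + excess z x u ≤ weight z x u
    length-rows z x (A x′ y′ z′) = begin
      length (when (z′ Fin.≟ z) (left ++ right)) + (ζ * ξ + 0)
        ≡⟨ cong (_+ (ζ * ξ + 0)) (trans (length-when (z′ Fin.≟ z) (left ++ right)) (cong (ζ *_)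
             (trans (length-++ left) (cong₂ _+_ (length-when (x′ Fin.≟ x) (others y′)) (length-when (x′ Fin.≟ pred x) _))))) ⟩
      ζ * (ξ * length (others y′) + π * 2) + (ζ * ξ + 0)
        ≡⟨ regroup ζ ξ π (length (others y′)) ⟩
      ζ * ξ * (length (others y′) + 1) + (2 * (ζ * π) + 0)
        ≤⟨ ℕ.+-monoˡ-≤ (2 * (ζ * π) + 0) (ℕ.*-monoʳ-≤ (ζ * ξ) (length-others y′)) ⟩
      ζ * ξ * k + (2 * (ζ * π) + 0)
        ≡⟨ cong (_+ (2 * (ζ * π) + 0)) (ℕ.*-comm (ζ * ξ) k) ⟩
      k * (ζ * ξ) + (2 * (ζ * π) + 0) ∎
      where
      open ℕ.≤-Reasoning
      left = when (x′ Fin.≟ x) (others y′)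
      right = when (x′ Fin.≟ pred x) (y′ ⊕ 𝟏 ∷ pred y′ ∷ [])
      ζ = 𝟙 (z′ Fin.≟ z)
      ξ = 𝟙 (x′ Fin.≟ x)
      π = 𝟙 (x′ Fin.≟ pred x)
      regroup : ∀ ζ ξ π l → ζ * (ξ * l + π * 2) + (ζ * ξ + 0) ≡ ζ * ξ * (l + 1) + (2 * (ζ * π) + 0)
      regroup = solve-∀
    length-rows z x (B x′ y′ z′) with x′ Fin.≟ pred x | x′ Fin.≟ x ⊕ 𝟏
    ... | yes p | yes q = contradiction (trans (sym p) q) pred≢suc
    ... | yes _ | no _  = ℕ.≤-reflexive (trans
      (cong (_+ (0 + (ζ * 1 + ζ * 0))) (length-when (z′ Fin.≟ other z) ((x′ ⊕ y′) ⊝ x ∷ []))) (regroup k ζ (𝟙 (z′ Fin.≟ other z))))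
      where
      ζ = 𝟙 (z′ Fin.≟ z)
      regroup : ∀ k ζ ζ′ → ζ′ * 1 + (0 + (ζ * 1 + ζ * 0)) ≡ k * 0 + (2 * 0 + (ζ + (ζ′ * 1 + ζ′ * 0)))
      regroup = solve-∀
    ... | no _  | yes _ = ℕ.≤-reflexive (trans
      (cong (_+ (0 + (ζ * 0 + ζ * 1))) (length-when (z′ Fin.≟ other z) ((x′ ⊕ y′) ⊝ x ∷ []))) (regroup k ζ (𝟙 (z′ Fin.≟ other z))))
      where
      ζ = 𝟙 (z′ Fin.≟ z)
      regroup : ∀ k ζ ζ′ → ζ′ * 1 + (0 + (ζ * 0 + ζ * 1)) ≡ k * 0 + (2 * 0 + (ζ + (ζ′ * 0 + ζ′ * 1)))
      regroup = solve-∀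
    ... | no _  | no _  = ℕ.≤-reflexive (trans
      (cong (_+ (0 + (ζ * 0 + ζ * 0))) (length-when (z′ Fin.≟ z) ((x′ ⊕ y′) ⊝ x ∷ []))) (regroup k ζ (𝟙 (z′ Fin.≟ other z))))
      where
      ζ = 𝟙 (z′ Fin.≟ z)
      regroup : ∀ k ζ ζ′ → ζ * 1 + (0 + (ζ * 0 + ζ * 0)) ≡ k * 0 + (2 * 0 + (ζ + (ζ′ * 0 + ζ′ * 0)))
      regroup = solve-∀

    -- A generous count is enough here: an `A` guard on the diagonal is credited with all of it in
    -- its layer, since the bound serves to show that diagonals without such a guard do not occur.
    points : Fin 2 → Fin k → V k → List (Fin k)
    points z ℓ (A x′ y′ z′) = when ((x′ ⊝ y′) Fin.≟ ℓ)
      (when (z′ Fin.≟ z) (allFin k) ++ when (z′ Fin.≟ other z) (x′ ⊕ 𝟏 ∷ pred x′ ∷ []))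
    points z ℓ (B x′ y′ z′) = when (z′ Fin.≟ z) (x′ ∷ pred x′ ∷ [])

    ∈-points : ∀ z ℓ x u → N u (A x (x ⊝ ℓ) z) → x List.∈ points z ℓ u
    ∈-points z ℓ x (A x′ y′ z′) (eq , side) = ∈-when ((x′ ⊝ y′) Fin.≟ ℓ) line (position side)
      where
      line : x′ ⊝ y′ ≡ ℓ
      line = by
        (solve 6 (λ x x′ y′ d e ℓ → e :+ (x′ :+ ((x :+ y′) :+ (d :+ ℓ))) ⊜ ℓ :+ ((e :+ y′) :+ ((x′ :+ d) :+ x)))
          refl x x′ y′ (x ⊝ ℓ) (x′ ⊝ y′) ℓ)
        (⊝-⊕ x′ y′ ⊞ (eq ⊞ sym (⊝-⊕ x ℓ)))
      position : SameSide x′ x z′ z →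
          x List.∈ (when (z′ Fin.≟ z) (allFin k) ++ when (z′ Fin.≟ other z) (x′ ⊕ 𝟏 ∷ pred x′ ∷ []))
      position (inj₁ (z≡ , _)) = ∈-++⁺ˡ (∈-when (z′ Fin.≟ z) z≡ (∈-allFin x))
      position (inj₂ (z≡ , near)) = ∈-++⁺ʳ (when (z′ Fin.≟ z) (allFin k))
        (∈-when (z′ Fin.≟ other z) (other-swap z≡) (candidate (near⇒pred near)))
        where
        candidate : x ≡ x′ ⊕ 𝟏 ⊎ x ≡ pred x′ → x List.∈ (x′ ⊕ 𝟏 ∷ pred x′ ∷ [])
        candidate (inj₁ eq) = here eq
        candidate (inj₂ eq) = there (here eq)
    ∈-points z ℓ x (B x′ y′ z′) (z≡ , inj₁ (x≡ , _)) = ∈-when (z′ Fin.≟ z) z≡ (here (sym x≡))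
    ∈-points z ℓ x (B x′ y′ z′) (z≡ , inj₂ (x≡ , _)) = ∈-when (z′ Fin.≟ z) z≡
      (there (here (sym (trans (cong pred x≡) (suc-pred x)))))

    length-points : ∀ z ℓ u → length (points z ℓ u) ≤ k * onA z ℓ u + (2 * onA (other z) ℓ u + 2 * inB z u)
    length-points z ℓ (A x′ y′ z′) = ℕ.≤-reflexive (begin
      length (when ((x′ ⊝ y′) Fin.≟ ℓ) (left ++ right))
        ≡⟨ trans (length-when ((x′ ⊝ y′) Fin.≟ ℓ) (left ++ right)) (cong (μ *_) (trans (length-++ left)
             (cong₂ _+_ (length-when (z′ Fin.≟ z) (allFin k)) (length-when (z′ Fin.≟ other z) _)))) ⟩
      μ * (ζ * length (allFin k) + ζ′ * 2)
        ≡⟨ cong (λ l → μ * (ζ * l + ζ′ * 2)) (length-tabulate {n = k} (λ i → i)) ⟩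
      μ * (ζ * k + ζ′ * 2)
        ≡⟨ regroup μ ζ ζ′ k ⟩
      k * (ζ * μ) + (2 * (ζ′ * μ) + 2 * 0) ∎)
      where
      open ≡-Reasoning
      left = when (z′ Fin.≟ z) (allFin k)
      right = when (z′ Fin.≟ other z) (x′ ⊕ 𝟏 ∷ pred x′ ∷ [])
      μ = 𝟙 ((x′ ⊝ y′) Fin.≟ ℓ)
      ζ = 𝟙 (z′ Fin.≟ z)
      ζ′ = 𝟙 (z′ Fin.≟ other z)
      regroup : ∀ l ζ ζ′ k → l * (ζ * k + ζ′ * 2) ≡ k * (ζ * l) + (2 * (ζ′ * l) + 2 * 0)
      regroup = solve-∀
    length-points z ℓ (B x′ y′ z′) = ℕ.≤-reflexive (trans (length-when (z′ Fin.≟ z) _)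
      (regroup (𝟙 (z′ Fin.≟ z)) k))
      where
      regroup : ∀ ζ k → ζ * 2 ≡ k * 0 + (2 * 0 + 2 * ζ)
      regroup = solve-∀

  -- Counting guards by columns and diagonals

  module Counts {n} (d : Fin n → V k) where

    cA cB eA : Fin 2 → Fin k → ℕ
    cA z x = sum (λ i → atA z x (d i))
    cB z x = sum (λ i → atB z x (d i))
    eA z ℓ = sum (λ i → onA z ℓ (d i))

    α β : Fin 2 → ℕ
    α z = sum (λ i → inA z (d i))
    β z = sum (λ i → inB z (d i))

    isZero : ℕ → ℕ
    isZero zero    = 1
    isZero (suc _) = 0

    p : Fin 2 → ℕ
    p z = sum (λ x → isZero (cA z x))

    private
      sum-zero : ∀ m → sum {m} (λ _ → 0) ≡ 0
      sum-zero m = trans (sum-const m 0) (ℕ.*-zeroʳ m)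

      sum-*𝟙 : ∀ c (x′ : Fin k) → sum (λ x → c * 𝟙 (x′ Fin.≟ x)) ≡ c
      sum-*𝟙 c x′ = trans (sym (*-distribˡ-sum c (λ x → 𝟙 (x′ Fin.≟ x))))
        (trans (cong (c *_) (sum-𝟙 x′)) (ℕ.*-identityʳ c))

    sum-cA : ∀ z → sum (cA z) ≡ α z
    sum-cA z = trans (∑-comm (λ x i → atA z x (d i))) (sum-cong-≗ (λ i → total (d i)))
      where
      total : ∀ u → sum (λ x → atA z x u) ≡ inA z u
      total (A x′ y′ z′) = sum-*𝟙 (𝟙 (z′ Fin.≟ z)) x′
      total (B x′ y′ z′) = sum-zero k

    sum-cB : ∀ z → sum (cB z) ≡ β z
    sum-cB z = trans (∑-comm (λ x i → atB z x (d i))) (sum-cong-≗ (λ i → total (d i)))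
      where
      total : ∀ u → sum (λ x → atB z x u) ≡ inB z u
      total (A x′ y′ z′) = sum-zero k
      total (B x′ y′ z′) = sum-*𝟙 (𝟙 (z′ Fin.≟ z)) x′

    sum-eA : ∀ z → sum (eA z) ≡ α z
    sum-eA z = trans (∑-comm (λ x i → onA z x (d i))) (sum-cong-≗ (λ i → total (d i)))
      where
      total : ∀ u → sum (λ ℓ → onA z ℓ u) ≡ inA z u
      total (A x′ y′ z′) = sum-*𝟙 (𝟙 (z′ Fin.≟ z)) (x′ ⊝ y′)
      total (B x′ y′ z′) = sum-zero k

    around : ∀ z → sum (λ x → cB z (pred x) + cB z (x ⊕ 𝟏)) ≡ β z + β z
    around z = trans (∑-distrib-+ (cB z ∘ pred) (cB z ∘ (_⊕ 𝟏)))
      (cong₂ _+_ (trans (sum-pred (cB z)) (sum-cB z)) (trans (sum-⊕𝟏 (cB z)) (sum-cB z)))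

    total-count : ∀ z → (α z + β z) + (α (other z) + β (other z)) ≡ n
    total-count z = begin
      (α z + β z) + (α (other z) + β (other z))
        ≡⟨ cong₂ _+_ (∑-distrib-+ (λ i → inA z (d i)) (λ i → inB z (d i)))
                     (∑-distrib-+ (λ i → inA (other z) (d i)) (λ i → inB (other z) (d i))) ⟨
      sum (λ i → inA z (d i) + inB z (d i)) + sum (λ i → inA (other z) (d i) + inB (other z) (d i))
        ≡⟨ ∑-distrib-+ (λ i → inA z (d i) + inB z (d i)) (λ i → inA (other z) (d i) + inB (other z) (d i)) ⟨
      sum (λ i → (inA z (d i) + inB z (d i)) + (inA (other z) (d i) + inB (other z) (d i)))
        ≡⟨ sum-cong-≗ (λ i → once (d i)) ⟩
      sum {n} (λ _ → 1)
        ≡⟨ trans (sum-const n 1) (ℕ.*-identityʳ n) ⟩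
      n ∎
      where
      open ≡-Reasoning
      layer-once : ∀ (z z′ : Fin 2) → 𝟙 (z′ Fin.≟ z) + 𝟙 (z′ Fin.≟ other z) ≡ 1
      layer-once zero       zero       = refl
      layer-once zero       (suc zero) = refl
      layer-once (suc zero) zero       = refl
      layer-once (suc zero) (suc zero) = refl
      once : ∀ u → (inA z u + inB z u) + (inA (other z) u + inB (other z) u) ≡ 1
      once (A x′ y′ z′) =
        trans (cong₂ _+_ (ℕ.+-identityʳ (𝟙 (z′ Fin.≟ z))) (ℕ.+-identityʳ (𝟙 (z′ Fin.≟ other z)))) (layer-once z z′)
      once (B x′ y′ z′) = layer-once z z′

    missed-bound : ∀ z → k ≤ α z + p z
    missed-bound z = begin
      k                                          ≡⟨ trans (sum-const k 1) (ℕ.*-identityʳ k) ⟨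
      sum {k} (λ _ → 1)                          ≤⟨ sum-mono (λ x → hit-or-zero (cA z x)) ⟩
      sum (λ x → cA z x + isZero (cA z x))       ≡⟨ ∑-distrib-+ (cA z) (λ x → isZero (cA z x)) ⟩
      sum (cA z) + p z                           ≡⟨ cong (_+ p z) (sum-cA z) ⟩
      α z + p z                                  ∎
      where
      open ℕ.≤-Reasoning
      hit-or-zero : ∀ m → 1 ≤ m + isZero m
      hit-or-zero zero    = s≤s z≤n
      hit-or-zero (suc m) = s≤s z≤n

    all-hit : ∀ z → p z ≡ 0 → ∀ x → 1 ≤ cA z x
    all-hit z pz≡0 x = nonzero (cA z x)
      (ℕ.≤-trans (term≤sum (λ x → isZero (cA z x)) x) (ℕ.≤-reflexive pz≡0))
      where
      nonzero : ∀ m → isZero m ≤ 0 → 1 ≤ m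
      nonzero (suc m) _ = s≤s z≤n

    module Bounds (dom : Dom d) where

      column-bound : ∀ z x → k + (cA z x + (cB z (pred x) + cB z (x ⊕ 𝟏)))
        ≤ k * cA z x + (2 * cA z (pred x) + (β z + (cB (other z) (pred x) + cB (other z) (x ⊕ 𝟏))))
      column-bound z x = begin
        k + (cA z x + (cB z (pred x) + cB z (x ⊕ 𝟏)))
          ≤⟨ ℕ.+-monoˡ-≤ _ (covering-bound (rows z x ∘ d) (λ y → let i , Ni = dom (B x y z) in i , ∈-rows z x y (d i) Ni)) ⟩
        sum (λ i → length (rows z x (d i))) + (cA z x + (cB z (pred x) + cB z (x ⊕ 𝟏)))
          ≡⟨ cong (sum (λ i → length (rows z x (d i))) +_) (trans (∑-distrib-+ (atA z x ∘ d) _)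
               (cong (cA z x +_) (∑-distrib-+ (atB z (pred x) ∘ d) (atB z (x ⊕ 𝟏) ∘ d)))) ⟨
        sum (λ i → length (rows z x (d i))) + sum (λ i → excess z x (d i))
          ≡⟨ ∑-distrib-+ (λ i → length (rows z x (d i))) (λ i → excess z x (d i)) ⟨
        sum (λ i → length (rows z x (d i)) + excess z x (d i))
          ≤⟨ sum-mono (λ i → length-rows z x (d i)) ⟩
        sum (λ i → weight z x (d i))
          ≡⟨ trans (∑-distrib-+ (λ i → k * atA z x (d i)) _) (cong₂ _+_ (sym (*-distribˡ-sum k (atA z x ∘ d)))
               (trans (∑-distrib-+ (λ i → 2 * atA z (pred x) (d i)) _) (cong₂ _+_ (sym (*-distribˡ-sum 2 (atA z (pred x) ∘ d)))
               (trans (∑-distrib-+ (inB z ∘ d) _) (cong (β z +_) (∑-distrib-+ (atB (other z) (pred x) ∘ d) (atB (other z) (x ⊕ 𝟏) ∘ d))))))) ⟩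
        k * cA z x + (2 * cA z (pred x) + (β z + (cB (other z) (pred x) + cB (other z) (x ⊕ 𝟏)))) ∎
        where open ℕ.≤-Reasoning

      diagonal-bound : ∀ z ℓ → k ≤ k * eA z ℓ + (2 * eA (other z) ℓ + 2 * β z)
      diagonal-bound z ℓ = begin
        k ≤⟨ covering-bound (points z ℓ ∘ d) (λ x → let i , Ni = dom (A x (x ⊝ ℓ) z) in i , ∈-points z ℓ x (d i) Ni) ⟩
        sum (λ i → length (points z ℓ (d i))) ≤⟨ sum-mono (λ i → length-points z ℓ (d i)) ⟩
        sum (λ i → k * onA z ℓ (d i) + (2 * onA (other z) ℓ (d i) + 2 * inB z (d i)))
          ≡⟨ trans (∑-distrib-+ (λ i → k * onA z ℓ (d i)) _) (cong₂ _+_ (sym (*-distribˡ-sum k (onA z ℓ ∘ d)))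
               (trans (∑-distrib-+ (λ i → 2 * onA (other z) ℓ (d i)) _) (cong₂ _+_ (sym (*-distribˡ-sum 2 (onA (other z) ℓ ∘ d))) (sym (*-distribˡ-sum 2 (inB z ∘ d)))))) ⟩
        k * eA z ℓ + (2 * eA (other z) ℓ + 2 * β z) ∎
        where open ℕ.≤-Reasoning

      -- The sum of `column-bound` over all columns. Each `B` guard is adjacent to two columns,
      -- which explains both terms `2 * β`; the `α z` of the correction cancels one of the `A`
      -- guards' two extra rows.
      grid-bound : ∀ z → k * k + 2 * β z ≤ (k + 1) * α z + k * β z + 2 * β (other z)
      grid-bound z = ℕ.+-cancelʳ-≤ (α z) _ _ (begin
        k * k + 2 * β z + α z
          ≡⟨ regroup k (α z) (β z) ⟩
        k * k + (α z + (β z + β z))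
          ≡⟨ trans (∑-distrib-+ {k} (λ _ → k) _) (cong₂ _+_ (sum-const k k) (trans (∑-distrib-+ (cA z) _)
               (cong₂ _+_ (sum-cA z) (around z)))) ⟨
        sum (λ x → k + (cA z x + (cB z (pred x) + cB z (x ⊕ 𝟏))))
          ≤⟨ sum-mono (column-bound z) ⟩
        sum (λ x → k * cA z x + (2 * cA z (pred x) + (β z + (cB (other z) (pred x) + cB (other z) (x ⊕ 𝟏)))))
          ≡⟨ trans (∑-distrib-+ (λ x → k * cA z x) _) (cong₂ _+_ (trans (sym (*-distribˡ-sum k (cA z))) (cong (k *_) (sum-cA z)))
               (trans (∑-distrib-+ (λ x → 2 * cA z (pred x)) _) (cong₂ _+_
                 (trans (sym (*-distribˡ-sum 2 (cA z ∘ pred))) (cong (2 *_) (trans (sum-pred (cA z)) (sum-cA z))))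
               (trans (∑-distrib-+ {k} (λ _ → β z) _) (cong₂ _+_ (sum-const k (β z)) (around (other z))))))) ⟩
        k * α z + (2 * α z + (k * β z + (β (other z) + β (other z))))
          ≡⟨ regroup′ k (α z) (β z) (β (other z)) ⟩
        (k + 1) * α z + k * β z + 2 * β (other z) + α z ∎)
        where
        open ℕ.≤-Reasoning
        regroup : ∀ k α β → k * k + 2 * β + α ≡ k * k + (α + (β + β))
        regroup = solve-∀
        regroup′ : ∀ k α β β′ → k * α + (2 * α + (k * β + (β′ + β′))) ≡ (k + 1) * α + k * β + 2 * β′ + α
        regroup′ = solve-∀

      -- Adding `column-bound` over the missed columns alone would ignore that guards before an
      -- occupied column are lost to them. Therefore 2 is added in every column: an occupied one
      -- pays it by `2 * cA z (pred x) + 2 * ι (pred x)`, a missed one by the surplus 2 in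
      -- `(β z + 2) * ι x`.
      missed-column-bound : ∀ z → p z * k + 2 * k ≤ 2 * α z + p z * (β z + 4) + 2 * β (other z)
      missed-column-bound z = begin
        p z * k + 2 * k
          ≡⟨ cong₂ _+_ (ℕ.*-comm (p z) k) (ℕ.*-comm 2 k) ⟩
        k * p z + k * 2
          ≡⟨ trans (∑-distrib-+ (λ x → k * ι x) (λ _ → 2)) (cong₂ _+_ (sym (*-distribˡ-sum k ι)) (sum-const k 2)) ⟨
        sum (λ x → k * ι x + 2)
          ≤⟨ sum-mono pointwise ⟩
        sum (λ x → 2 * cA z (pred x) + ((β z + 2) * ι x + (2 * ι (pred x) + (cB (other z) (pred x) + cB (other z) (x ⊕ 𝟏)))))
          ≡⟨ trans (∑-distrib-+ (λ x → 2 * cA z (pred x)) _) (cong₂ _+_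
                 (trans (sym (*-distribˡ-sum 2 (cA z ∘ pred))) (cong (2 *_) (trans (sum-pred (cA z)) (sum-cA z))))
               (trans (∑-distrib-+ (λ x → (β z + 2) * ι x) _) (cong₂ _+_ (sym (*-distribˡ-sum (β z + 2) ι))
               (trans (∑-distrib-+ (λ x → 2 * ι (pred x)) _) (cong₂ _+_
                 (trans (sym (*-distribˡ-sum 2 (ι ∘ pred))) (cong (2 *_) (sum-pred ι))) (around (other z))))))) ⟩
        2 * α z + ((β z + 2) * p z + (2 * p z + (β (other z) + β (other z))))
          ≡⟨ regroup (α z) (β z) (p z) (β (other z)) ⟩
        2 * α z + p z * (β z + 4) + 2 * β (other z) ∎
        where
        open ℕ.≤-Reasoning
        regroup : ∀ α β p β′ → 2 * α + ((β + 2) * p + (2 * p + (β′ + β′))) ≡ 2 * α + p * (β + 4) + 2 * β′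
        regroup = solve-∀
        ι : Fin k → ℕ
        ι x = isZero (cA z x)
        missed : ∀ k c b b₁ b₂ i e → k + (0 + e) ≤ k * 0 + (2 * c + (b + (b₁ + b₂))) →
                 k * 1 + 2 ≤ 2 * c + ((b + 2) * 1 + (2 * i + (b₁ + b₂)))
        missed k c b b₁ b₂ i e h = ℕ.≤-trans
          (ℕ.≤-trans (ℕ.m≤m+n (k * 1 + 2) e) (ℕ.≤-reflexive (left k e)))
          (ℕ.≤-trans (ℕ.+-monoˡ-≤ 2 h) (ℕ.≤-trans (ℕ.m≤m+n _ (2 * i)) (ℕ.≤-reflexive (right k c b b₁ b₂ i))))
          where
          left : ∀ k e → k * 1 + 2 + e ≡ k + (0 + e) + 2
          left = solve-∀
          right : ∀ k c b b₁ b₂ i →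
              k * 0 + (2 * c + (b + (b₁ + b₂))) + 2 + 2 * i ≡ 2 * c + ((b + 2) * 1 + (2 * i + (b₁ + b₂)))
          right = solve-∀
        hit : ∀ k c b r → k * 0 + 2 ≤ 2 * c + (b * 0 + (2 * isZero c + r))
        hit k c b r = subst₂ (λ l m → l + 2 ≤ 2 * c + (m + (2 * isZero c + r))) (sym (ℕ.*-zeroʳ k)) (sym (ℕ.*-zeroʳ b))
          (ℕ.≤-trans (two c) (ℕ.≤-trans (ℕ.m≤m+n _ r) (ℕ.≤-reflexive (ℕ.+-assoc (2 * c) (2 * isZero c) r))))
          where
          two : ∀ c → 2 ≤ 2 * c + 2 * isZero c
          two zero    = ℕ.≤-refl
          two (suc c) = ℕ.≤-trans (ℕ.*-monoʳ-≤ 2 (s≤s (z≤n {c}))) (ℕ.m≤m+n _ 0)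
        pointwise : ∀ x →
            k * ι x + 2 ≤ 2 * cA z (pred x) + ((β z + 2) * ι x + (2 * ι (pred x) + (cB (other z) (pred x) + cB (other z) (x ⊕ 𝟏))))
        pointwise x with cA z x | column-bound z x
        ... | zero  | h = missed k (cA z (pred x)) (β z) (cB (other z) (pred x)) (cB (other z) (x ⊕ 𝟏)) (ι (pred x)) _ h
        ... | suc _ | _ = hit k (cA z (pred x)) (β z + 2) _

-- Dominating sets with at most 2k + 1 guards

module Structure (k : ℕ) (C : OddCyclic k) where

  open OddCyclic C
  open Model k C

  A-injective : ∀ {x y t x′ y′ t′} → _≡_ {A = V k} (A x y t) (A x′ y′ t′) → x ≡ x′ × y ≡ y′ × t ≡ t′
  A-injective refl = refl , refl , refl

  𝟙*𝟙 : ∀ {P Q : Set} (P? : Dec P) (Q? : Dec Q) → P → Q → 1 ≤ 𝟙 P? * 𝟙 Q?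
  𝟙*𝟙 P? Q? p q = ℕ.≤-reflexive (sym (cong₂ _*_ (𝟙-yes P? p) (𝟙-yes Q? q)))

  𝟙*𝟙⁻¹ : ∀ {P Q : Set} (P? : Dec P) (Q? : Dec Q) → 1 ≤ 𝟙 P? * 𝟙 Q? → P × Q
  𝟙*𝟙⁻¹ (yes p) (yes q) _ = p , q

  atA⁻¹ : ∀ {z x} u → 1 ≤ atA z x u → ∃[ y ] u ≡ A x y z
  atA⁻¹ {z} {x} (A x′ y′ z′) h with 𝟙*𝟙⁻¹ (z′ Fin.≟ z) (x′ Fin.≟ x) h
  ... | refl , refl = y′ , refl

  inB⁻¹ : ∀ {z} u → 1 ≤ inB z u → ∃₂ λ x y → u ≡ B x y z
  inB⁻¹ {z} (B x′ y′ z′) h with 𝟙⁻¹ (z′ Fin.≟ z) h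
  ... | refl = x′ , y′ , refl

  atA-A : ∀ {u x y z} → u ≡ A x y z → 1 ≤ atA z x u
  atA-A {x = x} {z = z} refl = 𝟙*𝟙 (z Fin.≟ z) (x Fin.≟ x) refl refl

  onA-A : ∀ {u x y z ℓ} → u ≡ A x y z → x ⊝ y ≡ ℓ → 1 ≤ onA z ℓ u
  onA-A {x = x} {y} {z} refl refl = 𝟙*𝟙 (z Fin.≟ z) ((x ⊝ y) Fin.≟ (x ⊝ y)) refl refl

  inB-B : ∀ {u x y z} → u ≡ B x y z → 1 ≤ inB z u
  inB-B {z = z} refl = ℕ.≤-reflexive (sym (𝟙-yes (z Fin.≟ z) refl))

  ⊝-cong-diagonal : ∀ {x y x′ y′} → x ⊕ y′ ≡ x′ ⊕ y → x ⊝ y ≡ x′ ⊝ y′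
  ⊝-cong-diagonal {x} {y} {x′} {y′} eq = by
    (solve 6 (λ x y x′ y′ e e′ → e :+ (x :+ ((x′ :+ y) :+ (e′ :+ y′))) ⊜ e′ :+ ((e :+ y) :+ ((x :+ y′) :+ x′)))
      refl x y x′ y′ (x ⊝ y) (x′ ⊝ y′))
    (⊝-⊕ x y ⊞ (eq ⊞ sym (⊝-⊕ x′ y′)))

  ⊝-injective-diagonal : ∀ {x y x′ y′} → x ⊝ y ≡ x′ ⊝ y′ → x ⊕ y′ ≡ x′ ⊕ y
  ⊝-injective-diagonal {x} {y} {x′} {y′} eq = by
    (solve 6 (λ x y x′ y′ e e′ → (x :+ y′) :+ ((e :+ y) :+ (e′ :+ x′)) ⊜ (x′ :+ y) :+ (x :+ (e :+ (e′ :+ y′))))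
      refl x y x′ y′ (x ⊝ y) (x′ ⊝ y′))
    (sym (⊝-⊕ x y) ⊞ (eq ⊞ ⊝-⊕ x′ y′))

  -- D_c ⊆ D for the set D of values of d.
  Contains : ∀ {n} → Fin k → (Fin n → V k) → Set
  Contains c d = ∀ x t → ∃₂ λ i y → d i ≡ A x y t × x ⊕ y ≡ c

  module Good {n} (d : Fin n → V k) (dom : Dom d) (17≤k : 17 ≤ k) (n≤2k+1 : n ≤ 2 * k + 1) (z : Fin 2)
    (spread : Spread k (Counts.α d z) (Counts.β d z) (Counts.α d (other z)) (Counts.β d (other z)) (Counts.p d z) (Counts.p d (other z))) where

    open Counts d
    open Bounds dom
    open Spread spread

    private
      z′ : Fin 2
      z′ = other z

      layers : ∀ {P : Fin 2 → Set} → P z → P z′ → ∀ t → P t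
      layers {P} pz pz′ t with z Fin.≟ t
      ... | yes refl = pz
      ... | no z≢t   = subst P (sym (≢⇒other z≢t)) pz′

      β≤1 : ∀ t → β t ≤ 1
      β≤1 = layers (ℕ.≤-trans (ℕ.≤-reflexive empty) z≤n) rest

      n≤k*2+1 : n ≤ k * 2 + 1
      n≤k*2+1 = ℕ.≤-trans n≤2k+1 (ℕ.≤-reflexive (cong (_+ 1) (ℕ.*-comm 2 k)))

    -- On a diagonal without an `A` guard in its layer, a guard of the other layer dominates two
    -- points and the lone `B` guard at most two. Seven such guards would dominate at most
    -- `2 * 7 + 2 = 16 < 17` points.
    gap : ∀ t ℓ → eA t ℓ ≡ 0 → 8 ≤ eA (other t) ℓ
    gap t ℓ eq = ℕ.≮⇒≥ λ e<8 → ℕ.<⇒≱ (bound e<8) 17≤k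
      where
      open ℕ.≤-Reasoning
      bound : eA (other t) ℓ < 8 → k < 17
      bound (s≤s e≤7) = s≤s (begin
        k                                              ≤⟨ diagonal-bound t ℓ ⟩
        k * eA t ℓ + (2 * eA (other t) ℓ + 2 * β t)
          ≡⟨ cong (_+ (2 * eA (other t) ℓ + 2 * β t)) (trans (cong (k *_) eq) (ℕ.*-zeroʳ k)) ⟩
        2 * eA (other t) ℓ + 2 * β t                   ≤⟨ ℕ.+-mono-≤ (ℕ.*-monoʳ-≤ 2 e≤7) (ℕ.*-monoʳ-≤ 2 (β≤1 t)) ⟩
        16                                             ∎)

    -- Both layers together have at least two guards on each diagonal and eight on one with a gap,
    -- so a gap would require `2k + 6` guards.
    every-diagonal : ∀ t ℓ → 1 ≤ eA t ℓ
    every-diagonal t ℓ with eA t ℓ in eq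
    ... | suc _ = s≤s z≤n
    ... | zero  = contradiction
      (ℕ.≤-trans (sum-≥₁ 2 6 ℓ two (eight t ℓ eq)) both≤)
      (λ h → ℕ.<⇒≱ (s≤s (s≤s z≤n)) (ℕ.+-cancelˡ-≤ (k * 2) 6 1 h))
      where
      both : Fin k → ℕ
      both ℓ = eA zero ℓ + eA (suc zero) ℓ
      eight : ∀ t ℓ → eA t ℓ ≡ 0 → 8 ≤ both ℓ
      eight zero       ℓ eq = ℕ.≤-trans (gap zero ℓ eq) (ℕ.m≤n+m _ _)
      eight (suc zero) ℓ eq = ℕ.≤-trans (gap (suc zero) ℓ eq) (ℕ.m≤m+n _ _)
      two : ∀ ℓ → 2 ≤ both ℓ
      two ℓ with eA zero ℓ in eq₀ | eA (suc zero) ℓ in eq₁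
      ... | zero  | _     = ℕ.≤-trans (s≤s (s≤s z≤n)) (subst₂ (λ m o → 8 ≤ m + o) eq₀ eq₁ (eight zero ℓ eq₀))
      ... | suc m | zero  = ℕ.≤-trans (s≤s (s≤s z≤n)) (subst₂ (λ m o → 8 ≤ m + o) eq₀ eq₁ (eight (suc zero) ℓ eq₁))
      ... | suc m | suc o = s≤s (ℕ.≤-trans (s≤s z≤n) (ℕ.m≤n+m (suc o) m))
      both≤ : sum both ≤ k * 2 + 1
      both≤ = begin
        sum both                                                ≡⟨ ∑-distrib-+ (eA zero) (eA (suc zero)) ⟩
        sum (eA zero) + sum (eA (suc zero))                     ≡⟨ cong₂ _+_ (sum-eA zero) (sum-eA (suc zero)) ⟩
        α zero + α (suc zero)
          ≤⟨ ℕ.+-mono-≤ (ℕ.m≤m+n (α zero) (β zero)) (ℕ.m≤m+n (α (suc zero)) (β (suc zero))) ⟩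
        (α zero + β zero) + (α (suc zero) + β (suc zero))       ≡⟨ total-count zero ⟩
        n                                                       ≤⟨ n≤k*2+1 ⟩
        k * 2 + 1                                               ∎
        where open ℕ.≤-Reasoning

    private
      ¬double : ∀ {f : Fin k → ℕ} {x} → sum f ≡ k → (∀ x → 1 ≤ f x) → ¬ (2 ≤ f x)
      ¬double {f} {x} sum≡k hit double = ℕ.1+n≰n (ℕ.≤-trans
        (ℕ.≤-trans (ℕ.≤-reflexive (trans (ℕ.+-comm 1 k) (cong (_+ 1) (sym (ℕ.*-identityʳ k))))) (sum-≥₁ 1 1 x hit double))
        (ℕ.≤-reflexive sum≡k))

      ¬two-doubles : ∀ {f : Fin k → ℕ} {x x′} → sum f ≤ k + 1 → (∀ x → 1 ≤ f x) → x ≢ x′ → 2 ≤ f x → ¬ (2 ≤ f x′)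
      ¬two-doubles {f} sum≤ hit x≢x′ fx fx′ = contradiction
        (ℕ.+-cancelˡ-≤ k 2 1 (ℕ.≤-trans (ℕ.≤-reflexive (cong (_+ 2) (sym (ℕ.*-identityʳ k))))
          (ℕ.≤-trans (sum-≥₂ 1 x≢x′ hit fx fx′) sum≤))) λ { (s≤s ()) }

    -- Layer `z` has `k` guards on `A` and all `k` columns are occupied, so none is occupied twice;
    -- the same count works for diagonals.
    column-unique : ∀ {i j x y y′} → d i ≡ A x y z → d j ≡ A x y′ z → i ≡ j
    column-unique {i} {j} {x} di dj with i Fin.≟ j
    ... | yes i≡j = i≡j
    ... | no i≢j  = contradiction (sum≥2 i≢j (atA-A di) (atA-A dj))
      (¬double {cA z} {x} (trans (sum-cA z) exact) (all-hit z full))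

    diagonal-unique : ∀ {i j x y x′ y′} → d i ≡ A x y z → d j ≡ A x′ y′ z → x ⊕ y′ ≡ x′ ⊕ y → i ≡ j
    diagonal-unique {i} {j} {x} {y} di dj eq with i Fin.≟ j
    ... | yes i≡j = i≡j
    ... | no i≢j  = contradiction (sum≥2 i≢j (onA-A di refl) (onA-A dj (sym (⊝-cong-diagonal eq))))
      (¬double {eA z} {x ⊝ y} (trans (sum-eA z) exact) (every-diagonal z))

    no-B : ∀ {i x y} → d i ≢ B x y z
    no-B {i} di = contradiction (ℕ.≤-trans (inB-B di) (ℕ.≤-trans (term≤sum (inB z ∘ d) i) (ℕ.≤-reflexive empty))) λ ()

    B-unique : ∀ {i j x y x′ y′} → d i ≡ B x y z′ → d j ≡ B x′ y′ z′ → i ≡ j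
    B-unique di dj = sum≤1⇒unique rest (inB-B di) (inB-B dj)

    private
      guard : ∀ x → ∃₂ λ i y → d i ≡ A x y z
      guard x with sum-positive (λ i → atA z x (d i)) (all-hit z full x)
      ... | i , hit = i , atA⁻¹ (d i) hit

      y⟨_⟩ : Fin k → Fin k
      y⟨ x ⟩ = proj₁ (proj₂ (guard x))

      at : ∀ x → d (proj₁ (guard x)) ≡ A x y⟨ x ⟩ z
      at x = proj₂ (proj₂ (guard x))

      row-unique : ∀ {i x y} → d i ≡ A x y z → y ≡ y⟨ x ⟩
      row-unique {x =
        x} di = proj₁ (proj₂ (A-injective (trans (sym di) (trans (cong d (column-unique di (at x))) (at x)))))

      g : Fin k → Fin k
      g x = x ⊕ y⟨ x ⟩

      antidiagonal : ∃[ c ] (∀ {i x y} → d i ≡ B x y z′ → x ⊕ y ≡ c)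
      antidiagonal with Fin.any? (λ i → 1 ≤? inB z′ (d i))
      -- With no `B` guard in layer `z′` the condition is vacuous and any value will do.
      ... | no none = 𝟎 , λ di → contradiction (_ , inB-B di) none
      ... | yes (i , hit) with inB⁻¹ (d i) hit
      ...   | x , y , di = x ⊕ y , λ {j} dj → same (trans (sym dj) (trans (cong d (B-unique dj di)) di))
        where
        same : ∀ {x y t x′ y′ t′} → _≡_ {A = V k} (B x y t) (B x′ y′ t′) → x ⊕ y ≡ x′ ⊕ y′
        same refl = refl

      c : Fin k
      c = proj₁ antidiagonal

    -- Only the lone guard on the B side can dominate B x (y x) z, unless
    -- the row drops by one from the previous column (it cannot rise by one,
    -- as diagonals are not shared); that guard reaches just one antidiagonal.
    step : ∀ x → g x ≡ g (pred x) ⊎ g x ≡ c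
    step x with dom (B x y⟨ x ⟩ z)
    ... | i , Ni with d i in di
    ...   | B x′ y′ t with Ni
    ...     | eq , inj₁ (refl , _) = contradiction di no-B
    ...     | eq , inj₂ (z≡ , _) =
      inj₂ (trans (sym eq) (proj₂ antidiagonal (trans di (cong (B x′ y′) (other-swap z≡)))))
    step x | i , Ni | A x′ y′ t with Ni
    ...     | refl , inj₁ (refl , y′≢) = contradiction (row-unique di) y′≢
    ...     | refl , inj₂ (x≡ , inj₁ y≡) = contradiction
      (proj₁ (A-injective (trans (sym di) (trans (cong d (diagonal-unique di (at x) line)) (at x)))))
      λ x′≡x → 1≢0 (⊕-cancelˡ x _ _ (trans (sym (trans x≡ (cong (_⊕ 𝟏) x′≡x))) (sym (⊕-identityʳ x))))
      where
      line : x′ ⊕ y⟨ x ⟩ ≡ x ⊕ y′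
      line = trans (cong (x′ ⊕_) y≡) (trans (solve 3 (λ x y o → x :+ (y :+ o)
          ⊜ (x :+ o) :+ y) refl x′ y′ 𝟏) (cong (_⊕ y′) (sym x≡)))
    ...     | refl , inj₂ (x≡ , inj₂ y≡) = inj₁ (trans sums (cong g (sym (trans (cong pred x≡) (suc-pred x′)))))
      where
      sums : x ⊕ y⟨ x ⟩ ≡ x′ ⊕ y⟨ x′ ⟩
      sums = trans (cong (_⊕ y⟨ x ⟩) x≡) (trans (solve 3 (λ x y o → (x :+ o) :+ y ⊜ x :+ (y :+ o)) refl x′ y⟨ x ⟩ 𝟏)
        (cong (x′ ⊕_) (trans (sym y≡) (row-unique di))))

    -- From one column to the next `g` keeps its value or jumps to `c`, and once at `c` it stays
    -- there. Columns are cyclically ordered, so a value `c` anywhere spreads to all of them; if `c`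
    -- never occurs, `g` never changes.
    g-constant : ∃[ c₀ ] (∀ x → g x ≡ c₀)
    g-constant with Fin.any? (λ x → g x Fin.≟ c)
    ... | yes (x₀ , gx₀≡c) = c , cyclic-induction (λ x → g x ≡ c) next gx₀≡c
      where
      next : ∀ x → g x ≡ c → g (x ⊕ 𝟏) ≡ c
      next x gx≡c with step (x ⊕ 𝟏)
      ... | inj₁ eq = trans eq (trans (cong g (suc-pred x)) gx≡c)
      ... | inj₂ eq = eq
    ... | no none = g 𝟎 , cyclic-induction (λ x → g x ≡ g 𝟎) next refl
      where
      next : ∀ x → g x ≡ g 𝟎 → g (x ⊕ 𝟏) ≡ g 𝟎
      next x gx≡ with step (x ⊕ 𝟏)
      ... | inj₁ eq = trans eq (trans (cong g (suc-pred x)) gx≡)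
      ... | inj₂ eq = contradiction (x ⊕ 𝟏 , eq) none

    private
      -- The next point up the diagonal of the guard in column `x` is reached from the other layer
      -- by its own two neighbours alone: the copy of the guard and the point two steps up.
      -- Symmetrically downwards.
      Above Below : Fin k → Set
      Above x = ∃[ i ] d i ≡ A (x ⊕ 𝟏 ⊕ 𝟏) (y⟨ x ⟩ ⊕ 𝟏 ⊕ 𝟏) z′
      Below x = ∃[ i ] d i ≡ A (pred (pred x)) (pred (pred y⟨ x ⟩)) z′

      Copied : Fin k → Set
      Copied x = ∃[ i ] d i ≡ A x y⟨ x ⟩ z′

    -- Within layer z a guard leaves its two diagonal neighbours undominated.
    above : ∀ x → Copied x ⊎ Above x
    above x with dom (A (x ⊕ 𝟏) (y⟨ x ⟩ ⊕ 𝟏) z)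
    ... | i , Ni with d i in di
    ...   | B x′ y′ t = contradiction (trans di (cong (B x′ y′) (proj₁ Ni))) no-B
    ...   | A x′ y′ t = place (proj₁ Ni) (proj₂ Ni)
      where
      line : x′ ⊕ (y⟨ x ⟩ ⊕ 𝟏) ≡ (x ⊕ 𝟏) ⊕ y′ → x′ ⊕ y⟨ x ⟩ ≡ x ⊕ y′
      line eq = by (solve 5 (λ x y x′ y′ o → (x′ :+ y) :+ ((x :+ o) :+ y′)
          ⊜ (x :+ y′) :+ (x′ :+ (y :+ o))) refl x y⟨ x ⟩ x′ y′ 𝟏) eq
      place : x′ ⊕ (y⟨ x ⟩ ⊕ 𝟏) ≡ (x ⊕ 𝟏) ⊕ y′ → SameSide x′ (x ⊕ 𝟏) t z → Copied x ⊎ Above x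
      place eq (inj₁ (refl , ¬near)) = contradiction
        (inj₁ (cong (_⊕ 𝟏) (sym (proj₁ (A-injective (trans (sym di) (trans (cong d (diagonal-unique di (at x) (line eq))) (at x)))))))) ¬near
      place eq (inj₂ (z≡ , inj₁ x≡)) with ⊕-cancelʳ 𝟏 _ _ x≡ | line eq
      ... | refl | y≡ = inj₁ (i , trans di (cong₂ (A x) (sym (⊕-cancelˡ x _ _ y≡)) (other-swap z≡)))
      place eq (inj₂ (z≡ , inj₂ refl)) = inj₂ (i , trans di (cong₂ (A (x ⊕ 𝟏 ⊕ 𝟏))
        (⊕-cancelˡ x _ _ (trans (sym (line eq)) (solve 3 (λ x y o → x :+ o :+ o :+ y
            ⊜ x :+ (y :+ o :+ o)) refl x y⟨ x ⟩ 𝟏))) (other-swap z≡)))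

    below : ∀ x → Copied x ⊎ Below x
    below x with dom (A (pred x) (pred y⟨ x ⟩) z)
    ... | i , Ni with d i in di
    ...   | B x′ y′ t = contradiction (trans di (cong (B x′ y′) (proj₁ Ni))) no-B
    ...   | A x′ y′ t = place (proj₁ Ni) (proj₂ Ni)
      where
      line : x′ ⊕ pred y⟨ x ⟩ ≡ pred x ⊕ y′ → x′ ⊕ y⟨ x ⟩ ≡ x ⊕ y′
      line eq = by (solve 5 (λ x y x′ y′ m → (x′ :+ y) :+ ((x :+ m) :+ y′)
          ⊜ (x :+ y′) :+ (x′ :+ (y :+ m))) refl x y⟨ x ⟩ x′ y′ (⊖ 𝟏)) eq
      place : x′ ⊕ pred y⟨ x ⟩ ≡ pred x ⊕ y′ → SameSide x′ (pred x) t z → Copied x ⊎ Below x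
      place eq (inj₁ (refl , ¬near)) = contradiction
        (inj₂ (trans (proj₁ (A-injective (trans (sym di) (trans (cong d (diagonal-unique di (at x) (line eq))) (at x))))) (sym (pred-suc x)))) ¬near
      place eq (inj₂ (z≡ , inj₂ x≡)) with trans x≡ (pred-suc x) | line eq
      ... | refl | y≡ = inj₁ (i , trans di (cong₂ (A x) (sym (⊕-cancelˡ x _ _ y≡)) (other-swap z≡)))
      place eq (inj₂ (z≡ , inj₁ x≡)) with trans (sym (suc-pred x′)) (sym (cong pred x≡))
      ... | refl = inj₂ (i , trans di (cong₂ (A (pred (pred x)))
        (⊕-cancelˡ x _ _ (trans (sym (line eq)) (solve 3 (λ x y m → x :+ m :+ m :+ y
            ⊜ x :+ (y :+ m :+ m)) refl x y⟨ x ⟩ (⊖ 𝟏)))) (other-swap z≡)))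

    private
      pred-pred-⊕ : ∀ u → pred (pred u) ⊕ (𝟏 ⊕ 𝟏) ≡ u
      pred-pred-⊕ u = trans (sym (⊕-assoc (pred (pred u)) 𝟏 𝟏)) (trans (cong (_⊕ 𝟏) (pred-suc (pred u))) (pred-suc u))

      g-all : ∀ x x′ → x ⊕ y⟨ x ⟩ ≡ x′ ⊕ y⟨ x′ ⟩
      g-all x x′ = trans (proj₂ g-constant x) (sym (proj₂ g-constant x′))

      above-twice : ∀ {x} → Above x → Below x → 2 ≤ eA z′ (x ⊝ y⟨ x ⟩)
      above-twice {x} (i , di) (j , dj) = sum≥2 i≢j
        (onA-A di (⊝-cong-diagonal (solve 3 (λ x y o → (x :+ o :+ o) :+ y ⊜ x :+ (y :+ o :+ o)) refl x y⟨ x ⟩ 𝟏)))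
        (onA-A dj (⊝-cong-diagonal (solve 3 (λ x y o → (x :+ o :+ o) :+ y ⊜ x :+ (y :+ o :+ o)) refl x y⟨ x ⟩ (⊖ 𝟏))))
        where
        i≢j : i ≢ j
        i≢j refl = 4≢0 (by
          (solve 3 (λ x m o → (o :+ o :+ o :+ o) :+ (m :+ x)
              ⊜ :0 :+ ((x :+ o :+ o) :+ (m :+ (o :+ o)))) refl x (pred (pred x)) 𝟏)
          (proj₁ (A-injective (trans (sym di) dj)) ⊞ pred-pred-⊕ x))

      -- Copies lie on the antidiagonal of `g-constant`; the guard two steps up has coordinate sum
      -- larger by 4, so it is not the copy in its column.
      column-above : ∀ {x} → Above x → Copied (x ⊕ 𝟏 ⊕ 𝟏) → 2 ≤ cA z′ (x ⊕ 𝟏 ⊕ 𝟏)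
      column-above {x} (i , di) (j , dj) = sum≥2 i≢j (atA-A di) (atA-A dj)
        where
        i≢j : i ≢ j
        i≢j refl = 4≢0 (by
          (solve 4 (λ x y y′ o → (o :+ o :+ o :+ o) :+ (y′ :+ (x :+ y))
              ⊜ :0 :+ ((y :+ o :+ o) :+ ((x :+ o :+ o) :+ y′)))
            refl x y⟨ x ⟩ y⟨ x ⊕ 𝟏 ⊕ 𝟏 ⟩ 𝟏)
          (proj₁ (proj₂ (A-injective (trans (sym di) dj))) ⊞ g-all (x ⊕ 𝟏 ⊕ 𝟏) x))

      column-below : ∀ {x} → Below x → Copied (pred (pred x)) → 2 ≤ cA z′ (pred (pred x))
      column-below {x} (i , di) (j , dj) = sum≥2 i≢j (atA-A di) (atA-A dj)
        where
        i≢j : i ≢ j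
        i≢j refl = 4≢0 (by
          (solve 6 (λ x y p q y′ o → (o :+ o :+ o :+ o) :+ (q :+ (p :+ y′) :+ (x :+ y))
              ⊜ :0 :+ (y′ :+ (x :+ y) :+ ((p :+ (o :+ o)) :+ (q :+ (o :+ o)))))
            refl x y⟨ x ⟩ (pred (pred x)) (pred (pred y⟨ x ⟩)) y⟨ pred (pred x) ⟩ 𝟏)
          (sym (proj₁ (proj₂ (A-injective (trans (sym di) dj)))) ⊞ g-all x (pred (pred x)) ⊞ (pred-pred-⊕ x ⊞ pred-pred-⊕ y⟨ x ⟩)))

      status : ∀ x → Copied x ⊎ (Above x × Below x)
      status x with above x | below x
      ... | inj₁ c | _      = inj₁ c
      ... | inj₂ _ | inj₁ c = inj₁ c
      ... | inj₂ a | inj₂ b = inj₂ (a , b)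

      shared-once : ∀ {x x′} → x ≢ x′ → Above x × Below x → ¬ (Above x′ × Below x′)
      shared-once {x} {x′} x≢x′ (a , b) (a′ , b′) =
        ¬two-doubles (ℕ.≤-trans (ℕ.≤-reflexive (sum-eA z′)) rest′) (every-diagonal z′)
        (λ eq → x≢x′ (proj₁ (A-injective (trans (sym (at x)) (trans (cong d (diagonal-unique (at x) (at x′) (⊝-injective-diagonal eq))) (at x′))))))
        (above-twice a b) (above-twice a′ b′)

    -- Suppose `x` is not copied. Its diagonal then has two guards in layer `z′`. If one of the
    -- columns `x ± 2` is not copied either, a second diagonal is doubled; if both are copied, both
    -- these columns are doubled. Layer `z′` has at most `k + 1` guards on the `A` side and occupies
    -- all columns and diagonals, so it has room for one doubling of each kind.
    copied : ∀ x → Copied x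
    copied x with status x
    ... | inj₁ c = c
    ... | inj₂ ab@(a , b) with status (x ⊕ 𝟏 ⊕ 𝟏) | status (pred (pred x))
    ...   | inj₂ ab′ | _ = contradiction ab′ (shared-once
      (λ eq → 2≢0 (⊕-cancelˡ x _ _ (trans (sym (⊕-assoc x 𝟏 𝟏)) (trans (sym eq) (sym (⊕-identityʳ x)))))) ab)
    ...   | inj₁ _ | inj₂ ab′ = contradiction ab′ (shared-once
      (λ eq → 2≢0 (⊕-cancelˡ x _ _ (trans (cong (_⊕ (𝟏 ⊕ 𝟏)) eq) (trans (pred-pred-⊕ x) (sym (⊕-identityʳ x)))))) ab)
    ...   | inj₁ c₁ | inj₁ c₂ = contradiction (column-below b c₂)
      (¬two-doubles (ℕ.≤-trans (ℕ.≤-reflexive (sum-cA z′)) rest′) (all-hit z′ full′) distinct (column-above a c₁))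
      where
      distinct : x ⊕ 𝟏 ⊕ 𝟏 ≢ pred (pred x)
      distinct eq = 4≢0 (by
        (solve 3 (λ x m o → (o :+ o :+ o :+ o) :+ (m :+ x)
            ⊜ :0 :+ ((x :+ o :+ o) :+ (m :+ (o :+ o)))) refl x (pred (pred x)) 𝟏)
        (eq ⊞ pred-pred-⊕ x))

    contains : ∃[ c₀ ] Contains c₀ d
    contains = proj₁ g-constant , λ x → layers {λ t → ∃₂ λ i y → d i ≡ A x y t × x ⊕ y ≡ proj₁ g-constant}
      (proj₁ (guard x) , y⟨ x ⟩ , at x , proj₂ g-constant x)
      (proj₁ (copied x) , y⟨ x ⟩ , proj₂ (copied x) , proj₂ g-constant x)

  module _ {n} (d : Fin n → V k) where

    private
      module D = Counts d
      module Dφ = Counts (φ ∘ d)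

    α-φ : ∀ z → Dφ.α z ≡ D.β z
    α-φ z = sum-cong-≗ (λ i → swap (d i))
      where
      swap : ∀ u → inA z (φ u) ≡ inB z u
      swap (A _ _ _) = refl
      swap (B _ _ _) = refl

    β-φ : ∀ z → Dφ.β z ≡ D.α z
    β-φ z = sum-cong-≗ (λ i → swap (d i))
      where
      swap : ∀ u → inB z (φ u) ≡ inA z u
      swap (A _ _ _) = refl
      swap (B _ _ _) = refl

    -- The fields marked `ᵗ` are the direct bounds for `φ ∘ d`, whose `A` guards are the `B` guards
    -- of `d`.
    layer : Dom d → ∀ z → Layer k (D.α z) (D.β z) (D.α (other z)) (D.β (other z)) (D.p z) (Dφ.p z)
    layer dom z = record
      { grid    = D.Bounds.grid-bound dom z
      ; gridᵗ   = subst₂ _≤_ (cong (λ b → k * k + 2 * b) (β-φ z))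
          (cong₂ _+_ (cong₂ (λ a b → (k + 1) * a + k * b) (α-φ z) (β-φ z)) (cong (2 *_) (β-φ (other z))))
          (Dφ.Bounds.grid-bound (Dom-φ dom) z)
      ; column  = D.Bounds.missed-column-bound dom z
      ; columnᵗ = subst (Dφ.p z * k + 2 * k ≤_)
          (cong₂ _+_ (cong₂ (λ a b → 2 * a + Dφ.p z * (b + 4)) (α-φ z) (β-φ z)) (cong (2 *_) (β-φ (other z))))
          (Dφ.Bounds.missed-column-bound (Dom-φ dom) z)
      ; missed  = D.missed-bound z
      ; missedᵗ = subst (λ a → k ≤ a + Dφ.p z) (α-φ z) (Dφ.missed-bound z)
      }

    structure : Dom d → 17 ≤ k → n ≤ 2 * k + 1 → ∃[ c ] (Contains c d ⊎ Contains c (φ ∘ d))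
    structure dom 17≤k n≤ with one-sided D.α D.β D.p Dφ.p 17≤k (layer dom) (λ z → ℕ.≤-trans (ℕ.≤-reflexive (D.total-count z)) n≤)
    ... | z , inj₁ spread with Good.contains d dom 17≤k n≤ z spread
    ...   | c , contains = c , inj₁ contains
    structure dom 17≤k n≤ | z , inj₂ spread with Good.contains (φ ∘ d) (Dom-φ dom) 17≤k n≤ z spreadφ
      where
      spreadφ : Spread k (Dφ.α z) (Dφ.β z) (Dφ.α (other z)) (Dφ.β (other z)) (Dφ.p z) (Dφ.p (other z))
      spreadφ = record
        { exact = trans (α-φ z) (Spread.exact spread) ; empty = trans (β-φ z) (Spread.empty spread)
        ; full = Spread.full spread ; full′ = Spread.full′ spread
        ; rest = subst (_≤ 1) (sym (β-φ (other z))) (Spread.rest spread)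
        ; rest′ = subst (_≤ k + 1) (sym (α-φ (other z))) (Spread.rest′ spread) }
    ...   | c , contains = c , inj₂ contains

-- Reconfiguration

module Moves (k : ℕ) (C : OddCyclic k) where

  open OddCyclic C
  open Model k C
  open Structure k C

  module Selection {n} (d : Fin n → V k) {c} (contains : Contains c d) where

    sel : Fin k → Fin 2 → Fin n
    sel x t = proj₁ (contains x t)

    row : Fin k → Fin 2 → Fin k
    row x t = proj₁ (proj₂ (contains x t))

    at : ∀ x t → d (sel x t) ≡ A x (row x t) t
    at x t = proj₁ (proj₂ (proj₂ (contains x t)))

    row-sum : ∀ x t → x ⊕ row x t ≡ c
    row-sum x t = proj₂ (proj₂ (proj₂ (contains x t)))

    row-same : ∀ x t t′ → row x t ≡ row x t′
    row-same x t t′ = ⊕-cancelˡ x _ _ (trans (row-sum x t) (sym (row-sum x t′)))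

    sel-injective : ∀ {x t x′ t′} → sel x t ≡ sel x′ t′ → x ≡ x′ × t ≡ t′
    sel-injective {x} {t} {x′} {t′} eq with A-injective (trans (sym (at x t)) (trans (cong d eq) (at x′ t′)))
    ... | x≡ , _ , t≡ = x≡ , t≡

    Extra : Fin n → Set
    Extra i = ∀ x t → sel x t ≢ i

    selected? : ∀ i → (∃₂ λ x t → sel x t ≡ i) ⊎ Extra i
    selected? i with Fin.any? (λ x → Fin.any? (λ t → sel x t Fin.≟ i))
    ... | yes (x , t , eq) = inj₁ (x , t , eq)
    ... | no none = inj₂ λ x t eq → none (x , t , eq)

    private
      enumerate : Fin (k * 2) → Fin n
      enumerate i = sel (proj₁ (Fin.remQuot 2 i)) (proj₂ (Fin.remQuot {k} 2 i))

      enumerate-injective : ∀ {i j} → enumerate i ≡ enumerate j → i ≡ j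
      enumerate-injective {i} {j} eq with sel-injective eq
      ... | x≡ , t≡ =
        trans (sym (Fin.combine-remQuot {k} 2 i)) (trans (cong₂ Fin.combine x≡ t≡) (Fin.combine-remQuot {k} 2 j))

    size : k * 2 ≤ n
    size = Fin.injective⇒≤ enumerate-injective

    -- Two extras beside the selected guards would inject `2k + 2` indices into `Fin n`.
    extra-unique : n ≤ 2 * k + 1 → ∀ {i j} → Extra i → Extra j → i ≡ j
    extra-unique n≤ {i} {j} ei ej with i Fin.≟ j
    ... | yes i≡j = i≡j
    ... | no i≢j  = contradiction (ℕ.≤-trans (Fin.injective⇒≤ extended-injective) n≤)
      (λ h → ℕ.1+n≰n (ℕ.≤-trans (ℕ.≤-reflexive size≡) h))
      where
      size≡ : suc (2 * k + 1) ≡ 2 + k * 2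
      size≡ = lemma k where
        lemma : ∀ k → suc (2 * k + 1) ≡ 2 + k * 2
        lemma = solve-∀
      extended : Fin (2 + k * 2) → Fin n
      extended zero          = i
      extended (suc zero)    = j
      extended (suc (suc m)) = enumerate m
      extended-injective : ∀ {p q} → extended p ≡ extended q → p ≡ q
      extended-injective {zero}          {zero}          eq = refl
      extended-injective {zero}          {suc zero}      eq = contradiction eq i≢j
      extended-injective {zero}          {suc (suc _)}   eq = contradiction (sym eq) (ei _ _)
      extended-injective {suc zero}      {zero}          eq = contradiction (sym eq) i≢j
      extended-injective {suc zero}      {suc zero}      eq = refl
      extended-injective {suc zero}      {suc (suc _)}   eq = contradiction (sym eq) (ej _ _)
      extended-injective {suc (suc _)}   {zero}          eq = contradiction eq (ei _ _)
      extended-injective {suc (suc _)}   {suc zero}      eq = contradiction eq (ej _ _)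
      extended-injective {suc (suc _)}   {suc (suc _)}   eq = cong (λ m → suc (suc m)) (enumerate-injective eq)

  -- Take x* with 2 x* + c′ = c. In either layer, the guards in columns x* and
  -- x* + 1 can reach the same position only, so that one of them is extra.
  ¬cross : ∀ {n} (d d′ : Fin n → V k) → n ≤ 2 * k + 1 → (∀ i → N (d i) (d′ i)) →
           ∀ {c c′} → Contains c d → ¬ Contains c′ (φ ∘ d′)
  ¬cross d d′ n≤ move {c} {c′} hc hc′ with stuck zero | stuck (suc zero)
    where
    module S = Selection d hc
    module S′ = Selection (φ ∘ d′) hc′
    x* : Fin k
    x* = half (c ⊝ c′)
    x*-eq : x* ⊕ x* ⊕ c′ ≡ c
    x*-eq = trans (cong (_⊕ c′) (half-⊕ (c ⊝ c′))) (⊝-⊕ c c′)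
    Lands : Fin k → Fin 2 → Fin k → Set
    Lands x t x̂ = ∃[ ŷ ] (ŷ ≡ c′ ⊕ x̂ × N (A x (S.row x t) t) (B x̂ ŷ t))
    landing : ∀ x t → (∃[ x′ ] (S′.sel x′ t ≡ S.sel x t × Lands x t (⊖ x′))) ⊎ S′.Extra (S.sel x t)
    landing x t with S′.selected? (S.sel x t)
    ... | inj₂ extra = inj₂ extra
    ... | inj₁ (x′ , t′ , eq) with subst₂ N (S.at x t) d′-at (move (S.sel x t))
      where
      d′-at : d′ (S.sel x t) ≡ B (⊖ x′) (S′.row x′ t′) t′
      d′-at = trans (sym (φ-involutive _)) (cong φ (trans (cong (φ ∘ d′) (sym eq)) (S′.at x′ t′)))
    ...   | refl , near = inj₁ (x′ , eq , S′.row x′ t , row-eq , refl , near)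
      where
      row-eq : S′.row x′ t ≡ c′ ⊕ (⊖ x′)
      row-eq = by (solve 4 (λ x m y c → y :+ (c :+ (x :+ m))
          ⊜ (c :+ m) :+ ((x :+ y) :+ :0)) refl x′ (⊖ x′) (S′.row x′ t) c′)
        (S′.row-sum x′ t ⊞ sym (⊖-inverseʳ x′))
    -- Staying in column `x*` is impossible: the rows `c − x*` and `c′ + x*` coincide, and this is
    -- the row that a guard misses in its own column.
    left : ∀ t {x̂} → Lands x* t x̂ → x̂ ≡ x* ⊕ 𝟏
    left t (ŷ , ŷ≡ , _ , inj₂ (x̂≡ , _))     = x̂≡
    left t (ŷ , ŷ≡ , _ , inj₁ (refl , y≢)) = contradiction (⊕-cancelˡ x* _ _ (trans (S.row-sum x* t)
      (trans (sym x*-eq) (trans (solve 2 (λ x c → x :+ x :+ c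
          ⊜ x :+ (c :+ x)) refl x* c′) (cong (x* ⊕_) (sym ŷ≡)))))) y≢
    -- Moving on to column `x* + 2` would change the row by 3, while such a move allows only a
    -- change by one.
    right : ∀ t {x̂} → Lands (x* ⊕ 𝟏) t x̂ → x̂ ≡ x* ⊕ 𝟏
    right t (ŷ , ŷ≡ , _ , inj₁ (x̂≡ , _))   = sym x̂≡
    right t {x̂} (ŷ , ŷ≡ , _ , inj₂ (x̂≡ , near)) = contradiction near far
      where
      y = S.row (x* ⊕ 𝟏) t
      y+3≡ŷ : y ⊕ 𝟏 ⊕ 𝟏 ⊕ 𝟏 ≡ ŷ
      y+3≡ŷ = by
        (solve 7 (λ x y ŷ x̂ c c′ o → (y :+ o :+ o :+ o) :+ (c :+ (x :+ x :+ c′) :+ (ŷ :+ x̂))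
            ⊜ ŷ :+ ((x :+ o :+ y) :+ c :+ ((c′ :+ x̂) :+ (x :+ o :+ o))))
          refl x* y ŷ x̂ c c′ 𝟏)
        (S.row-sum (x* ⊕ 𝟏) t ⊞ sym x*-eq ⊞ (sym ŷ≡ ⊞ sym x̂≡))
      far : ¬ Near y ŷ
      far (inj₁ eq) = 2≢0 (by (solve 3 (λ y ŷ o → (o :+ o) :+ (ŷ :+ (y :+ o))
          ⊜ :0 :+ ((y :+ o :+ o :+ o) :+ ŷ)) refl y ŷ 𝟏) (y+3≡ŷ ⊞ eq))
      far (inj₂ eq) = 4≢0 (by (solve 3 (λ y ŷ o → (o :+ o :+ o :+ o) :+ (ŷ :+ y)
          ⊜ :0 :+ ((y :+ o :+ o :+ o) :+ (ŷ :+ o))) refl y ŷ 𝟏) (y+3≡ŷ ⊞ sym eq))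
    stuck : ∀ t → ∃[ x ] S′.Extra (S.sel x t)
    stuck t with landing x* t | landing (x* ⊕ 𝟏) t
    ... | inj₂ extra | _ = x* , extra
    ... | inj₁ _ | inj₂ extra = x* ⊕ 𝟏 , extra
    ... | inj₁ (x₁ , eq₁ , l₁) | inj₁ (x₂ , eq₂ , l₂) = contradiction
      (proj₁ (S.sel-injective (trans (sym eq₁) (trans (cong (λ x → S′.sel x t) x₁≡x₂) eq₂))))
      λ eq → 1≢0 (⊕-cancelˡ x* _ _ (trans (sym eq) (sym (⊕-identityʳ x*))))
      where
      x₁≡x₂ : x₁ ≡ x₂
      x₁≡x₂ = trans (sym (⊖-involutive x₁)) (trans (cong ⊖_ (trans (left t l₁) (sym (right t l₂)))) (⊖-involutive x₂))
  ... | x₀ , extra₀ | x₁ , extra₁ = contradiction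
    (proj₂ (Selection.sel-injective d hc (Selection.extra-unique (φ ∘ d′) hc′ n≤ extra₀ extra₁))) λ ()

  -- Lies in the layer without w, out of reach of the guards of D_c on the
  -- diagonal of w (in column h, where 2 h = x′ − y′ + c) or three columns from w.
  target : Fin k → V k → V k
  target c (A x′ y′ z′) = B (half ((x′ ⊝ y′) ⊕ c) ⊕ 𝟏 ⊕ 𝟏) 𝟎 (other z′)
  target c (B x′ y′ z′) = B (x′ ⊕ 𝟏 ⊕ 𝟏 ⊕ 𝟏) 𝟎 (other z′)

  target-B : ∀ c w → ∃₂ λ x z → target c w ≡ B x 𝟎 z
  target-B c (A x′ y′ z′) = _ , _ , refl
  target-B c (B x′ y′ z′) = _ , _ , refl

  offset-≢ : ∀ {x y e} → e ≢ 𝟎 → y ≡ x ⊕ e → y ≢ x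
  offset-≢ {x} e≢0 y≡ y≡x = e≢0 (⊕-cancelˡ x _ _ (trans (sym y≡) (trans y≡x (sym (⊕-identityʳ x)))))

  private
    2-steps : ∀ x → x ⊕ 𝟏 ⊕ 𝟏 ≡ x ⊕ (𝟏 ⊕ 𝟏)
    2-steps x = ⊕-assoc x 𝟏 𝟏

    3-steps : ∀ x → x ⊕ 𝟏 ⊕ 𝟏 ⊕ 𝟏 ≡ x ⊕ (𝟏 ⊕ 𝟏 ⊕ 𝟏)
    3-steps x = trans (cong (_⊕ 𝟏) (2-steps x)) (⊕-assoc x _ 𝟏)

    4-steps : ∀ x → x ⊕ 𝟏 ⊕ 𝟏 ⊕ 𝟏 ⊕ 𝟏 ≡ x ⊕ (𝟏 ⊕ 𝟏 ⊕ 𝟏 ⊕ 𝟏)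
    4-steps x = trans (cong (_⊕ 𝟏) (3-steps x)) (⊕-assoc x _ 𝟏)

    5-steps : ∀ x → x ⊕ 𝟏 ⊕ 𝟏 ⊕ 𝟏 ⊕ 𝟏 ⊕ 𝟏 ≡ x ⊕ (𝟏 ⊕ 𝟏 ⊕ 𝟏 ⊕ 𝟏 ⊕ 𝟏)
    5-steps x = trans (cong (_⊕ 𝟏) (4-steps x)) (⊕-assoc x _ 𝟏)

  ¬N-target : ∀ c w → ¬ N w (target c w)
  ¬N-target c (A x′ y′ z′) (z≡ , _) = other-≢ z′ z≡
  ¬N-target c (B x′ y′ z′) (_ , inj₁ (z≡ , _)) = other-≢ z′ z≡
  ¬N-target c (B x′ y′ z′) (_ , inj₂ (_ , inj₁ x≡)) = offset-≢ 2≢0 (2-steps (x′ ⊕ 𝟏)) x≡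
  ¬N-target c (B x′ y′ z′) (_ , inj₂ (_ , inj₂ x≡)) = offset-≢ 4≢0
    (4-steps x′) (sym x≡)

  target-≢ : ∀ c w → w ≢ target c w
  target-≢ c (B x′ y′ z′) eq = other-≢ z′ (cong proj₂ eq)

  -- A guard that starts in column x of D_c, on the opposite side, and moves
  -- to the target leaves a vacancy that w cannot fill.
  vacancy : ∀ {c x y z x₁ y₁ z₁ w} → x ⊕ y ≡ c → N (A x y z) (target c w) →
            x ⊕ y₁ ≡ x₁ ⊕ y → SameSide x x₁ (other z) z₁ → ¬ N w (A x₁ y₁ (other z₁))
  vacancy {c} {x} {y} {z} {x₁} {y₁} {w = A x′ y′ z′} sum (_ , reach) diag _ (diag′ , _) = apart reach
    where
    h = half ((x′ ⊝ y′) ⊕ c)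
    -- If `w` could fill the vacancy, `w` and `A x y z` would share a diagonal; `x − y = x′ − y′`
    -- and `x + y = c` determine the column as `h`. The target is in column `h + 2`, but the guard
    -- reaches columns `x` and `x + 1` only.
    h≡x : h ≡ x
    h≡x = ⊕-self-injective (trans (half-⊕ ((x′ ⊝ y′) ⊕ c)) (by
      (solve 8 (λ x y x₁ y₁ x′ y′ e c → (e :+ c) :+ (((x :+ y₁) :+ (x₁ :+ y′)) :+ (x′ :+ (x :+ y)))
          ⊜ (x :+ x) :+ (((x₁ :+ y) :+ (x′ :+ y₁)) :+ ((e :+ y′) :+ c)))
        refl x y x₁ y₁ x′ y′ (x′ ⊝ y′) c)
      (sym diag ⊞ diag′ ⊞ (⊝-⊕ x′ y′ ⊞ sym sum))))
    apart : ¬ ((x ≡ h ⊕ 𝟏 ⊕ 𝟏 × y ≢ 𝟎) ⊎ (h ⊕ 𝟏 ⊕ 𝟏 ≡ x ⊕ 𝟏 × Near y 𝟎))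
    apart (inj₁ (eq , _)) = offset-≢ 2≢0 (2-steps h) (trans (sym eq) (sym h≡x))
    apart (inj₂ (eq , _)) = offset-≢ 1≢0 refl (trans (⊕-cancelʳ 𝟏 _ _ eq) (sym h≡x))
  -- The partner stayed in its layer, so the vacancy is in the layer of the target, which a `B`
  -- guard at `w` cannot enter on the `A` side.
  vacancy {w = B x′ y′ z′} sum (refl , reach) diag (inj₁ (z≡ , _)) (z′≡ , _) =
    other-≢ z′ (trans z′≡ (cong other (trans (sym z≡) (other-involutive z′))))
  vacancy {x =
    x} {x₁ = x₁} {w = B x′ y′ z′} sum (refl , reach) diag (inj₂ (_ , near)) (_ , reach′) = apart near (column reach′) (column′ reach)
    where
    column : ∀ {x x₁ P Q} → (x ≡ x₁ × P) ⊎ (x ≡ x₁ ⊕ 𝟏 × Q) → x ≡ x₁ ⊎ x ≡ x₁ ⊕ 𝟏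
    column (inj₁ (eq , _)) = inj₁ eq
    column (inj₂ (eq , _)) = inj₂ eq
    column′ : ∀ {x v P Q} → (x ≡ v × P) ⊎ (v ≡ x ⊕ 𝟏 × Q) → v ≡ x ⊎ v ≡ x ⊕ 𝟏
    column′ (inj₁ (eq , _)) = inj₁ (sym eq)
    column′ (inj₂ (eq , _)) = inj₂ eq
    -- The partner moved by one column, and each of the two crossings shifts the column by at most
    -- one. The shift by three in `target` exceeds the available total unless one of the numbers 1
    -- to 5 is zero modulo `k`.
    apart : Near x x₁ → x′ ≡ x₁ ⊎ x′ ≡ x₁ ⊕ 𝟏 → ¬ (x′ ⊕ 𝟏 ⊕ 𝟏 ⊕ 𝟏 ≡ x ⊎ x′ ⊕ 𝟏 ⊕ 𝟏 ⊕ 𝟏 ≡ x ⊕ 𝟏)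
    apart (inj₁ refl) (inj₁ refl) (inj₁ eq) = offset-≢ 4≢0 (4-steps x) eq
    apart (inj₁ refl) (inj₁ refl) (inj₂ eq) = offset-≢ 3≢0 (3-steps x) (⊕-cancelʳ 𝟏 _ _ eq)
    apart (inj₁ refl) (inj₂ refl) (inj₁ eq) = offset-≢ 5≢0 (5-steps x) eq
    apart (inj₁ refl) (inj₂ refl) (inj₂ eq) = offset-≢ 4≢0 (4-steps x) (⊕-cancelʳ 𝟏 _ _ eq)
    apart (inj₂ refl) (inj₁ refl) (inj₁ eq) = offset-≢ 2≢0 (2-steps x₁) (⊕-cancelʳ 𝟏 _ _ eq)
    apart (inj₂ refl) (inj₁ refl) (inj₂ eq) = offset-≢ 1≢0 refl (⊕-cancelʳ 𝟏 _ _ (⊕-cancelʳ 𝟏 _ _ eq))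
    apart (inj₂ refl) (inj₂ refl) (inj₁ eq) = offset-≢ 3≢0 (3-steps x₁) (⊕-cancelʳ 𝟏 _ _ eq)
    apart (inj₂ refl) (inj₂ refl) (inj₂ eq) = offset-≢ 2≢0 (2-steps x₁) (⊕-cancelʳ 𝟏 _ _ (⊕-cancelʳ 𝟏 _ _ eq))

  -- If the guard `j` that meets the attack is not the spare one, it has a partner in the same
  -- column of `D_c`. The partner must end on `D_c′`, because `j` is already the one guard outside
  -- it. The copy of its new position in the other layer lies on the same diagonal, from which `D_c`
  -- supplies only `j` and the partner. So the spare guard would have to go there, against
  -- `vacancy`.
  ¬straight : ∀ {n} (d d′ : Fin n → V k) → n ≤ 2 * k + 1 → (∀ i → N (d i) (d′ i)) →
              ∀ {c c′} (hc : Contains c d) → Contains c′ d′ →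
              ∀ {w} → (∀ {i} → Selection.Extra d hc i → d i ≡ w) → ∀ j → d′ j ≢ target c w
  ¬straight d d′ n≤ move {c} {c′} hc hc′ {w} spare j d′j = escape (S.selected? j)
    where
    module S = Selection d hc
    module S′ = Selection d′ hc′
    j-extra : S′.Extra j
    j-extra x t eq with target-B c w
    ... | _ , _ , B≡ with trans (sym (S′.at x t)) (trans (cong d′ eq) (trans d′j B≡))
    ... | ()
    escape : ¬ ((∃₂ λ x t → S.sel x t ≡ j) ⊎ S.Extra j)
    escape (inj₂ extra) = ¬N-target c w (subst₂ N (spare extra) d′j (move j))
    escape (inj₁ (x , t , selxt≡j)) with S′.selected? (S.sel x (other t))
    ... | inj₂ extra = other-≢ t (proj₂ (S.sel-injective (trans selxt≡j (S′.extra-unique n≤ j-extra extra))))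
    ... | inj₁ (x₁ , t₁ , eq₁) = refill (S.selected? (S′.sel x₁ (other t₁)))
      where
      y y₁ : Fin k
      y = S.row x t
      y₁ = S′.row x₁ t₁
      moved : N (A x y (other t)) (A x₁ y₁ t₁)
      moved = subst₂ N (trans (S.at x (other t)) (cong (λ y → A x y (other t)) (S.row-same x (other t) t)))
        (trans (cong d′ (sym eq₁)) (S′.at x₁ t₁)) (move (S.sel x (other t)))
      filled : d′ (S′.sel x₁ (other t₁)) ≡ A x₁ y₁ (other t₁)
      filled = trans (S′.at x₁ (other t₁)) (cong (λ y → A x₁ y (other t₁)) (S′.row-same x₁ (other t₁) t₁))
      reach : N (A x y t) (target c w)
      reach = subst₂ N (trans (cong d (sym selxt≡j)) (S.at x t)) d′j (move j)
      refill : ¬ ((∃₂ λ x₂ t₂ → S.sel x₂ t₂ ≡ S′.sel x₁ (other t₁)) ⊎ S.Extra (S′.sel x₁ (other t₁)))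
      refill (inj₂ extra) = vacancy {w = w} (S.row-sum x t) reach (proj₁ moved) (proj₂ moved)
        (subst₂ N (spare extra) filled (move (S′.sel x₁ (other t₁))))
      refill (inj₁ (x₂ , t₂ , eq₂)) = column (Fin._≟_ t t₂)
        where
        y₂ = S.row x₂ t₂
        moved₂ : N (A x₂ y₂ t₂) (A x₁ y₁ (other t₁))
        moved₂ = subst₂ N (trans (cong d (sym eq₂)) (S.at x₂ t₂)) filled (move (S′.sel x₁ (other t₁)))
        -- Both starting points lie on one diagonal and on the antidiagonal `c`, which meet in a
        -- single point as `k` is odd.
        x₂≡x : x₂ ≡ x
        x₂≡x = ⊕-self-injective (by
          (solve 7 (λ x y x₁ y₁ x₂ y₂ c → (x₂ :+ x₂) :+ (((x₁ :+ y₂) :+ (x :+ y₁)) :+ (c :+ (x :+ y)))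
              ⊜ (x :+ x) :+ (((x₂ :+ y₁) :+ (x₁ :+ y)) :+ ((x₂ :+ y₂) :+ c)))
            refl x y x₁ y₁ x₂ y₂ c)
          (proj₁ moved₂ ⊞ sym (proj₁ moved) ⊞ (S.row-sum x₂ t₂ ⊞ sym (S.row-sum x t))))
        column : ¬ Dec (t ≡ t₂)
        column (yes t≡t₂) = j-extra x₁ (other t₁) (trans (sym eq₂) (trans (cong₂ S.sel x₂≡x (sym t≡t₂)) selxt≡j))
        column (no t≢t₂)  =
          other-≢ t₁ (proj₂ (S′.sel-injective (trans eq₁ (trans (cong₂ S.sel (sym x₂≡x) (sym (≢⇒other t≢t₂))) eq₂))))

  Unanswerable : ∀ {n} → (Fin n → V k) → V k → Set
  Unanswerable {n} d v = (∀ i → d i ≢ v) ×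
    (∀ (d′ : Fin n → V k) → Dom d′ → (∀ i → N (d i) (d′ i)) → ∀ j → d′ j ≢ v)

  attack-contained : ∀ {n} (d : Fin n → V k) → 17 ≤ k → n ≤ 2 * k + 1 → ∀ {c} → Contains c d → ∃ (Unanswerable d)
  attack-contained {n} d 17≤k n≤ {c} hc = target c w , away , unanswered
    where
    open Selection d hc
    spare-guard : ∃[ w ] (∀ {i} → Extra i → d i ≡ w)
    spare-guard with Fin.any? (λ i → Fin.all? (λ x → Fin.all? (λ t → ¬? (sel x t Fin.≟ i))))
    ... | yes (e , extra) = d e , λ {i} extra′ → cong d (extra-unique n≤ extra′ extra)
    -- Without a spare guard the property of `w` is vacuous, so an arbitrary vertex serves to define
    -- the target.
    ... | no none = A 𝟎 𝟎 zero , λ {i} extra → contradiction (i , extra) none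
    w : V k
    w = proj₁ spare-guard
    away : ∀ i → d i ≢ target c w
    away i di with selected? i
    ... | inj₂ extra = target-≢ c w (trans (sym (proj₂ spare-guard extra)) di)
    ... | inj₁ (x , t , refl) with target-B c w
    ...   | _ , _ , B≡ with trans (sym (at x t)) (trans di B≡)
    ...     | ()
    unanswered : ∀ (d′ : Fin n → V k) → Dom d′ → (∀ i → N (d i) (d′ i)) → ∀ j → d′ j ≢ target c w
    unanswered d′ dom′ move j with structure d′ dom′ 17≤k n≤
    ... | c′ , inj₁ hc′ = ¬straight d d′ n≤ move hc hc′ (proj₂ spare-guard) j
    ... | c′ , inj₂ hc′ = contradiction hc′ (¬cross d d′ n≤ move hc)

  attack : ∀ {n} (d : Fin n → V k) → Dom d → 17 ≤ k → n ≤ 2 * k + 1 → ∃ (Unanswerable d)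
  attack d dom 17≤k n≤ with structure d dom 17≤k n≤
  ... | c , inj₁ hc = attack-contained d 17≤k n≤ hc
  ... | c , inj₂ hc with attack-contained (φ ∘ d) 17≤k n≤ hc
  ...   | v , away , unanswered = φ v
    , (λ i di → away i (reflect di))
    , (λ d′ dom′ move j d′j → unanswered (φ ∘ d′) (Dom-φ dom′) (λ i → N-φ (d i) (d′ i) (move i)) j (reflect d′j))
    where
    reflect : ∀ {u} → u ≡ φ v → φ u ≡ v
    reflect eq = trans (cong φ eq) (φ-involutive v)

  dominating-size : ∀ {n} (d : Fin n → V k) → Dom d → 17 ≤ k → 2 * k ≤ n
  dominating-size {n} d dom 17≤k with 2 * k ≤? n
  ... | yes 2k≤n = 2k≤n
  ... | no 2k≰n with structure d dom 17≤k (ℕ.≤-trans (ℕ.<⇒≤ (ℕ.≰⇒> 2k≰n)) (ℕ.m≤m+n (2 * k) 1))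
  ...   | c , inj₁ hc = ℕ.≤-trans (ℕ.≤-reflexive (ℕ.*-comm 2 k)) (Selection.size d hc)
  ...   | c , inj₂ hc = ℕ.≤-trans (ℕ.≤-reflexive (ℕ.*-comm 2 k)) (Selection.size (φ ∘ d) hc)

  -- The set `D_c` for `c = 0`.
  smallest : Fin (k * 2) → V k
  smallest i = A (proj₁ (Fin.remQuot {k} 2 i)) (⊖ proj₁ (Fin.remQuot {k} 2 i)) (proj₂ (Fin.remQuot {k} 2 i))

  smallest-dominates : Dom smallest
  smallest-dominates w with dominator w
    where
    dominator : ∀ w → ∃₂ λ x t → N (A x (⊖ x) t) w
    dominator (B x y z) with (⊖ x) Fin.≟ y
    ... | no ⊖x≢y  = x , z , refl , inj₁ (refl , ⊖x≢y)
    ... | yes refl = pred x , z , refl , inj₂ (sym (pred-suc x) , inj₂ (⊖-suc (sym (pred-suc x))))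
    dominator (A x y z) = on-line (near? x₀ x)
      where
      -- The column in which `D_0` meets the diagonal of the vertex; the guard of the same layer
      -- dominates it unless the columns are adjacent, and then the guard of the other layer does.
      x₀ = half (x ⊝ y)
      line : x₀ ⊕ y ≡ x ⊕ (⊖ x₀)
      line = by (solve 5 (λ x y h m e → (h :+ y) :+ (e :+ (x :+ (h :+ m))) ⊜ (x :+ m) :+ ((h :+ h) :+ ((e :+ y) :+ :0)))
          refl x y x₀ (⊖ x₀) (x ⊝ y))
        (half-⊕ (x ⊝ y) ⊞ (⊝-⊕ x y ⊞ sym (⊖-inverseʳ x₀)))
      on-line : Dec (Near x₀ x) → ∃₂ λ x₁ t → N (A x₁ (⊖ x₁) t) (A x y z)
      on-line (no ¬near) = x₀ , z , line , inj₁ (refl , ¬near)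
      on-line (yes near) = x₀ , other z , line , inj₂ (sym (other-involutive z) , near)
  ... | x , t , near = Fin.combine x t , subst (λ (x , t) → N (A x (⊖ x) t) w) (sym (Fin.remQuot-combine x t)) near

-- Coordinates in the Cayley graph

module Residues (k : ℕ) .{{_ : NonZero k}} (17≤k : 17 ≤ k) (odd : k % 2 ≡ 1) where

  private
    open IsAbelianGroup (+ₙ-isAbelianGroup k) using (comm; identityʳ)

    infixl 6 _+ᵏ_
    _+ᵏ_ : Fin k → Fin k → Fin k
    _+ᵏ_ = _+ₙ_ k

    toℕ-mod : ∀ m → toℕ (m mod k) ≡ m % k
    toℕ-mod m = Fin.toℕ-fromℕ< (m%n<n m k)

    -- For odd `k` this is `(k + 1) / 2`, the inverse of 2 modulo `k`.
    h : ℕ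
    h = suc (k / 2)

    k+1≡2h : ∀ m → m * h + m * h ≡ m + m * k
    k+1≡2h m = trans (lemma m (k / 2)) (cong (λ o → m + m * o)
      (sym (trans (m≡m%n+[m/n]*n k 2) (cong (_+ k / 2 * 2) odd))))
      where
      lemma : ∀ m q → m * suc q + m * suc q ≡ m + m * (1 + q * 2)
      lemma = solve-∀

    mod-+k : ∀ x → (toℕ x + toℕ x * k) mod k ≡ x
    mod-+k x = trans (mod-cong k ([m+kn]%n≡m%n (toℕ x) (toℕ x) k)) (mod-toℕ k x)

    double : ∀ x → (toℕ (x +ᵏ x) * h) mod k ≡ x
    double x = trans (mod-cong k reduce) (mod-+k x)
      where
      open ≡-Reasoning
      t = toℕ x
      reduce : (toℕ (x +ᵏ x) * h) % k ≡ (t + t * k) % k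
      reduce = begin
        (toℕ (x +ᵏ x) * h) % k               ≡⟨ cong (λ m → (m * h) % k) (toℕ-mod (t + t)) ⟩
        ((t + t) % k * h) % k                ≡⟨ %-distribˡ-* ((t + t) % k) h k ⟩
        ((t + t) % k % k * (h % k)) % k      ≡⟨ cong (λ m → (m * (h % k)) % k) (m%n%n≡m%n (t + t) k) ⟩
        ((t + t) % k * (h % k)) % k          ≡⟨ %-distribˡ-* (t + t) h k ⟨
        ((t + t) * h) % k                    ≡⟨ cong (_% k) (trans (ℕ.*-distribʳ-+ h t t) (k+1≡2h t)) ⟩
        (t + t * k) % k                      ∎

    small : ∀ m → m < 17 → toℕ (m mod k) ≡ m
    small m m<17 = trans (toℕ-mod m) (m<n⇒m%n≡m (ℕ.≤-trans m<17 17≤k))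

    mod≢0 : ∀ m {m<17 : True (suc m <? 17)} → suc m mod k ≢ 0ₙ k
    mod≢0 m {m<17} eq with trans (sym (small (suc m) (toWitness m<17))) (trans (cong toℕ eq) (small 0 (s≤s z≤n)))
    ... | ()

    plus-one : ∀ m → (m mod k) +ᵏ (1 mod k) ≡ suc m mod k
    plus-one m = trans (mod-+ k m 1) (cong (_mod k) (ℕ.+-comm m 1))

    two : (1 mod k) +ᵏ (1 mod k) ≡ 2 mod k
    two = plus-one 1
    three : (1 mod k) +ᵏ (1 mod k) +ᵏ (1 mod k) ≡ 3 mod k
    three = trans (cong (_+ᵏ (1 mod k)) two) (plus-one 2)
    four : (1 mod k) +ᵏ (1 mod k) +ᵏ (1 mod k) +ᵏ (1 mod k) ≡ 4 mod k
    four = trans (cong (_+ᵏ (1 mod k)) three) (plus-one 3)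
    five : (1 mod k) +ᵏ (1 mod k) +ᵏ (1 mod k) +ᵏ (1 mod k) +ᵏ (1 mod k) ≡ 5 mod k
    five = trans (cong (_+ᵏ (1 mod k)) four) (plus-one 4)

    induction : (P : Fin k → Set) → (∀ x → P x → P (x +ᵏ (1 mod k))) → ∀ {x} → P x → ∀ y → P y
    induction P step {x} px y = subst P reach (along (toℕ (y +ᵏ (-ₙ_ k x))))
      where
      along : ∀ m → P (x +ᵏ (m mod k))
      along zero    = subst P (sym (identityʳ x)) px
      along (suc m) = subst P (trans (+ₙ-assoc k x (m mod k) (1 mod k)) (cong (x +ᵏ_) (plus-one m))) (step _ (along m))
      reach : x +ᵏ (toℕ (y +ᵏ (-ₙ_ k x)) mod k) ≡ y
      reach = trans (cong (x +ᵏ_) (mod-toℕ k _)) (trans (comm x _) (trans (+ₙ-assoc k y (-ₙ_ k x) x)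
        (trans (cong (y +ᵏ_) (+ₙ-inverseˡ k x)) (identityʳ y))))

  oddCyclic : OddCyclic k
  oddCyclic = record
    { _⊕_              = _+ₙ_ k
    ; 𝟎                = 0ₙ k
    ; 𝟏                = 1 mod k
    ; ⊖_               = -ₙ_ k
    ; isAbelianGroup   = +ₙ-isAbelianGroup k
    ; cyclic-induction = induction
    ; half             = λ u → (toℕ u * h) mod k
    ; half-⊕           =
      λ u → trans (mod-+ k (toℕ u * h) (toℕ u * h)) (trans (cong (_mod k) (k+1≡2h (toℕ u))) (mod-+k u))
    ; ⊕-self-injective = λ {x} {y} eq → trans (sym (double x)) (trans (cong (λ u → (toℕ u * h) mod k) eq) (double y))
    ; 1≢0              = mod≢0 0
    ; 2≢0              = λ eq → mod≢0 1 (trans (sym two) eq)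
    ; 3≢0              = λ eq → mod≢0 2 (trans (sym three) eq)
    ; 4≢0              = λ eq → mod≢0 3 (trans (sym four) eq)
    ; 5≢0              = λ eq → mod≢0 4 (trans (sym five) eq)
    }

module Adjacency (k : ℕ) .{{_ : NonZero k}} (17≤k : 17 ≤ k) (odd : k % 2 ≡ 1) where

  C : OddCyclic k
  C = Residues.oddCyclic k 17≤k odd

  open OddCyclic C
  open Model k C
  open Graph (Δ k) using (_~_)
  open FiniteGroup (⟨G,b⟩ k) using (_∙_; _^_; _⁻¹)

  ⊖0≡0 : ⊖ 𝟎 ≡ 𝟎
  ⊖0≡0 = trans (sym (⊕-identityʳ (⊖ 𝟎))) (⊖-inverseˡ 𝟎)

  private
    A-cong : ∀ {x x′ y y′ z} → x ≡ x′ → y ≡ y′ → _≡_ {A = V k} (A x y z) (A x′ y′ z)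
    A-cong refl refl = refl
    B-cong : ∀ {x x′ y y′ z} → x ≡ x′ → y ≡ y′ → _≡_ {A = V k} (B x y z) (B x′ y′ z)
    B-cong refl refl = refl

    0⊕⊖0 : 𝟎 ⊕ (⊖ 𝟎) ≡ 𝟎
    0⊕⊖0 = trans (⊕-identityˡ (⊖ 𝟎)) ⊖0≡0

  τa^ : ∀ i → τ k ∙ a k ^ i ≡ B 𝟎 (i mod k) zero
  τa^ i = trans (cong (τ k ∙_) (a^-coordinates k i)) (B-cong 0⊕⊖0 (⊕-identityˡ (i mod k)))

  ρ^a^ : ∀ i → ρ k ^ i ∙ a k ^ i ≡ A (i mod k) (i mod k) zero
  ρ^a^ i =
    trans (cong₂ _∙_ (ρ^-coordinates k i) (a^-coordinates k i)) (A-cong (⊕-identityʳ (i mod k)) (⊕-identityˡ (i mod k)))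

  ρa : ρ k ∙ a k ≡ A 𝟏 𝟏 zero
  ρa = A-cong (⊕-identityʳ 𝟏) (⊕-identityˡ 𝟏)

  ρ⁻¹a⁻¹ : ρ k ⁻¹ ∙ a k ⁻¹ ≡ A (⊖ 𝟏) (⊖ 𝟏) zero
  ρ⁻¹a⁻¹ = A-cong (trans (cong ((⊖ 𝟏) ⊕_) ⊖0≡0) (⊕-identityʳ (⊖ 𝟏))) (trans (cong (_⊕ (⊖ 𝟏)) ⊖0≡0) (⊕-identityˡ (⊖ 𝟏)))

  ρτa : ρ k ∙ τ k ∙ a k ≡ B 𝟏 𝟏 zero
  ρτa =
    B-cong (trans (cong₂ _⊕_ (⊕-identityʳ 𝟏) ⊖0≡0) (⊕-identityʳ 𝟏)) (trans (cong (_⊕ 𝟏) (⊕-identityʳ 𝟎)) (⊕-identityˡ 𝟏))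

  ρτa⁻¹ : ρ k ∙ τ k ∙ a k ⁻¹ ≡ B 𝟏 (⊖ 𝟏) zero
  ρτa⁻¹ = B-cong (trans (cong₂ _⊕_ (⊕-identityʳ 𝟏) (trans (cong ⊖_ ⊖0≡0) ⊖0≡0)) (⊕-identityʳ 𝟏))
    (trans (cong (_⊕ (⊖ 𝟏)) (⊕-identityʳ 𝟎)) (⊕-identityˡ (⊖ 𝟏)))

  ρab : ρ k ∙ a k ∙ b k ≡ A 𝟏 𝟏 (suc zero)
  ρab = trans (cong (_∙ b k) ρa) (A-cong (⊕-identityʳ 𝟏) (⊕-identityʳ 𝟏))

  ρ⁻¹a⁻¹b : ρ k ⁻¹ ∙ a k ⁻¹ ∙ b k ≡ A (⊖ 𝟏) (⊖ 𝟏) (suc zero)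
  ρ⁻¹a⁻¹b = trans (cong (_∙ b k) ρ⁻¹a⁻¹) (A-cong (⊕-identityʳ (⊖ 𝟏)) (⊕-identityʳ (⊖ 𝟏)))

  -- `T` in coordinates. A `slide` by `𝟏` or `⊖ 𝟏` is excluded because these two steps have become
  -- the `hop`s.
  data Connector : V k → Set where
    rung  : ∀ {j} → j ≢ 𝟎 → Connector (B 𝟎 j zero)
    slant : ∀ {e} → e ≡ 𝟏 ⊎ e ≡ ⊖ 𝟏 → Connector (B 𝟏 e zero)
    slide : ∀ {j} → j ≢ 𝟎 → j ≢ 𝟏 → j ≢ ⊖ 𝟏 → Connector (A j j zero)
    hop   : ∀ {e} → e ≡ 𝟏 ⊎ e ≡ ⊖ 𝟏 → Connector (A e e (suc zero))

  private
    mod≢0 : ∀ i → 1 ≤ i → i ≤ k ∸ 1 → i mod k ≢ 𝟎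
    mod≢0 i 1≤i i≤ eq = ℕ.<⇒≢ 1≤i (sym (trans (sym (m<n⇒m%n≡m i<k)) (trans (sym (Fin.toℕ-fromℕ< (m%n<n i k)))
      (trans (cong toℕ eq) (trans (Fin.toℕ-fromℕ< (m%n<n 0 k)) (m<n⇒m%n≡m (ℕ.≤-trans (s≤s z≤n) 17≤k)))))))
      where
      i<k : i < k
      i<k = ℕ.≤-trans (s≤s i≤) (ℕ.≤-reflexive (ℕ.suc-pred k))

    toℕ≥1 : ∀ {j} → j ≢ 𝟎 → 1 ≤ toℕ j
    toℕ≥1 {j} j≢0 = ℕ.n≢0⇒n>0 λ eq → j≢0 (trans (sym (mod-toℕ k j)) (cong (_mod k) eq))

    toℕ≤k∸1 : ∀ (j : Fin k) → toℕ j ≤ k ∸ 1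
    toℕ≤k∸1 j = ℕ.≤-pred (ℕ.≤-trans (Fin.toℕ<n j) (ℕ.≤-reflexive (sym (ℕ.suc-pred k))))

    B-kept : ∀ {x y z} → ¬ (ρ k ∙ a k ≡ B x y z ⊎ ρ k ⁻¹ ∙ a k ⁻¹ ≡ B x y z)
    B-kept (inj₁ eq) with trans (sym ρa) eq
    ... | ()
    B-kept (inj₂ eq) with trans (sym ρ⁻¹a⁻¹) eq
    ... | ()

  T⇒connector : ∀ {s} → T k s → Connector s
  T⇒connector (inj₂ (inj₁ refl)) = subst Connector (sym ρab) (hop (inj₁ refl))
  T⇒connector (inj₂ (inj₂ refl)) = subst Connector (sym ρ⁻¹a⁻¹b) (hop (inj₂ refl))
  T⇒connector (inj₁ (inj₂ (inj₁ refl) , _)) = subst Connector (sym ρτa) (slant (inj₁ refl))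
  T⇒connector (inj₁ (inj₂ (inj₂ refl) , _)) = subst Connector (sym ρτa⁻¹) (slant (inj₂ refl))
  T⇒connector (inj₁ (inj₁ (i , 1≤i , i≤ , inj₁ refl) , _)) = subst Connector (sym (τa^ i)) (rung (mod≢0 i 1≤i i≤))
  T⇒connector (inj₁ (inj₁ (i , 1≤i , i≤ , inj₂ refl) , s∉)) = subst Connector (sym (ρ^a^ i)) (slide (mod≢0 i 1≤i i≤)
    (λ eq → s∉ (inj₁ (trans ρa (trans (A-cong (sym eq) (sym eq)) (sym (ρ^a^ i))))))
    (λ eq → s∉ (inj₂ (trans ρ⁻¹a⁻¹ (trans (A-cong (sym eq) (sym eq)) (sym (ρ^a^ i)))))))

  connector⇒T : ∀ {s} → Connector s → T k s
  connector⇒T (hop (inj₁ refl)) = inj₂ (inj₁ ρab)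
  connector⇒T (hop (inj₂ refl)) = inj₂ (inj₂ ρ⁻¹a⁻¹b)
  connector⇒T (slant (inj₁ refl)) = inj₁ (inj₂ (inj₁ ρτa) , B-kept)
  connector⇒T (slant (inj₂ refl)) = inj₁ (inj₂ (inj₂ ρτa⁻¹) , B-kept)
  connector⇒T (rung {j} j≢0) =
    inj₁ (inj₁ (toℕ j , toℕ≥1 j≢0 , toℕ≤k∸1 j , inj₁ (sym (trans (τa^ (toℕ j)) (B-cong refl (mod-toℕ k j)))))
    , B-kept)
  connector⇒T (slide {j} j≢0 j≢1 j≢-1) =
    inj₁ (inj₁ (toℕ j , toℕ≥1 j≢0 , toℕ≤k∸1 j , inj₂ (sym (trans (ρ^a^ (toℕ j)) (A-cong (mod-toℕ k j) (mod-toℕ k j)))))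
    , λ { (inj₁ eq) → j≢1 (sym (first (trans (sym ρa) eq))) ; (inj₂ eq) → j≢-1 (sym (first (trans (sym ρ⁻¹a⁻¹) eq))) })
    where
    first : ∀ {x y z x′ y′ z′} → _≡_ {A = V k} (A x y z) (A x′ y′ z′) → x ≡ x′
    first refl = refl

  private
    layer-0 : ∀ z → z ≡ _+ₙ_ 2 z zero
    layer-0 zero       = refl
    layer-0 (suc zero) = refl

    layer-1 : ∀ z → _+ₙ_ 2 z (suc zero) ≡ other z
    layer-1 zero       = refl
    layer-1 (suc zero) = refl

    near-unit : ∀ x {e} → e ≡ 𝟏 ⊎ e ≡ ⊖ 𝟏 → Near x (x ⊕ e)
    near-unit x (inj₁ refl) = inj₁ refl
    near-unit x (inj₂ refl) = inj₂ (sym (pred-suc x))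

    unit-near : ∀ {x e} → Near x (x ⊕ e) → e ≡ 𝟏 ⊎ e ≡ ⊖ 𝟏
    unit-near {x} (inj₁ eq) = inj₁ (⊕-cancelˡ x _ _ eq)
    unit-near {x} {e} (inj₂ eq) = inj₂ (⊕-cancelˡ x _ _ (⊕-cancelʳ 𝟏 _ _ (trans (sym eq) (sym (pred-suc x)))))

    ⊖-unit : ∀ {e} → e ≡ 𝟏 ⊎ e ≡ ⊖ 𝟏 → ⊖ e ≡ 𝟏 ⊎ ⊖ e ≡ ⊖ 𝟏
    ⊖-unit (inj₁ refl) = inj₂ refl
    ⊖-unit (inj₂ refl) = inj₁ (⊖-involutive 𝟏)

    ⊖-unit⁻¹ : ∀ {e} → ⊖ e ≡ 𝟏 ⊎ ⊖ e ≡ ⊖ 𝟏 → e ≡ 𝟏 ⊎ e ≡ ⊖ 𝟏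
    ⊖-unit⁻¹ {e} unit with ⊖-unit unit
    ... | inj₁ eq = inj₁ (trans (sym (⊖-involutive e)) eq)
    ... | inj₂ eq = inj₂ (trans (sym (⊖-involutive e)) eq)

    ⊕-moves : ∀ {y j} → j ≢ 𝟎 → y ≢ y ⊕ j
    ⊕-moves {y} j≢0 eq = j≢0 (⊕-cancelˡ y _ _ (trans (sym eq) (sym (⊕-identityʳ y))))

    no-unit : ∀ {j : Fin k} → j ≢ 𝟏 → j ≢ ⊖ 𝟏 → ¬ (j ≡ 𝟏 ⊎ j ≡ ⊖ 𝟏)
    no-unit j≢1 j≢-1 (inj₁ eq) = j≢1 eq
    no-unit j≢1 j≢-1 (inj₂ eq) = j≢-1 eq

    along : ∀ x y j → x ⊕ (y ⊕ j) ≡ (x ⊕ j) ⊕ y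
    along x y j = solve 3 (λ x y j → x :+ (y :+ j) ⊜ (x :+ j) :+ y) refl x y j

    against : ∀ x y j → x ⊕ y ≡ (x ⊕ (⊖ j)) ⊕ (y ⊕ j)
    against x y j = sym (trans (solve 4 (λ x y j m → (x :+ m) :+ (y :+ j) ⊜ (x :+ y) :+ (m :+ j)) refl x y j (⊖ j))
      (trans (cong ((x ⊕ y) ⊕_) (⊖-inverseˡ j)) (⊕-identityʳ (x ⊕ y))))

  connector⇒N : ∀ u {s} → Connector s → N u (u ∙ s)
  connector⇒N (A x y z) (rung j≢0)   = layer-0 z , inj₁ (sym (⊕-identityʳ x) , ⊕-moves j≢0)
  connector⇒N (A x y z) (slant unit) = layer-0 z , inj₂ (refl , near-unit y unit)
  connector⇒N (A x y z) (slide {j} _ j≢1 j≢-1) =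
    along x y j , inj₁ (layer-0 z , λ near → no-unit j≢1 j≢-1 (unit-near near))
  connector⇒N (A x y z) (hop {e} unit) = along x y e , inj₂ (layer-1 z , near-unit x unit)
  connector⇒N (B x y z) (rung j≢0)   = layer-0 z , inj₁ (sym (trans (cong (x ⊕_) ⊖0≡0) (⊕-identityʳ x)) , ⊕-moves j≢0)
  connector⇒N (B x y z) (slant unit) = layer-0 z , inj₂ (sym (pred-suc x) , near-unit y unit)
  connector⇒N (B x y z) (slide {j} _ j≢1 j≢-1) =
    against x y j , inj₁ (layer-0 z , λ near → no-unit j≢1 j≢-1 (⊖-unit⁻¹ (unit-near near)))
  connector⇒N (B x y z) (hop {e} unit) = against x y e , inj₂ (layer-1 z , near-unit x (⊖-unit unit))

  ¬near-self : ∀ {x} → ¬ Near x x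
  ¬near-self {x} (inj₁ eq) = 1≢0 (⊕-cancelˡ x _ _ (trans (sym eq) (sym (⊕-identityʳ x))))
  ¬near-self {x} (inj₂ eq) = 1≢0 (⊕-cancelˡ x _ _ (trans (sym eq) (sym (⊕-identityʳ x))))

  N-refl : ∀ u → N u u
  N-refl (A x y z) = refl , inj₁ (refl , ¬near-self)
  N-refl (B x y z) = refl , inj₁ (refl , ¬near-self)

  ~⇒N : ∀ {u w} → w ≡ u ⊎ u ~ w → N u w
  ~⇒N {u} (inj₁ refl) = N-refl u
  ~⇒N {u} (inj₂ (s , s∈T , refl)) = connector⇒N u (T⇒connector s∈T)

  private
    coordinates : ∀ {x x′ y y′ z z′ s} → x ≡ x′ → y ≡ y′ → z ≡ z′ →
                  _≡_ {A = V k} (((x , s) , y) , z) (((x′ , s) , y′) , z′)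
    coordinates refl refl refl = refl

    difference : ∀ x x′ → x′ ≡ x ⊕ (x′ ⊝ x)
    difference x x′ = trans (sym (⊝-⊕ x′ x)) (⊕-comm (x′ ⊝ x) x)

    diagonal-difference : ∀ {x y x′ y′} → x ⊕ y′ ≡ x′ ⊕ y → y′ ≡ y ⊕ (x′ ⊝ x)
    diagonal-difference {x} {y} {x′} {y′} eq = by
      (solve 5 (λ x y x′ y′ e → y′ :+ ((x′ :+ y) :+ (x :+ e)) ⊜ (y :+ e) :+ ((x :+ y′) :+ x′)) refl x y x′ y′ (x′ ⊝ x))
      (eq ⊞ difference x x′)

  -- Lower bounds need only that adjacency implies `N`. The converse is for `smallest`, all of whose
  -- guards are on the `A` side.
  N⇒~ : ∀ {x y z} w → N (A x y z) w → w ≡ A x y z ⊎ A x y z ~ w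
  N⇒~ {x} {y} {z} (B x′ y′ z′) (refl , inj₁ (refl , y≢y′)) = inj₂ (_ , connector⇒T (rung {y′ ⊝ y}
    λ eq → y≢y′ (sym (trans (difference y y′) (trans (cong (y ⊕_) eq) (⊕-identityʳ y)))))
    , coordinates (sym (⊕-identityʳ x)) (difference y y′) (layer-0 z))
  N⇒~ {x} {y} {z} (B x′ y′ z′) (refl , inj₂ (refl , near)) = inj₂ (_ , connector⇒T (slant {y′ ⊝ y}
    (unit-near (subst (Near y) (difference y y′) near)))
    , coordinates refl (difference y y′) (layer-0 z))
  N⇒~ {x} {y} {z} (A x′ y′ z′) (eq , inj₂ (z′≡ , near)) = inj₂ (_ , connector⇒T (hop {x′ ⊝ x}
    (unit-near (subst (Near x) (difference x x′) near)))
    , coordinates (difference x x′) (diagonal-difference eq) (trans z′≡ (sym (layer-1 z))))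
  N⇒~ {x} {y} {z} (A x′ y′ z′) (eq , inj₁ (refl , ¬near)) with (x′ ⊝ x) Fin.≟ 𝟎
  ... | yes same = inj₁ (coordinates
    (trans (difference x x′) (trans (cong (x ⊕_) same) (⊕-identityʳ x)))
    (trans (diagonal-difference eq) (trans (cong (y ⊕_) same) (⊕-identityʳ y))) refl)
  ... | no j≢0 = inj₂ (_ , connector⇒T (slide {x′ ⊝ x} j≢0
      (λ e → ¬near (subst (Near x) (sym (difference x x′)) (near-unit x (inj₁ e))))
      (λ e → ¬near (subst (Near x) (sym (difference x x′)) (near-unit x (inj₂ e)))))
    , coordinates (difference x x′) (diagonal-difference eq) (layer-0 z))

-- Sets of guards as families

members : ∀ {m} (p : Subset m) → Fin ∣ p ∣ → Fin m
members (inside  ∷ p) zero    = zero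
members (inside  ∷ p) (suc i) = suc (members p i)
members (outside ∷ p) i       = suc (members p i)

members-∈ : ∀ {m} (p : Subset m) i → members p i Subset.∈ p
members-∈ (inside  ∷ p) zero    = here
members-∈ (inside  ∷ p) (suc i) = there (members-∈ p i)
members-∈ (outside ∷ p) i       = there (members-∈ p i)

members-surjective : ∀ {m} (p : Subset m) {x} → x Subset.∈ p → ∃[ i ] members p i ≡ x
members-surjective (inside  ∷ p) here       = zero , refl
members-surjective (inside  ∷ p) (there x∈) with members-surjective p x∈
... | i , refl = suc i , refl
members-surjective (outside ∷ p) (there x∈) with members-surjective p x∈
... | i , refl = i , refl

∣p∪q∣≤∣p∣+∣q∣ : ∀ {m} (p q : Subset m) → ∣ p ∪ q ∣ ≤ ∣ p ∣ + ∣ q ∣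
∣p∪q∣≤∣p∣+∣q∣ []            []            = z≤n
∣p∪q∣≤∣p∣+∣q∣ (inside  ∷ p) (inside  ∷ q) = s≤s (ℕ.≤-trans (∣p∪q∣≤∣p∣+∣q∣ p q) (ℕ.+-monoʳ-≤ ∣ p ∣ (ℕ.n≤1+n ∣ q ∣)))
∣p∪q∣≤∣p∣+∣q∣ (inside  ∷ p) (outside ∷ q) = s≤s (∣p∪q∣≤∣p∣+∣q∣ p q)
∣p∪q∣≤∣p∣+∣q∣ (outside ∷ p) (inside  ∷ q) =
  ℕ.≤-trans (s≤s (∣p∪q∣≤∣p∣+∣q∣ p q)) (ℕ.≤-reflexive (sym (ℕ.+-suc ∣ p ∣ ∣ q ∣)))
∣p∪q∣≤∣p∣+∣q∣ (outside ∷ p) (outside ∷ q) = ∣p∪q∣≤∣p∣+∣q∣ p q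

image : ∀ {m n} → (Fin n → Fin m) → Subset m
image {n = zero}  f = Subset.⊥
image {n = suc n} f = ⁅ f zero ⁆ ∪ image (f ∘ suc)

∈-image : ∀ {m n} (f : Fin n → Fin m) i → f i Subset.∈ image f
∈-image f zero    = Subset.x∈p∪q⁺ (inj₁ (Subset.x∈⁅x⁆ (f zero)))
∈-image f (suc i) = Subset.x∈p∪q⁺ (inj₂ (∈-image (f ∘ suc) i))

∣image∣≤ : ∀ {m n} (f : Fin n → Fin m) → ∣ image f ∣ ≤ n
∣image∣≤ {m} {zero}  f = ℕ.≤-reflexive (Subset.∣⊥∣≡0 m)
∣image∣≤ {m} {suc n} f = ℕ.≤-trans (∣p∪q∣≤∣p∣+∣q∣ ⁅ f zero ⁆ (image (f ∘ suc)))
  (ℕ.+-mono-≤ (ℕ.≤-reflexive (Subset.∣⁅x⁆∣≡1 (f zero))) (∣image∣≤ (f ∘ suc)))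

module GuardFamilies (Γ : Graph) where

  open Graph Γ
  open Domination Γ
  open Inverse enum using (to; from; strictlyInverseˡ; strictlyInverseʳ)

  guards : (D : VertexSet) → Fin ∣ D ∣ → Vertex
  guards D i = from (members D i)

  guards-∈ : ∀ D i → guards D i ∈ᵛ D
  guards-∈ D i = subst (Subset._∈ D) (sym (strictlyInverseˡ (members D i))) (members-∈ D i)

  guards-surjective : ∀ D {u} → u ∈ᵛ D → ∃[ i ] guards D i ≡ u
  guards-surjective D {u} u∈D with members-surjective D u∈D
  ... | i , eq = i , trans (cong from eq) (strictlyInverseʳ u)

  guards-dominate : ∀ D → Dominating D → ∀ w → ∃[ i ] Dominates (guards D i) w
  guards-dominate D dom w with dom w
  ... | u , u∈D , dominates with guards-surjective D u∈D
  ...   | i , eq = i , subst (λ u → Dominates u w) (sym eq) dominates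

  -- The new positions keep the indices of the old guards, so that a bijection of sets becomes a
  -- pointwise move of families.
  relocate : ∀ {D D′} → Reconfigure D D′ →
    Σ (Fin ∣ D ∣ → Vertex) λ d′ → (∀ i → Dominates (guards D i) (d′ i)) × (∀ {u} → u ∈ᵛ D′ → ∃[ i ] d′ i ≡ u)
  relocate {D} {D′} (f , near) = d′ , (λ i → near (guards D i , guards-∈ D i)) , hit
    where
    open Bijection f using (strictlySurjective) renaming (to to move)
    d′ : Fin ∣ D ∣ → Vertex
    d′ i = proj₁ (move (guards D i , guards-∈ D i))
    hit : ∀ {u} → u ∈ᵛ D′ → ∃[ i ] d′ i ≡ u
    hit {u} u∈D′ with strictlySurjective (u , u∈D′)
    ... | (g , g∈D) , eq with guards-surjective D g∈D
    ...   | i , gi≡g = i , trans (cong (proj₁ ∘ move) (guard-≡ gi≡g)) (cong proj₁ eq)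

  -- The answer to an attack on `w` sends some guard there, and that guard dominated `w` before it
  -- moved.
  eternal⇒dominating : ∀ {𝒟} → EternalDominatingConfiguration 𝒟 → ∀ {D} → 𝒟 D → Dominating D
  eternal⇒dominating conf {D} D∈𝒟 w with ∈ᵛ? w D
  ... | yes w∈D = w , w∈D , inj₁ refl
  ... | no w∉D with EternalDominatingConfiguration.defends conf D D∈𝒟 w w∉D
  ...   | D′ , _ , w∈D′ , f , near with Bijection.strictlySurjective f (w , w∈D′)
  ...     | (u , u∈D) , eq = u , u∈D , subst (Dominates u) (cong proj₁ eq) (near (u , u∈D))

  Undefendable : VertexSet → Set
  Undefendable D = ∃[ v ] (v ∉ᵛ D × (∀ D′ → Dominating D′ → v ∈ᵛ D′ → ¬ Reconfigure D D′))

  undefendable : ∀ D v → (∀ i → guards D i ≢ v) →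
    (∀ (d′ : Fin ∣ D ∣ → Vertex) → (∀ w → ∃[ i ] Dominates (d′ i) w) → (∀ i →
        Dominates (guards D i) (d′ i)) → ∀ j → d′ j ≢ v) →
    Undefendable D
  undefendable D v away unanswered = v , v∉D , ¬answer
    where
    v∉D : v ∉ᵛ D
    v∉D v∈D with guards-surjective D v∈D
    ... | i , eq = away i eq
    ¬answer : ∀ D′ → Dominating D′ → v ∈ᵛ D′ → ¬ Reconfigure D D′
    ¬answer D′ dom′ v∈D′ D⇝D′ with relocate D⇝D′
    ... | d′ , near , hit = unanswered d′ d′-dominates near (proj₁ (hit v∈D′)) (proj₂ (hit v∈D′))
      where
      d′-dominates : ∀ w → ∃[ i ] Dominates (d′ i) w
      d′-dominates w with dom′ w
      ... | u , u∈D′ , dominates with hit u∈D′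
      ...   | i , eq = i , subst (λ u → Dominates u w) (sym eq) dominates

  -- Answers to attacks stay in the configuration, so they are dominating sets again, and these are
  -- the only answers that `Undefendable` excludes.
  eternal-bound : ∀ m → (∀ D → Dominating D → ∣ D ∣ ≤ m → Undefendable D) → suc m ≤ γ∞all
  eternal-bound m attacked = ℕ.≮⇒≥ λ γ∞≤m → ¬small (proj₁ (proj₂ γ∞all-least)) (ℕ.≤-pred γ∞≤m)
    where
    ¬small : EternalDominatingSize γ∞all → ¬ (γ∞all ≤ m)
    ¬small (D , (𝒟 , conf , D∈𝒟) , size) small
      with attacked D (eternal⇒dominating conf D∈𝒟) (ℕ.≤-trans (ℕ.≤-reflexive size) small)
    ... | v , v∉D , ¬answer with EternalDominatingConfiguration.defends conf D D∈𝒟 v v∉D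
    ...   | D′ , D′∈𝒟 , v∈D′ , D⇝D′ = ¬answer D′ (eternal⇒dominating conf D′∈𝒟) v∈D′ D⇝D′

  -- A family with repetitions has a smaller image, which is harmless for an upper bound.
  γ-≤ : ∀ {m} (d : Fin m → Vertex) → (∀ w → ∃[ i ] Dominates (d i) w) → γ ≤ m
  γ-≤ d dom =
    ℕ.≤-trans (proj₂ (proj₂ γ-least) ∣ image (to ∘ d) ∣ (image (to ∘ d) , image-dominating , refl)) (∣image∣≤ (to ∘ d))
    where
    image-dominating : Dominating (image (to ∘ d))
    image-dominating w with dom w
    ... | i , near = d i , ∈-image (to ∘ d) i , near

  ≤-γ : ∀ m → (∀ {n} (d : Fin n → Vertex) → (∀ w → ∃[ i ] Dominates (d i) w) → m ≤ n) → m ≤ γ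
  ≤-γ m bound with proj₁ (proj₂ γ-least)
  ... | D , dom , size = subst (m ≤_) size (bound (guards D) (guards-dominate D dom))

-- The bounds on both domination numbers

module Conclusion (k : ℕ) .{{_ : NonZero k}} (17≤k : 17 ≤ k) (odd : k % 2 ≡ 1) where

  open Adjacency k 17≤k odd
  open Model k C using (N; Dom)
  open Moves k C
  open Domination (Δ k)
  open GuardFamilies (Δ k)

  private
    dominates⇒Dom : ∀ {n} {d : Fin n → V k} → (∀ w → ∃[ i ] Dominates (d i) w) → Dom d
    dominates⇒Dom dom w = proj₁ (dom w) , ~⇒N (proj₂ (dom w))

  small⇒undefendable : ∀ D → Dominating D → ∣ D ∣ ≤ 2 * k + 1 → Undefendable D
  small⇒undefendable D dom size = conclude (attack (guards D) (dominates⇒Dom (guards-dominate D dom)) 17≤k size)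
    where
    conclude : ∃ (Unanswerable (guards D)) → Undefendable D
    conclude (v , away , unanswered) = undefendable D v away
      λ d′ dom′ near → unanswered d′ (dominates⇒Dom dom′) (λ i → ~⇒N (near i))

  smallest-dominating : ∀ w → ∃[ i ] Dominates (smallest i) w
  smallest-dominating w = proj₁ (smallest-dominates w) , N⇒~ w (proj₂ (smallest-dominates w))

  γ-upper : γ ≤ k * 2
  γ-upper = γ-≤ smallest smallest-dominating

  γ-lower : 2 * k ≤ γ
  γ-lower = ≤-γ (2 * k) (λ d dom → dominating-size d (dominates⇒Dom dom) 17≤k)

  γ≡2k : γ ≡ 2 * k
  γ≡2k = ℕ.≤-antisym (subst (γ ≤_) (ℕ.*-comm k 2) γ-upper) γ-lower

  2k+2≤γ∞all : 2 * k + 2 ≤ γ∞all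
  2k+2≤γ∞all = subst (_≤ γ∞all) (sym (ℕ.+-suc (2 * k) 1)) (eternal-bound (2 * k + 1) small⇒undefendable)

theorem5p15 : ∀ (k : ℕ) .{{_ : NonZero k}} → 17 ≤ k → k % 2 ≡ 1 →
    let open Domination (Δ k) in
    (∀ (D : VertexSet) → Dominating D → ∣ D ∣ ≤ 2 * k + 1 →
    ∃[ v ] (v ∉ᵛ D × (∀ (D′ : VertexSet) → Dominating D′ → v ∈ᵛ D′ → ¬ Reconfigure D D′)))
    × 2 * k + 2 ≤ γ∞all
    × 2 * k + 2 ≡ γ + 2
theorem5p15 k 17≤k odd = small⇒undefendable , 2k+2≤γ∞all , cong (_+ 2) (sym γ≡2k)
  where open Conclusion k 17≤k odd
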